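{- There exists an absolute constant $c>0$ such that for all integers $n\ge k\ge 1$ there exists a $k\times n$ MDS matrix with integer entries in $\{ -m,\ldots,m\}$ for some positive integer $m\le (cn/k)^c$.
   Context: For $n\ge k$, a $k\times n$ matrix is called an MDS matrix if any $k$ of its columns are linearly independent; equivalently, every $k\times k$ minor of it is nonsingular. -}

module Defs where

open import Data.Nat using (ℕ; zero; suc)
open import Data.Integer using (ℤ; _+_; _*_; -_; 0ℤ; 1ℤ)
open import Data.Fin using (Fin; zero; suc; punchIn; toℕ)
open import Function.Definitions using (Injective)
open import Relation.Binary.PropositionalEquality using (_≡_; _≢_)

Matrix : ℕ → ℕ → Set
Matrix k n = Fin k → Fin n → ℤ

sumℤ : ∀ {n} → (Fin n → ℤ) → ℤ
sumℤ {zero}  f = 0ℤ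
sumℤ {suc n} f = f zero + sumℤ (λ i → f (suc i))

sign : ℕ → ℤ
sign zero    = 1ℤ
sign (suc j) = - sign j

det : ∀ {n} → Matrix n n → ℤ
det {zero}  A = 1ℤ
det {suc n} A =
  sumℤ (λ j → sign (toℕ j) * A zero j * det (λ r c → A (suc r) (punchIn j c)))

columns : ∀ {k n} → Matrix k n → (Fin k → Fin n) → Matrix k k
columns A cols i j = A i (cols j)

IsMDS : ∀ {k n} → Matrix k n → Set
IsMDS {k} {n} A =
  (cols : Fin k → Fin n) → Injective _≡_ _≡_ cols → det (columns A cols) ≢ 0ℤ

{-# OPTIONS --safe #-}

-- The columns are independent random vectors, each a sum of 2^i independent uniform elements of
-- {1, -1}^k, where 2^i is polynomial in n/k; probabilities are counts in lists with repetition.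
--
-- Doubling the number of summands multiplies the probability of lying in a fixed proper subspace by
-- at most 79/80.  Hence, if A and B are the distributions after 2s and s doublings, every proper
-- subspace U satisfies A(U) ≤ B(U)/T with T exponential in s, and B(U) ≤ T^(-codim U).
--
-- Suppose that the first d of k columns are independent and span U.  If B(U) is below about T^(-k/2),
-- then so is A(U), and the next column is unlikely to lie in U.  Otherwise about k/2 independent
-- vectors can be drawn from B inside U, and they can be exchanged for as many of the d columns; as
-- each exchange gains a factor T, summing over U shows that such U occur with probability at most
-- about (4/T)^(k/2).  This beats the number of choices of k among n columns, which is exponential in
-- k log(n/k).

module Submission where

open import Defs
open import Data.Nat
open import Data.Nat.Properties
open import Data.Nat.Tactic.RingSolver using (solve-∀)
import Data.Integer as ℤ
import Data.Integer.Properties as ℤ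
import Data.Integer.Tactic.RingSolver as ℤSolver
open import Data.Integer using (ℤ; 0ℤ; 1ℤ; -1ℤ; ∣_∣)
open import Data.Fin as Fin using (Fin; zero; suc; inject₁; punchIn; punchOut; toℕ; fromℕ<)
import Data.Fin.Properties as Fin
open import Data.List using (List; []; _∷_; _++_; map; length; cartesianProductWith)
open import Data.List.Properties using (length-map; length-++)
open import Data.List.Relation.Unary.All as All using (All; []; _∷_; all?)
import Data.List.Relation.Unary.All.Properties as All
open import Data.Vec as Vec using (Vec; []; _∷_; tail; zipWith; replicate; lookup; tabulate)
import Data.Vec.Properties as Vec
open import Data.Vec.Relation.Unary.All as VecAll using ([]; _∷_)
import Data.Vec.Relation.Unary.All.Properties as VecAll
open import Data.Product using (∃; ∃₂; _×_; _,_; proj₁; proj₂)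
open import Data.Sum using (_⊎_; inj₁; inj₂; [_,_]′)
open import Data.Unit using (tt)
open import Data.Empty using (⊥-elim)
open import Function using (_∘_; const; id)
open import Function.Definitions using (Injective)
open import Relation.Nullary using (¬_; Dec; yes; no; _×-dec_; ¬?)
open import Relation.Nullary.Decidable using (decidable-stable)
open import Relation.Binary.PropositionalEquality

-- A hyperplane such as x_1 = x_2 contains a random column with a probability of at least about 1/m,
-- polynomial in k/n, while the union bound needs a failure probability exponential in k. So no
-- bound for fixed subspaces can suffice for the last columns: subspaces of large mass have to be
-- seldom spanned rather than seldom hit. The two distributions serve this purpose. Once e vectors
-- of B are placed in U, e of the columns drawn from A are redundant and cost A(U)^e, while the
-- vectors of B supply about B(U)^e; the ratio is at most T^(-e) whatever U is, so no arithmetic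
-- classification of the subspaces is needed.
--
-- The factor 79/80 comes without Fourier analysis: the multiplicities of a doubled symmetric list
-- are an autocorrelation, hence positive definite, and one inequality between three points is
-- enough.
--
-- Budget: for n at most 2^(j+1) k there are at most (8 · 2^j)^k choices of columns, and the
-- argument loses at most 16^k. The product stays below θ^k for θ = 2^(j+8), and T = θ² because only
-- about k/2 factors T are gained.

private variable
  X Y Z : Set
  k m n : ℕ

-- Finite sums

∑ : List X → (X → ℕ) → ℕ
∑ []       f = 0
∑ (x ∷ xs) f = f x + ∑ xs f

infixr 5 ∑
syntax ∑ xs (λ x → e) = ∑[ x ∈ xs ] e

∑-cong-All : ∀ {P : X → Set} {xs} {f g : X → ℕ} → All P xs →
             (∀ x → P x → f x ≡ g x) → ∑ xs f ≡ ∑ xs g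
∑-cong-All []         eq = refl
∑-cong-All (px ∷ pxs) eq = cong₂ _+_ (eq _ px) (∑-cong-All pxs eq)

∑-cong : ∀ (xs : List X) {f g : X → ℕ} → (∀ x → f x ≡ g x) → ∑ xs f ≡ ∑ xs g
∑-cong []       eq = refl
∑-cong (x ∷ xs) eq = cong₂ _+_ (eq x) (∑-cong xs eq)

∑-mono : ∀ (xs : List X) {f g : X → ℕ} → (∀ x → f x ≤ g x) → ∑ xs f ≤ ∑ xs g
∑-mono []       le = z≤n
∑-mono (x ∷ xs) le = +-mono-≤ (le x) (∑-mono xs le)

∑-mono-All : ∀ {P : X → Set} {xs} {f g : X → ℕ} → All P xs →
             (∀ x → P x → f x ≤ g x) → ∑ xs f ≤ ∑ xs g
∑-mono-All []         le = z≤n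
∑-mono-All (px ∷ pxs) le = +-mono-≤ (le _ px) (∑-mono-All pxs le)

∑-+ : ∀ (xs : List X) (f g : X → ℕ) → ∑[ x ∈ xs ] (f x + g x) ≡ ∑ xs f + ∑ xs g
∑-+ []       f g = refl
∑-+ (x ∷ xs) f g rewrite ∑-+ xs f g = lem (f x) (g x) (∑ xs f) (∑ xs g)
  where
  lem : ∀ a b c d → a + b + (c + d) ≡ a + c + (b + d)
  lem = solve-∀

∑-*ˡ : ∀ (xs : List X) c (f : X → ℕ) → ∑[ x ∈ xs ] (c * f x) ≡ c * ∑ xs f
∑-*ˡ []       c f = sym (*-zeroʳ c)
∑-*ˡ (x ∷ xs) c f rewrite ∑-*ˡ xs c f = sym (*-distribˡ-+ c (f x) _)

∑-*ʳ : ∀ (xs : List X) c (f : X → ℕ) → ∑[ x ∈ xs ] (f x * c) ≡ ∑ xs f * c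
∑-*ʳ xs c f = begin
  (∑[ x ∈ xs ] (f x * c)) ≡⟨ ∑-cong xs (λ x → *-comm (f x) c) ⟩
  (∑[ x ∈ xs ] (c * f x)) ≡⟨ ∑-*ˡ xs c f ⟩
  c * ∑ xs f              ≡⟨ *-comm c _ ⟩
  ∑ xs f * c              ∎
  where open ≡-Reasoning

∑-const : ∀ (xs : List X) c → ∑[ _ ∈ xs ] c ≡ length xs * c
∑-const []       c = refl
∑-const (x ∷ xs) c = cong (c +_) (∑-const xs c)

∑-one : ∀ (xs : List X) → ∑[ _ ∈ xs ] 1 ≡ length xs
∑-one xs = trans (∑-const xs 1) (*-identityʳ _)

∑-zero : ∀ (xs : List X) → ∑[ _ ∈ xs ] 0 ≡ 0
∑-zero xs = trans (∑-const xs 0) (*-zeroʳ (length xs))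

∑-≤-const : ∀ (xs : List X) {f : X → ℕ} {c} → (∀ x → f x ≤ c) → ∑ xs f ≤ length xs * c
∑-≤-const xs le = ≤-trans (∑-mono xs le) (≤-reflexive (∑-const xs _))

∑-swap : ∀ (xs : List X) (ys : List Y) (f : X → Y → ℕ) →
         ∑[ x ∈ xs ] ∑[ y ∈ ys ] f x y ≡ ∑[ y ∈ ys ] ∑[ x ∈ xs ] f x y
∑-swap []       ys f = sym (∑-zero ys)
∑-swap (x ∷ xs) ys f rewrite ∑-swap xs ys f = sym (∑-+ ys (f x) _)

∑-++ : ∀ (xs ys : List X) (f : X → ℕ) → ∑ (xs ++ ys) f ≡ ∑ xs f + ∑ ys f
∑-++ []       ys f = refl
∑-++ (x ∷ xs) ys f rewrite ∑-++ xs ys f = sym (+-assoc (f x) _ _)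

∑-map : ∀ (g : X → Y) xs (f : Y → ℕ) → ∑ (map g xs) f ≡ ∑[ x ∈ xs ] f (g x)
∑-map g []       f = refl
∑-map g (x ∷ xs) f = cong (f (g x) +_) (∑-map g xs f)

∑-cartesianProductWith : ∀ (g : X → Y → Z) xs ys (f : Z → ℕ) →
  ∑ (cartesianProductWith g xs ys) f ≡ ∑[ x ∈ xs ] ∑[ y ∈ ys ] f (g x y)
∑-cartesianProductWith g []       ys f = refl
∑-cartesianProductWith g (x ∷ xs) ys f = begin
  ∑ (map (g x) ys ++ cartesianProductWith g xs ys) f
    ≡⟨ ∑-++ (map (g x) ys) _ f ⟩
  ∑ (map (g x) ys) f + ∑ (cartesianProductWith g xs ys) f
    ≡⟨ cong₂ _+_ (∑-map (g x) ys f) (∑-cartesianProductWith g xs ys f) ⟩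
  _ ∎
  where open ≡-Reasoning

-- The first-moment method: natural numbers that are all nonzero add up to at least their number.
∑<length⇒∃-zero : ∀ {P : X → Set} {xs} (f : X → ℕ) → All P xs → ∑ xs f < length xs →
                  ∃ λ x → P x × f x ≡ 0
∑<length⇒∃-zero {xs = x ∷ xs} f (px ∷ pxs) lt with f x in eq
... | zero  = x , px , eq
... | suc m = ∑<length⇒∃-zero f pxs (≤-trans (s≤s (m≤n+m _ m)) (s≤s⁻¹ lt))

∑≡0⇒All-zero : ∀ (xs : List X) (f : X → ℕ) → ∑ xs f ≡ 0 → All (λ x → f x ≡ 0) xs
∑≡0⇒All-zero []       f eq = []
∑≡0⇒All-zero (x ∷ xs) f eq = m+n≡0⇒m≡0 (f x) eq ∷ ∑≡0⇒All-zero xs f (m+n≡0⇒n≡0 (f x) eq)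

-- Indicators of decidable propositions

ι : {P : Set} → Dec P → ℕ
ι (yes _) = 1
ι (no _)  = 0

ι≤1 : {P : Set} (p : Dec P) → ι p ≤ 1
ι≤1 (yes _) = ≤-refl
ι≤1 (no _)  = z≤n

ι-yes : {P : Set} (p : Dec P) → P → ι p ≡ 1
ι-yes (yes _) _ = refl
ι-yes (no ¬p) p = ⊥-elim (¬p p)

ι-no : {P : Set} (p : Dec P) → ¬ P → ι p ≡ 0
ι-no (yes p) ¬p = ⊥-elim (¬p p)
ι-no (no _)  _  = refl

ι-mono : {P Q : Set} (p : Dec P) (q : Dec Q) → (P → Q) → ι p ≤ ι q
ι-mono (no _)  q f = z≤n
ι-mono (yes p) q f = ≤-reflexive (sym (ι-yes q (f p)))

ι-cong : {P Q : Set} (p : Dec P) (q : Dec Q) → (P → Q) → (Q → P) → ι p ≡ ι q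
ι-cong p q f g = ≤-antisym (ι-mono p q f) (ι-mono q p g)

ι*-cong : {P : Set} (p : Dec P) {m n : ℕ} → (P → m ≡ n) → ι p * m ≡ ι p * n
ι*-cong (yes p) eq = cong (_+ 0) (eq p)
ι*-cong (no _)  _  = refl

ι*-mono : {P : Set} (p : Dec P) {m n : ℕ} → (P → m ≤ n) → ι p * m ≤ ι p * n
ι*-mono (yes p) le = +-monoˡ-≤ 0 (le p)
ι*-mono (no _)  _  = z≤n

ι³-mono : {P Q R S T : Set} (p : Dec P) (q : Dec Q) (r : Dec R) (s : Dec S) (t : Dec T) →
          (P → Q → R → S × T) → ι p * ι q * ι r ≤ ι s * ι t
ι³-mono (no _)  q       r       s t f = z≤n
ι³-mono (yes p) (no _)  r       s t f = z≤n
ι³-mono (yes p) (yes q) (no _)  s t f = z≤n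
ι³-mono (yes p) (yes q) (yes r) s t f =
  ≤-reflexive (sym (cong₂ _*_ (ι-yes s (proj₁ (f p q r))) (ι-yes t (proj₂ (f p q r)))))

-- Independent draws

tuples : List X → ∀ n → List (Vec X n)
tuples xs zero    = [] ∷ []
tuples xs (suc n) = cartesianProductWith _∷_ xs (tuples xs n)

∑-tuples : ∀ (xs : List X) n (f : Vec X (suc n) → ℕ) →
           ∑ (tuples xs (suc n)) f ≡ ∑[ x ∈ xs ] ∑[ v ∈ tuples xs n ] f (x ∷ v)
∑-tuples xs n f = ∑-cartesianProductWith _∷_ xs (tuples xs n) f

length-tuples : ∀ (xs : List X) n → length (tuples xs n) ≡ length xs ^ n
length-tuples xs zero    = refl
length-tuples xs (suc n) = begin
  length (tuples xs (suc n))                  ≡⟨ ∑-one (tuples xs (suc n)) ⟨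
  (∑[ _ ∈ tuples xs (suc n) ] 1)              ≡⟨ ∑-tuples xs n _ ⟩
  (∑[ _ ∈ xs ] ∑[ _ ∈ tuples xs n ] 1)        ≡⟨ ∑-const xs _ ⟩
  length xs * (∑[ _ ∈ tuples xs n ] 1)
    ≡⟨ cong (length xs *_) (trans (∑-one (tuples xs n)) (length-tuples xs n)) ⟩
  length xs ^ suc n                           ∎
  where open ≡-Reasoning

All-cartesianProductWith : ∀ {P : X → Set} {Q : Y → Set} {R : Z → Set} (g : X → Y → Z) {xs ys} →
  (∀ {x y} → P x → Q y → R (g x y)) → All P xs → All Q ys → All R (cartesianProductWith g xs ys)
All-cartesianProductWith g f []         qs = []
All-cartesianProductWith g f (px ∷ pxs) qs =
  All.++⁺ (All.map⁺ (All.map (f px) qs)) (All-cartesianProductWith g f pxs qs)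

All-tuples : ∀ {P : X → Set} {xs} → All P xs → ∀ n → All (VecAll.All P) (tuples xs n)
All-tuples pxs zero    = VecAll.[] ∷ []
All-tuples pxs (suc n) = All-cartesianProductWith _∷_ VecAll._∷_ pxs (All-tuples pxs n)

^-distribʳ-* : ∀ n a b → (a * b) ^ n ≡ a ^ n * b ^ n
^-distribʳ-* zero    a b = refl
^-distribʳ-* (suc n) a b rewrite ^-distribʳ-* n a b = lem a b (a ^ n) (b ^ n)
  where
  lem : ∀ a b x y → a * b * (x * y) ≡ a * x * (b * y)
  lem = solve-∀

-- Doubling a symmetric multiset of integers

count : ℤ → List ℤ → ℕ
count a V = ∑[ v ∈ V ] ι (v ℤ.≟ a)

∑-ι≟ : ∀ (W : List ℤ) s (f : ℤ → ℕ) → ∑[ t ∈ W ] (ι (t ℤ.≟ s) * f t) ≡ count s W * f s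
∑-ι≟ W s f = begin
  (∑[ t ∈ W ] (ι (t ℤ.≟ s) * f t)) ≡⟨ ∑-cong W (λ t → ι*-cong (t ℤ.≟ s) (cong f)) ⟩
  (∑[ t ∈ W ] (ι (t ℤ.≟ s) * f s)) ≡⟨ ∑-*ʳ W (f s) _ ⟩
  count s W * f s                  ∎
  where open ≡-Reasoning

Symmetric : List ℤ → Set
Symmetric V = ∀ F → ∑ V F ≡ ∑[ v ∈ V ] F (ℤ.- v)

-- Stated through test functions, so that only multiplicities count: the lists `values w` double in
-- this sense although their order differs from that of the list of pairwise sums.
_DoubleOf_ : List ℤ → List ℤ → Set
V' DoubleOf V = ∀ F → ∑ V' F ≡ ∑[ u ∈ V ] ∑[ v ∈ V ] F (u ℤ.+ v)

-- Positive definiteness of the multiplicity function, tested on the vector (1, 1, -2).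
Positive : List ℤ → Set
Positive V = ∀ a b → 2 * count a V + 2 * count b V ≤ 3 * count 0ℤ V + count (a ℤ.+ b) V

length-double : ∀ V V' → V' DoubleOf V → length V' ≡ length V * length V
length-double V V' dbl = begin
  length V'                       ≡⟨ ∑-one V' ⟨
  (∑[ _ ∈ V' ] 1)                 ≡⟨ dbl (const 1) ⟩
  (∑[ _ ∈ V ] ∑[ _ ∈ V ] 1)       ≡⟨ ∑-const V _ ⟩
  length V * (∑[ _ ∈ V ] 1)       ≡⟨ cong (length V *_) (∑-one V) ⟩
  length V * length V             ∎
  where open ≡-Reasoning

double-symmetric : ∀ V V' → Symmetric V → V' DoubleOf V → Symmetric V'
double-symmetric V V' sm dbl F = begin
  ∑ V' F                                                      ≡⟨ dbl F ⟩
  (∑[ u ∈ V ] ∑[ v ∈ V ] F (u ℤ.+ v))                         ≡⟨ sm _ ⟩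
  (∑[ u ∈ V ] ∑[ v ∈ V ] F (ℤ.- u ℤ.+ v))                     ≡⟨ ∑-cong V (λ u → sm _) ⟩
  (∑[ u ∈ V ] ∑[ v ∈ V ] F (ℤ.- u ℤ.+ ℤ.- v))
    ≡⟨ ∑-cong V (λ u → ∑-cong V (λ v → cong F (sym (ℤ.neg-distrib-+ u v)))) ⟩
  (∑[ u ∈ V ] ∑[ v ∈ V ] F (ℤ.- (u ℤ.+ v)))                   ≡⟨ dbl _ ⟨
  (∑[ v ∈ V' ] F (ℤ.- v))                                     ∎
  where open ≡-Reasoning

count-neg : ∀ V → Symmetric V → ∀ a → count (ℤ.- a) V ≡ count a V
count-neg V sm a = trans (sm _) (∑-cong V λ v → ι-cong (ℤ.- v ℤ.≟ ℤ.- a) (v ℤ.≟ a) ℤ.neg-injective (cong (λ x → ℤ.- x)))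

-- By symmetry, pairs with sum zero are as many as pairs of equal elements.
count-double-0 : ∀ V V' → Symmetric V → V' DoubleOf V → count 0ℤ V' ≡ ∑[ v ∈ V ] count v V
count-double-0 V V' sm dbl = begin
  count 0ℤ V'                                          ≡⟨ dbl _ ⟩
  (∑[ u ∈ V ] ∑[ v ∈ V ] ι (u ℤ.+ v ℤ.≟ 0ℤ))           ≡⟨ ∑-cong V (λ u → ∑-cong V (λ v → lem u v)) ⟩
  (∑[ u ∈ V ] count (ℤ.- u) V)                         ≡⟨ ∑-cong V (count-neg V sm) ⟩
  (∑[ u ∈ V ] count u V)                               ∎
  where
  open ≡-Reasoning
  lem : ∀ u v → ι (u ℤ.+ v ℤ.≟ 0ℤ) ≡ ι (v ℤ.≟ ℤ.- u)
  lem u v = ι-cong (u ℤ.+ v ℤ.≟ 0ℤ) (v ℤ.≟ ℤ.- u) (to u v)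
    (λ { refl → ℤ.+-inverseʳ u })
    where
    aux : ∀ u v → v ≡ ℤ.- u ℤ.+ (u ℤ.+ v)
    aux = ℤSolver.solve-∀
    to : ∀ u v → u ℤ.+ v ≡ 0ℤ → v ≡ ℤ.- u
    to u v eq = trans (aux u v) (trans (cong (ℤ._+_ (ℤ.- u)) eq) (ℤ.+-identityʳ _))

-- Lets a finite sum stand for a sum over all integers of a function supported on `L`.
window : ∀ L → ∃ λ W → (∀ t → count t W ≤ 1) × All (λ t → count t W ≡ 1) L
window [] = [] , (λ _ → z≤n) , []
window (s ∷ L) with window L
... | W , le , eqs with count s W in eq
...   | suc m = W , le , trans eq (cong suc (n<1⇒n≡0 (subst (_≤ 1) eq (le s)))) ∷ eqs
...   | zero  = s ∷ W , le' , trans (cong₂ _+_ (ι-yes (s ℤ.≟ s) refl) eq) refl ∷ All.map eq' eqs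
  where
  le' : ∀ t → count t (s ∷ W) ≤ 1
  le' t with s ℤ.≟ t
  ... | yes refl = ≤-reflexive (cong suc eq)
  ... | no _     = le t
  eq' : ∀ {t} → count t W ≡ 1 → count t (s ∷ W) ≡ 1
  eq' {t} e with s ℤ.≟ t
  ... | yes refl = ⊥-elim (0≢1+n (trans (sym eq) e))
  ... | no _     = e

2xy≤x²+y² : ∀ x y → 2 * (x * y) ≤ x * x + y * y
2xy≤x²+y² x y with ≤-total x y
... | inj₁ x≤y = subst (λ y → 2 * (x * y) ≤ x * x + y * y) (m+[n∸m]≡n x≤y) (lem x (y ∸ x))
  where
  expand : ∀ x d → x * x + (x + d) * (x + d) ≡ 2 * (x * (x + d)) + d * d
  expand = solve-∀
  lem : ∀ x d → 2 * (x * (x + d)) ≤ x * x + (x + d) * (x + d)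
  lem x d = subst (2 * (x * (x + d)) ≤_) (sym (expand x d)) (m≤m+n _ _)
... | inj₂ y≤x = subst (λ x → 2 * (x * y) ≤ x * x + y * y) (m+[n∸m]≡n y≤x) (lem y (x ∸ y))
  where
  expand : ∀ y d → (y + d) * (y + d) + y * y ≡ 2 * ((y + d) * y) + d * d
  expand = solve-∀
  lem : ∀ y d → 2 * ((y + d) * y) ≤ (y + d) * (y + d) + y * y
  lem y d = subst (2 * ((y + d) * y) ≤_) (sym (expand y d)) (m≤m+n _ _)

module _ (V V' : List ℤ) (sm : Symmetric V) (dbl : V' DoubleOf V) where

  -- The sum counts pairs `v`, `u` in `V` with `v - u = a - b`, and symmetry turns the difference
  -- into a sum. Thus the multiplicities of `V'` are the autocorrelation of those of `V`.
  correlation : ∀ W a b → All (λ v → count (v ℤ.- a) W ≡ 1) V →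
    ∑[ t ∈ W ] (count (t ℤ.+ a) V * count (t ℤ.+ b) V) ≡ count (a ℤ.- b) V'
  correlation W a b covers = begin
    (∑[ t ∈ W ] (count (t ℤ.+ a) V * count (t ℤ.+ b) V))
      ≡⟨ ∑-cong W (λ t → sym (∑-*ʳ V (count (t ℤ.+ b) V) _)) ⟩
    (∑[ t ∈ W ] ∑[ v ∈ V ] (ι (v ℤ.≟ t ℤ.+ a) * count (t ℤ.+ b) V))
      ≡⟨ ∑-swap W V _ ⟩
    (∑[ v ∈ V ] ∑[ t ∈ W ] (ι (v ℤ.≟ t ℤ.+ a) * count (t ℤ.+ b) V))
      ≡⟨ ∑-cong V (λ v → ∑-cong W (λ t → cong (_* count (t ℤ.+ b) V)
           (ι-cong (v ℤ.≟ t ℤ.+ a) (t ℤ.≟ v ℤ.- a) (λ { refl → to t a }) (λ { refl → from v a })))) ⟩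
    (∑[ v ∈ V ] ∑[ t ∈ W ] (ι (t ℤ.≟ v ℤ.- a) * count (t ℤ.+ b) V))
      ≡⟨ ∑-cong V (λ v → ∑-ι≟ W (v ℤ.- a) _) ⟩
    (∑[ v ∈ V ] (count (v ℤ.- a) W * count (v ℤ.- a ℤ.+ b) V))
      ≡⟨ ∑-cong-All covers (λ v e → trans (cong (_* count (v ℤ.- a ℤ.+ b) V) e) (*-identityˡ _)) ⟩
    (∑[ v ∈ V ] count (v ℤ.- a ℤ.+ b) V)
      ≡⟨ ∑-cong V (λ v → ∑-cong V (λ u →
           ι-cong (u ℤ.≟ v ℤ.- a ℤ.+ b) (v ℤ.+ ℤ.- u ℤ.≟ a ℤ.- b) (λ { refl → to′ v a b }) (from′ u v))) ⟩
    (∑[ v ∈ V ] ∑[ u ∈ V ] ι (v ℤ.+ ℤ.- u ℤ.≟ a ℤ.- b))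
      ≡⟨ ∑-cong V (λ v → sm _) ⟨
    (∑[ v ∈ V ] ∑[ u ∈ V ] ι (v ℤ.+ u ℤ.≟ a ℤ.- b))
      ≡⟨ dbl _ ⟨
    count (a ℤ.- b) V' ∎
    where
    open ≡-Reasoning
    to : ∀ t a → t ≡ t ℤ.+ a ℤ.- a
    to = ℤSolver.solve-∀
    from : ∀ v a → v ≡ v ℤ.- a ℤ.+ a
    from = ℤSolver.solve-∀
    to′ : ∀ v a b → v ℤ.+ ℤ.- (v ℤ.- a ℤ.+ b) ≡ a ℤ.- b
    to′ = ℤSolver.solve-∀
    aux₁ : ∀ u v → u ≡ v ℤ.- (v ℤ.+ ℤ.- u)
    aux₁ = ℤSolver.solve-∀
    aux₂ : ∀ v a b → v ℤ.- (a ℤ.- b) ≡ v ℤ.- a ℤ.+ b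
    aux₂ = ℤSolver.solve-∀
    from′ : ∀ u v → v ℤ.+ ℤ.- u ≡ a ℤ.- b → u ≡ v ℤ.- a ℤ.+ b
    from′ u v eq = trans (aux₁ u v) (trans (cong (ℤ._-_ v) eq) (aux₂ v a b))

  -- Sum (A + B - 2C)² ≥ 0 over t, where A, B, C are the multiplicities of t + a, t - b and t in V.
  double-positive : Positive V'
  double-positive a b with window (map (ℤ._- a) V ++ (map (ℤ._- (ℤ.- b)) V ++ map (ℤ._- 0ℤ) V))
  ... | W , _ , covers = *-cancelˡ-≤ 2 (subst₂ _≤_ lhs rhs (∑-mono W pointwise))
    where
    coverA = All.map⁻ (All.++⁻ˡ (map (ℤ._- a) V) covers)
    coverB = All.map⁻ (All.++⁻ˡ (map (ℤ._- (ℤ.- b)) V) (All.++⁻ʳ (map (ℤ._- a) V) covers))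
    coverC = All.map⁻ (All.++⁻ʳ (map (ℤ._- (ℤ.- b)) V) (All.++⁻ʳ (map (ℤ._- a) V) covers))
    A B C : ℤ → ℕ
    A t = count (t ℤ.+ a) V
    B t = count (t ℤ.+ ℤ.- b) V
    C t = count (t ℤ.+ 0ℤ) V
    pointwise : ∀ t → 4 * (A t * C t) + 4 * (C t * B t) ≤
                      A t * A t + B t * B t + 4 * (C t * C t) + 2 * (A t * B t)
    pointwise t = subst₂ _≤_ (e₁ (A t) (B t) (C t)) (e₂ (A t) (B t) (C t)) (2xy≤x²+y² (A t + B t) (2 * C t))
      where
      e₁ : ∀ x y z → 2 * ((x + y) * (2 * z)) ≡ 4 * (x * z) + 4 * (z * y)
      e₁ = solve-∀
      e₂ : ∀ x y z → (x + y) * (x + y) + 2 * z * (2 * z) ≡ x * x + y * y + 4 * (z * z) + 2 * (x * y)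
      e₂ = solve-∀
    p : ℤ → ℕ
    p c = count c V'
    corr : ∀ a b c → a ℤ.- b ≡ c → All (λ v → count (v ℤ.- a) W ≡ 1) V →
           ∑[ t ∈ W ] (count (t ℤ.+ a) V * count (t ℤ.+ b) V) ≡ p c
    corr a b c eq cov = trans (correlation W a b cov) (cong p eq)
    lhs : ∑[ t ∈ W ] (4 * (A t * C t) + 4 * (C t * B t)) ≡ 2 * (2 * p a + 2 * p b)
    lhs = begin
      (∑[ t ∈ W ] (4 * (A t * C t) + 4 * (C t * B t)))
        ≡⟨ ∑-+ W _ _ ⟩
      (∑[ t ∈ W ] (4 * (A t * C t))) + (∑[ t ∈ W ] (4 * (C t * B t)))
        ≡⟨ cong₂ _+_ (∑-*ˡ W 4 _) (∑-*ˡ W 4 _) ⟩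
      4 * (∑[ t ∈ W ] (A t * C t)) + 4 * (∑[ t ∈ W ] (C t * B t))
        ≡⟨ cong₂ (λ x y → 4 * x + 4 * y) (corr a 0ℤ a (i a) coverA) (corr 0ℤ (ℤ.- b) b (ii b) coverC) ⟩
      4 * p a + 4 * p b
        ≡⟨ iii (p a) (p b) ⟩
      2 * (2 * p a + 2 * p b) ∎
      where
      open ≡-Reasoning
      i : ∀ a → a ℤ.- 0ℤ ≡ a
      i = ℤSolver.solve-∀
      ii : ∀ b → 0ℤ ℤ.- (ℤ.- b) ≡ b
      ii = ℤSolver.solve-∀
      iii : ∀ x y → 4 * x + 4 * y ≡ 2 * (2 * x + 2 * y)
      iii = solve-∀
    rhs : ∑[ t ∈ W ] (A t * A t + B t * B t + 4 * (C t * C t) + 2 * (A t * B t)) ≡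
          2 * (3 * p 0ℤ + p (a ℤ.+ b))
    rhs = begin
      (∑[ t ∈ W ] (A t * A t + B t * B t + 4 * (C t * C t) + 2 * (A t * B t)))
        ≡⟨ trans (∑-+ W _ _) (cong₂ _+_ (trans (∑-+ W _ _) (cong₂ _+_ (∑-+ W _ _) (∑-*ˡ W 4 _))) (∑-*ˡ W 2 _)) ⟩
      (∑[ t ∈ W ] (A t * A t)) + (∑[ t ∈ W ] (B t * B t)) + 4 * (∑[ t ∈ W ] (C t * C t)) + 2 * (∑[ t ∈ W ] (A t * B t))
        ≡⟨ cong₂ _+_ (cong₂ _+_ (cong₂ _+_ (corr a a 0ℤ (ℤ.+-inverseʳ a) coverA) (corr (ℤ.- b) (ℤ.- b) 0ℤ (ℤ.+-inverseʳ (ℤ.- b)) coverB))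
             (cong (4 *_) (corr 0ℤ 0ℤ 0ℤ refl coverC)))
             (cong (2 *_) (corr a (ℤ.- b) (a ℤ.+ b) (i a b) coverA)) ⟩
      p 0ℤ + p 0ℤ + 4 * p 0ℤ + 2 * p (a ℤ.+ b)
        ≡⟨ ii (p 0ℤ) (p (a ℤ.+ b)) ⟩
      2 * (3 * p 0ℤ + p (a ℤ.+ b)) ∎
      where
      open ≡-Reasoning
      i : ∀ a b → a ℤ.- (ℤ.- b) ≡ a ℤ.+ b
      i = ℤSolver.solve-∀
      ii : ∀ x y → x + x + 4 * x + 2 * y ≡ 2 * (3 * x + y)
      ii = solve-∀

-- `Positive` is applied to the pair `a`, `- a`, whose sum is zero.
count≤count-0 : ∀ V → Symmetric V → Positive V → ∀ a → count a V ≤ count 0ℤ V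
count≤count-0 V sm pos a = *-cancelˡ-≤ 4 (begin
  4 * p a                       ≡⟨ e₁ (p a) ⟩
  2 * p a + 2 * p a             ≡⟨ cong (λ x → 2 * p a + 2 * x) (count-neg V sm a) ⟨
  2 * p a + 2 * p (ℤ.- a)       ≤⟨ pos a (ℤ.- a) ⟩
  3 * p 0ℤ + p (a ℤ.+ ℤ.- a)    ≡⟨ cong (λ x → 3 * p 0ℤ + p x) (ℤ.+-inverseʳ a) ⟩
  3 * p 0ℤ + p 0ℤ               ≡⟨ e₂ (p 0ℤ) ⟩
  4 * p 0ℤ                      ∎)
  where
  open ≤-Reasoning
  p : ℤ → ℕ
  p c = count c V
  e₁ : ∀ x → 4 * x ≡ 2 * x + 2 * x
  e₁ = solve-∀
  e₂ : ∀ x → 3 * x + x ≡ 4 * x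
  e₂ = solve-∀

-- `P 0ℤ` supplies a starting value, so `M` exists even if no element of `V` satisfies `P`.
maximal : ∀ {P : ℤ → Set} → (∀ v → Dec (P v)) → P 0ℤ → ∀ V →
          ∃ λ M → P M × 0ℤ ℤ.≤ M × All (λ v → P v → v ℤ.≤ M) V
maximal P? p0 [] = 0ℤ , p0 , ℤ.≤-refl , []
maximal P? p0 (v ∷ V) with maximal P? p0 V
... | M , pM , 0≤M , le with P? v ×-dec (M ℤ.≤? v)
...   | yes (pv , M≤v) = v , pv , ℤ.≤-trans 0≤M M≤v , (λ _ → ℤ.≤-refl) ∷ All.map (λ f p → ℤ.≤-trans (f p) M≤v) le
...   | no ¬pv = M , pM , 0≤M , (λ pv → ℤ.<⇒≤ (ℤ.≰⇒> (λ M≤v → ¬pv (pv , M≤v)))) ∷ le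

-- Call a popular if count a V ≥ 7/8 count 0 V, and let M be the largest popular element.  For popular
-- a > 0, positivity gives count (a + M) V ≥ 1/2 count 0 V although a + M is not popular.  So a tenth of
-- V is unpopular, which costs a factor 1 - 1/80.
module _ (V : List ℤ) (sm : Symmetric V) (pos : Positive V) (half : 2 * count 0ℤ V ≤ length V) where
  private
    p : ℤ → ℕ
    p c = count c V
    δ = p 0ℤ
    N = length V
    Popular : ℤ → Set
    Popular a = 7 * δ ≤ 8 * p a
    pop? : ∀ a → Dec (Popular a)
    pop? a = 7 * δ ≤? 8 * p a
    out posP : ℕ
    out  = ∑[ v ∈ V ] ι (¬? (pop? v))
    pos? : ∀ v → Dec (0ℤ ℤ.< v × Popular v)
    pos? v = (0ℤ ℤ.<? v) ×-dec pop? v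
    posP = ∑[ v ∈ V ] ι (pos? v)
    pop0 : Popular 0ℤ
    pop0 = *-monoˡ-≤ δ {7} {8} (n≤1+n 7)
    max = maximal pop? pop0 V
    M = proj₁ max
    popM : Popular M
    popM = proj₁ (proj₂ max)

    p[a+M] : ∀ a → Popular a → δ ≤ 2 * p (a ℤ.+ M)
    p[a+M] a pa = *-cancelˡ-≤ 4 (+-cancelˡ-≤ (24 * δ) _ _ (begin
      24 * δ + 4 * δ                           ≡⟨ e₁ δ ⟩
      2 * (7 * δ) + 2 * (7 * δ)                ≤⟨ +-mono-≤ (*-monoʳ-≤ 2 pa) (*-monoʳ-≤ 2 popM) ⟩
      2 * (8 * p a) + 2 * (8 * p M)            ≡⟨ e₂ (p a) (p M) ⟩
      8 * (2 * p a + 2 * p M)                  ≤⟨ *-monoʳ-≤ 8 (pos a M) ⟩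
      8 * (3 * δ + p (a ℤ.+ M))                ≡⟨ e₃ δ (p (a ℤ.+ M)) ⟩
      24 * δ + 4 * (2 * p (a ℤ.+ M))           ∎))
      where
      open ≤-Reasoning
      e₁ : ∀ x → 24 * x + 4 * x ≡ 2 * (7 * x) + 2 * (7 * x)
      e₁ = solve-∀
      e₂ : ∀ x y → 2 * (8 * x) + 2 * (8 * y) ≡ 8 * (2 * x + 2 * y)
      e₂ = solve-∀
      e₃ : ∀ x y → 8 * (3 * x + y) ≡ 24 * x + 4 * (2 * y)
      e₃ = solve-∀

    -- Double counting along the shift `v ↦ v + M`: each positive popular `v` meets at least `δ / 2`
    -- unpopular elements equal to `v + M`, and each unpopular `u` is met only from `u - M`, which
    -- has multiplicity at most `δ`.
    δ*posP≤ : δ * posP ≤ δ * (2 * out)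
    δ*posP≤ = begin
      δ * posP
        ≡⟨ *-comm δ posP ⟩
      posP * δ
        ≡⟨ ∑-*ʳ V δ _ ⟨
      (∑[ v ∈ V ] (ι (pos? v) * δ))
        ≤⟨ ∑-mono V (λ v → ι*-mono (pos? v) (λ q → p[a+M] v (proj₂ q))) ⟩
      (∑[ v ∈ V ] (ι (pos? v) * (2 * p (v ℤ.+ M))))
        ≡⟨ ∑-cong V (λ v → e₁ (ι (pos? v)) (p (v ℤ.+ M))) ⟩
      (∑[ v ∈ V ] (2 * (ι (pos? v) * p (v ℤ.+ M))))
        ≡⟨ ∑-*ˡ V 2 _ ⟩
      2 * (∑[ v ∈ V ] (ι (pos? v) * p (v ℤ.+ M)))
        ≡⟨ cong (2 *_) (∑-cong V (λ v → sym (∑-*ˡ V (ι (pos? v)) _))) ⟩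
      2 * (∑[ v ∈ V ] ∑[ u ∈ V ] (ι (pos? v) * ι (u ℤ.≟ v ℤ.+ M)))
        ≡⟨ cong (2 *_) (∑-swap V V _) ⟩
      2 * (∑[ u ∈ V ] ∑[ v ∈ V ] (ι (pos? v) * ι (u ℤ.≟ v ℤ.+ M)))
        ≤⟨ *-monoʳ-≤ 2 (∑-mono-All (proj₂ (proj₂ (proj₂ max))) (λ u le → ∑-mono V (λ v → escape u v le))) ⟩
      2 * (∑[ u ∈ V ] ∑[ v ∈ V ] (ι (¬? (pop? u)) * ι (v ℤ.≟ u ℤ.- M)))
        ≡⟨ cong (2 *_) (∑-cong V (λ u → ∑-*ˡ V (ι (¬? (pop? u))) _)) ⟩
      2 * (∑[ u ∈ V ] (ι (¬? (pop? u)) * p (u ℤ.- M)))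
        ≤⟨ *-monoʳ-≤ 2 (∑-mono V (λ u → *-monoʳ-≤ (ι (¬? (pop? u))) (count≤count-0 V sm pos (u ℤ.- M)))) ⟩
      2 * (∑[ u ∈ V ] (ι (¬? (pop? u)) * δ))
        ≡⟨ cong (2 *_) (∑-*ʳ V δ _) ⟩
      2 * (out * δ)
        ≡⟨ e₂ out δ ⟩
      δ * (2 * out) ∎
      where
      open ≤-Reasoning
      e₁ : ∀ x y → x * (2 * y) ≡ 2 * (x * y)
      e₁ = solve-∀
      e₂ : ∀ x y → 2 * (x * y) ≡ y * (2 * x)
      e₂ = solve-∀
      e₃ : ∀ v M → v ≡ v ℤ.+ M ℤ.- M
      e₃ = ℤSolver.solve-∀
      escape : ∀ u v → (Popular u → u ℤ.≤ M) →
               ι (pos? v) * ι (u ℤ.≟ v ℤ.+ M) ≤ ι (¬? (pop? u)) * ι (v ℤ.≟ u ℤ.- M)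
      escape u v le with pos? v
      ... | no _ = z≤n
      ... | yes (0<v , pv) with u ℤ.≟ v ℤ.+ M
      ...   | no _ = z≤n
      ...   | yes refl = ≤-reflexive (sym (cong₂ _*_ (ι-yes (¬? (pop? u)) unpop) (ι-yes (v ℤ.≟ u ℤ.- M) (e₃ v M))))
        where
        unpop : ¬ Popular (v ℤ.+ M)
        unpop q = ℤ.<⇒≱ (ℤ.+-monoˡ-< M 0<v) (ℤ.≤-trans (le q) (ℤ.≤-reflexive (sym (ℤ.+-identityˡ M))))

    -- By symmetry the negative popular elements are as many as the positive ones, and `δ` accounts
    -- for zero.
    split : N ≤ out + 2 * posP + δ
    split = begin
      N                      ≡⟨ ∑-one V ⟨
      (∑[ _ ∈ V ] 1)         ≤⟨ ∑-mono V pointwise ⟩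
      (∑[ v ∈ V ] (ι (¬? (pop? v)) + (ι (pos? v) + ι (pos? (ℤ.- v))) + ι (v ℤ.≟ 0ℤ)))
        ≡⟨ trans (∑-+ V _ _) (cong (_+ δ) (trans (∑-+ V _ _) (cong (out +_) (∑-+ V _ _)))) ⟩
      out + (posP + (∑[ v ∈ V ] ι (pos? (ℤ.- v)))) + δ
        ≡⟨ cong (λ x → out + (posP + x) + δ) (sym (sm _)) ⟩
      out + (posP + posP) + δ
        ≡⟨ cong (λ x → out + (posP + x) + δ) (+-identityʳ posP) ⟨
      out + 2 * posP + δ ∎
      where
      open ≤-Reasoning
      pointwise : ∀ v → 1 ≤ ι (¬? (pop? v)) + (ι (pos? v) + ι (pos? (ℤ.- v))) + ι (v ℤ.≟ 0ℤ)
      pointwise v with pop? v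
      ... | no ¬q = s≤s z≤n
      ... | yes q with v
      ...   | ℤ.+ zero = m≤n+m 1 (ι (pos? 0ℤ) + ι (pos? 0ℤ))
      ...   | ℤ.+[1+ n ] = s≤s z≤n
      ...   | ℤ.-[1+ n ] with ι (pos? (ℤ.+[1+ n ])) | ι-yes (pos? (ℤ.+[1+ n ]))
               (ℤ.+<+ (s≤s z≤n) , subst (λ x → 7 * δ ≤ 8 * x) (sym (count-neg V sm (ℤ.-[1+ n ]))) q)
      ...     | _ | refl = s≤s z≤n

    -- Every multiplicity is at most `δ`, and an unpopular one falls short of that by an eighth.
    loss : 8 * (∑[ v ∈ V ] p v) + out * δ ≤ 8 * (N * δ)
    loss = begin
      8 * (∑[ v ∈ V ] p v) + out * δ
        ≡⟨ cong₂ _+_ (sym (∑-*ˡ V 8 _)) (sym (∑-*ʳ V δ _)) ⟩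
      (∑[ v ∈ V ] (8 * p v)) + (∑[ v ∈ V ] (ι (¬? (pop? v)) * δ))
        ≡⟨ ∑-+ V _ _ ⟨
      (∑[ v ∈ V ] (8 * p v + ι (¬? (pop? v)) * δ))
        ≤⟨ ∑-≤-const V pointwise ⟩
      N * (8 * δ)
        ≡⟨ e N δ ⟩
      8 * (N * δ) ∎
      where
      open ≤-Reasoning
      e : ∀ x y → x * (8 * y) ≡ 8 * (x * y)
      e = solve-∀
      e′ : ∀ x → 7 * x + 1 * x ≡ 8 * x
      e′ = solve-∀
      pointwise : ∀ v → 8 * p v + ι (¬? (pop? v)) * δ ≤ 8 * δ
      pointwise v with pop? v
      ... | yes _ = ≤-trans (≤-reflexive (+-identityʳ _)) (*-monoʳ-≤ 8 (count≤count-0 V sm pos v))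
      ... | no ¬q = ≤-trans (+-monoˡ-≤ (1 * δ) (<⇒≤ (≰⇒> ¬q))) (≤-reflexive (e′ δ))

  ∑-count≤ : 80 * (∑[ v ∈ V ] count v V) ≤ 79 * (count 0ℤ V * length V)
  ∑-count≤ = +-cancelʳ-≤ (δ * N) _ _ (begin
    80 * Σp + δ * N              ≤⟨ +-monoʳ-≤ (80 * Σp) δN≤ ⟩
    80 * Σp + δ * (10 * out)     ≡⟨ e₁ Σp δ out ⟩
    10 * (8 * Σp + out * δ)      ≤⟨ *-monoʳ-≤ 10 loss ⟩
    10 * (8 * (N * δ))           ≡⟨ e₂ N δ ⟩
    79 * (δ * N) + δ * N         ∎)
    where
    open ≤-Reasoning
    Σp = ∑[ v ∈ V ] p v
    e₁ : ∀ x y z → 80 * x + y * (10 * z) ≡ 10 * (8 * x + z * y)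
    e₁ = solve-∀
    e₂ : ∀ x y → 10 * (8 * (x * y)) ≡ 79 * (y * x) + y * x
    e₂ = solve-∀
    e₃ : ∀ δ o q s → δ * (2 * (o + 2 * q + s)) ≡ 2 * (δ * o) + 4 * (δ * q) + δ * (2 * s)
    e₃ = solve-∀
    e₄ : ∀ δ o n → 2 * (δ * o) + 4 * (δ * (2 * o)) + δ * n ≡ δ * (10 * o) + δ * n
    e₄ = solve-∀
    e₅ : ∀ δ n → δ * n + δ * n ≡ δ * (2 * n)
    e₅ = solve-∀
    -- `N ≤ out + 4 out + N / 2`, that is `N ≤ 10 out`. All is multiplied by `δ`, so that `δ = 0`
    -- needs no separate case.
    δN≤ : δ * N ≤ δ * (10 * out)
    δN≤ = +-cancelʳ-≤ (δ * N) _ _ (begin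
      δ * N + δ * N                                   ≡⟨ e₅ δ N ⟩
      δ * (2 * N)                                     ≤⟨ *-monoʳ-≤ δ (*-monoʳ-≤ 2 split) ⟩
      δ * (2 * (out + 2 * posP + δ))                  ≡⟨ e₃ δ out posP δ ⟩
      2 * (δ * out) + 4 * (δ * posP) + δ * (2 * δ)
        ≤⟨ +-mono-≤ (+-monoʳ-≤ (2 * (δ * out)) (*-monoʳ-≤ 4 δ*posP≤)) (*-monoʳ-≤ δ half) ⟩
      2 * (δ * out) + 4 * (δ * (2 * out)) + δ * N     ≡⟨ e₄ δ out N ⟩
      δ * (10 * out) + δ * N                          ∎)

-- Linear algebra by elimination

Vector : ℕ → Set
Vector = Vec ℤ

infix 7 _·_
_·_ : Vector k → Vector k → ℤ
[]      · []      = 0ℤ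
(a ∷ u) · (b ∷ v) = a ℤ.* b ℤ.+ u · v

𝟎 : Vector k
𝟎 = replicate _ 0ℤ

comb : ℤ → Vector k → ℤ → Vector k → Vector k
comb a u b v = zipWith (λ x y → a ℤ.* x ℤ.+ b ℤ.* y) u v

·-comm : ∀ (u v : Vector k) → u · v ≡ v · u
·-comm []      []      = refl
·-comm (a ∷ u) (b ∷ v) = cong₂ ℤ._+_ (ℤ.*-comm a b) (·-comm u v)

·-comb : ∀ (q : Vector k) a u b v → q · comb a u b v ≡ a ℤ.* (q · u) ℤ.+ b ℤ.* (q · v)
·-comb []      a []      b []      = sym (cong₂ ℤ._+_ (ℤ.*-zeroʳ a) (ℤ.*-zeroʳ b))
·-comb (c ∷ q) a (x ∷ u) b (y ∷ v) rewrite ·-comb q a u b v = lem a b c x y (q · u) (q · v)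
  where
  lem : ∀ a b c x y s t → c ℤ.* (a ℤ.* x ℤ.+ b ℤ.* y) ℤ.+ (a ℤ.* s ℤ.+ b ℤ.* t) ≡
        a ℤ.* (c ℤ.* x ℤ.+ s) ℤ.+ b ℤ.* (c ℤ.* y ℤ.+ t)
  lem = ℤSolver.solve-∀

comb-· : ∀ a (u : Vector k) b v q → comb a u b v · q ≡ a ℤ.* (u · q) ℤ.+ b ℤ.* (v · q)
comb-· a u b v q = begin
  comb a u b v · q                          ≡⟨ ·-comm (comb a u b v) q ⟩
  q · comb a u b v                          ≡⟨ ·-comb q a u b v ⟩
  a ℤ.* (q · u) ℤ.+ b ℤ.* (q · v)           ≡⟨ cong₂ (λ s t → a ℤ.* s ℤ.+ b ℤ.* t) (·-comm q u) (·-comm q v) ⟩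
  a ℤ.* (u · q) ℤ.+ b ℤ.* (v · q)           ∎
  where open ≡-Reasoning

·-𝟎 : ∀ (q : Vector k) → q · 𝟎 ≡ 0ℤ
·-𝟎 []      = refl
·-𝟎 (a ∷ q) = cong₂ ℤ._+_ (ℤ.*-zeroʳ a) (·-𝟎 q)

*≡0⇒≡0 : ∀ {a b} → a ≢ 0ℤ → a ℤ.* b ≡ 0ℤ → b ≡ 0ℤ
*≡0⇒≡0 {a} a≢0 eq = [ (λ a≡0 → ⊥-elim (a≢0 a≡0)) , id ]′ (ℤ.i*j≡0⇒i≡0∨j≡0 a eq)

combination-vanishes : ∀ {s t} a b → s ≡ 0ℤ → t ≡ 0ℤ → a ℤ.* s ℤ.+ b ℤ.* t ≡ 0ℤ
combination-vanishes a b refl refl = cong₂ ℤ._+_ (ℤ.*-zeroʳ a) (ℤ.*-zeroʳ b)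

combination-cancels : ∀ {s t} a b → a ≢ 0ℤ → t ≡ 0ℤ → a ℤ.* s ℤ.+ b ℤ.* t ≡ 0ℤ → s ≡ 0ℤ
combination-cancels {s} a b a≢0 refl eq = *≡0⇒≡0 a≢0 (begin
  a ℤ.* s                 ≡⟨ ℤ.+-identityʳ _ ⟨
  a ℤ.* s ℤ.+ 0ℤ          ≡⟨ cong (ℤ._+_ (a ℤ.* s)) (ℤ.*-zeroʳ b) ⟨
  a ℤ.* s ℤ.+ b ℤ.* 0ℤ    ≡⟨ eq ⟩
  0ℤ                      ∎)
  where open ≡-Reasoning

-- A list of functionals stands for the subspace of the vectors that they all kill.
Rows : ℕ → Set
Rows k = List (Vector k)

Ker : Rows k → Vector k → Set
Ker Q z = All (λ q → q · z ≡ 0ℤ) Q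

ker? : ∀ (Q : Rows k) z → Dec (Ker Q z)
ker? Q z = all? (λ q → q · z ℤ.≟ 0ℤ) Q

-- Elimination without division: the result vanishes at `x`, and on the kernel of the pivot `q` it
-- is `q'` times the nonzero number `q · x`.
eliminate : Vector k → Vector k → Vector k → Vector k
eliminate x q q' = comb (q · x) q' (ℤ.- (q' · x)) q

-- Adds x to the subspace.
step : Vector k → Rows k → Rows k
step x []      = []
step x (q ∷ Q) with q · x ℤ.≟ 0ℤ
... | yes _ = q ∷ step x Q
... | no _  = map (eliminate x q) Q

eliminate-· : ∀ (x q q' z : Vector k) →
  eliminate x q q' · z ≡ (q · x) ℤ.* (q' · z) ℤ.+ ℤ.- (q' · x) ℤ.* (q · z)
eliminate-· x q q' z = comb-· (q · x) q' (ℤ.- (q' · x)) q z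

step-ker : ∀ (x : Vector k) {Q} → Ker Q x → step x Q ≡ Q
step-ker x {[]}    []         = refl
step-ker x {q ∷ Q} (qx ∷ Qx) with q · x ℤ.≟ 0ℤ
... | yes _    = cong (q ∷_) (step-ker x Qx)
... | no qx≢0 = ⊥-elim (qx≢0 qx)

length-step : ∀ (x : Vector k) Q → ¬ Ker Q x → suc (length (step x Q)) ≡ length Q
length-step x []      x∉Q = ⊥-elim (x∉Q [])
length-step x (q ∷ Q) x∉Q with q · x ℤ.≟ 0ℤ
... | yes qx = cong suc (length-step x Q (λ Qx → x∉Q (qx ∷ Qx)))
... | no _   = cong suc (length-map (eliminate x q) Q)

Ker⊆Ker-step : ∀ (x : Vector k) {Q z} → Ker Q z → Ker (step x Q) z
Ker⊆Ker-step x {[]}    []         = []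
Ker⊆Ker-step x {q ∷ Q} {z} (qz ∷ Qz) with q · x ℤ.≟ 0ℤ
... | yes _ = qz ∷ Ker⊆Ker-step x Qz
... | no _  = All.map⁺ (All.map (λ {q'} q'z → trans (eliminate-· x q q' z)
                (combination-vanishes (q · x) (ℤ.- (q' · x)) q'z qz)) Qz)

Ker-step-self : ∀ (x : Vector k) Q → Ker (step x Q) x
Ker-step-self x []      = []
Ker-step-self x (q ∷ Q) with q · x ℤ.≟ 0ℤ
... | yes qx = qx ∷ Ker-step-self x Q
... | no _   = All.map⁺ (All.universal (λ q' → trans (eliminate-· x q q' x) (lem (q · x) (q' · x))) Q)
  where
  lem : ∀ a b → a ℤ.* b ℤ.+ ℤ.- b ℤ.* a ≡ 0ℤ
  lem = ℤSolver.solve-∀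

Ker-comb⁻ : ∀ (Q : Rows k) a b {z x} → a ≢ 0ℤ → Ker Q x → Ker Q (comb a z b x) → Ker Q z
Ker-comb⁻ Q a b {z} {x} a≢0 Qx Qzx = All.zipWith
  (λ {q} (qx , qzx) → combination-cancels a b a≢0 qx (trans (sym (·-comb q a z b x)) qzx)) (Qx , Qzx)

Ker-step⁺ : ∀ (x : Vector k) {Q z} a b → a ≢ 0ℤ → Ker Q (comb a z b x) → Ker (step x Q) z
Ker-step⁺ x {Q} a b a≢0 Qzx = Ker-comb⁻ (step x Q) a b a≢0 (Ker-step-self x Q) (Ker⊆Ker-step x Qzx)

-- Over the rationals `z` differs from the old subspace by a multiple of `x`; `a` clears the
-- denominator.
Ker-step⁻ : ∀ (x : Vector k) Q {z} → Ker (step x Q) z → ∃₂ λ a b → a ≢ 0ℤ × Ker Q (comb a z b x)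
Ker-step⁻ x []      _ = 1ℤ , 0ℤ , (λ ()) , []
Ker-step⁻ x (q ∷ Q) {z} Qz with q · x ℤ.≟ 0ℤ
Ker-step⁻ x (q ∷ Q) {z} (qz ∷ Qz) | yes qx with Ker-step⁻ x Q Qz
... | a , b , a≢0 , Qzx = a , b , a≢0 , trans (·-comb q a z b x) (combination-vanishes a b qz qx) ∷ Qzx
Ker-step⁻ x (q ∷ Q) {z} Qz | no qx≢0 = q · x , ℤ.- (q · z) , qx≢0 ,
  trans (·-comb q (q · x) z (ℤ.- (q · z)) x) (i (q · x) (q · z)) ∷
  All.map (λ {q'} e → trans (·-comb q' (q · x) z (ℤ.- (q · z)) x)
    (trans (ii (q · x) (q · z) (q' · z) (q' · x)) (trans (sym (eliminate-· x q q' z)) e))) (All.map⁻ Qz)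
  where
  i : ∀ a b → a ℤ.* b ℤ.+ ℤ.- b ℤ.* a ≡ 0ℤ
  i = ℤSolver.solve-∀
  ii : ∀ a b c d → a ℤ.* c ℤ.+ ℤ.- b ℤ.* d ≡ a ℤ.* c ℤ.+ ℤ.- d ℤ.* b
  ii = ℤSolver.solve-∀

infix 4 _≈_
-- The length is the codimension only for independent functionals, so it is recorded beside the
-- kernels.
record _≈_ (Q Q' : Rows k) : Set where
  constructor mk≈
  field
    to     : ∀ {z} → Ker Q z → Ker Q' z
    from   : ∀ {z} → Ker Q' z → Ker Q z
    length≡ : length Q ≡ length Q'
open _≈_ public

≈-refl : {Q : Rows k} → Q ≈ Q
≈-refl = mk≈ id id refl

≈-reflexive : {Q Q' : Rows k} → Q ≡ Q' → Q ≈ Q'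
≈-reflexive refl = ≈-refl

≈-sym : {Q Q' : Rows k} → Q ≈ Q' → Q' ≈ Q
≈-sym (mk≈ f g e) = mk≈ g f (sym e)

≈-trans : {Q Q' Q'' : Rows k} → Q ≈ Q' → Q' ≈ Q'' → Q ≈ Q''
≈-trans (mk≈ f g e) (mk≈ f' g' e') = mk≈ (f' ∘ f) (g ∘ g') (trans e e')

step-⊆ : ∀ (x : Vector k) {Q Q'} → (∀ {z} → Ker Q z → Ker Q' z) → ∀ {z} → Ker (step x Q) z → Ker (step x Q') z
step-⊆ x {Q} f Qz with Ker-step⁻ x Q Qz
... | a , b , a≢0 , Qzx = Ker-step⁺ x a b a≢0 (f Qzx)

step-≈ : ∀ (x : Vector k) {Q Q'} → Q ≈ Q' → step x Q ≈ step x Q'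
step-≈ x {Q} {Q'} Q≈Q'@(mk≈ f g e) with ker? Q x
... | yes Qx = ≈-trans (≈-reflexive (step-ker x Qx)) (≈-trans Q≈Q' (≈-reflexive (sym (step-ker x (f Qx)))))
... | no x∉Q = mk≈ (step-⊆ x f) (step-⊆ x g)
  (suc-injective (trans (length-step x Q x∉Q) (trans e (sym (length-step x Q' (x∉Q ∘ g))))))

Ker-swap : ∀ (x y : Vector k) Q {z} → Ker (step x (step y Q)) z → Ker (step y (step x Q)) z
Ker-swap x y Q {z} Qz with Ker-step⁻ x (step y Q) Qz
... | a , b , a≢0 , Qzx with Ker-step⁻ y Q Qzx
...   | c , d , c≢0 , Qzxy = Ker-comb⁻ Q' a b a≢0 (Ker⊆Ker-step y (Ker-step-self x Q))
        (Ker-comb⁻ Q' c d c≢0 (Ker-step-self y (step x Q)) (Ker⊆Ker-step y (Ker⊆Ker-step x Qzxy)))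
  where Q' = step y (step x Q)

-- Steinitz exchange: in the relation between `x` and `y` modulo the subspace, the coefficient of
-- `y` is nonzero because `x` lies outside.
exchange : ∀ (x y : Vector k) Q → ¬ Ker Q x → Ker (step y Q) x → Ker (step x Q) y
exchange x y Q x∉Q Qx with Ker-step⁻ y Q Qx
... | a , b , a≢0 , Qxy = Ker-step⁺ x b a b≢0
        (All.map (λ {q} e → trans (·-comb q b y a x) (trans (ℤ.+-comm (b ℤ.* (q · y)) _) (trans (sym (·-comb q a x b y)) e))) Qxy)
  where
  b≢0 : b ≢ 0ℤ
  b≢0 refl = x∉Q (All.map (λ {q} e → *≡0⇒≡0 a≢0 (trans (sym (ℤ.+-identityʳ _)) (trans (sym (·-comb q a x 0ℤ y)) e))) Qxy)

-- For the lengths `exchange` is decisive: if both vectors are new, then `x` is still new after `y`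
-- exactly when `y` is still new after `x`.
step-swap : ∀ (x y : Vector k) Q → step x (step y Q) ≈ step y (step x Q)
step-swap x y Q = mk≈ (Ker-swap x y Q) (Ker-swap y x Q) len
  where
  len : length (step x (step y Q)) ≡ length (step y (step x Q))
  len with ker? Q x | ker? Q y
  ... | yes Qx | _ = cong length (trans (step-ker x (Ker⊆Ker-step y Qx)) (cong (step y) (sym (step-ker x Qx))))
  ... | no _ | yes Qy = cong length (trans (cong (step x) (step-ker y Qy)) (sym (step-ker y (Ker⊆Ker-step x Qy))))
  ... | no x∉Q | no y∉Q with ker? (step y Q) x
  ...   | yes Qx = suc-injective (trans (cong (suc ∘ length) (step-ker x Qx)) (trans (length-step y Q y∉Q)
                     (sym (trans (cong (suc ∘ length) (step-ker y (exchange x y Q x∉Q Qx))) (length-step x Q x∉Q)))))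
  ...   | no x∉ = suc-injective (suc-injective (trans (cong suc (length-step x (step y Q) x∉)) (trans (length-step y Q y∉Q)
                     (sym (trans (cong suc (length-step y (step x Q) (x∉ ∘ exchange y x Q y∉Q))) (length-step x Q x∉Q))))))

-- The vectors are added from right to left.
run : Rows k → Vec (Vector k) m → Rows k
run Q []       = Q
run Q (x ∷ xs) = step x (run Q xs)

step-run : ∀ x Q (ys : Vec (Vector k) m) → step x (run Q ys) ≈ run (step x Q) ys
step-run x Q []       = ≈-refl
step-run x Q (y ∷ ys) = ≈-trans (step-swap x y (run Q ys)) (step-≈ y (step-run x Q ys))

run-swap : ∀ Q (xs : Vec (Vector k) m) (ys : Vec (Vector k) n) → run (run Q ys) xs ≈ run (run Q xs) ys
run-swap Q []       ys = ≈-refl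
run-swap Q (x ∷ xs) ys = ≈-trans (step-≈ x (run-swap Q xs ys)) (step-run x (run Q xs) ys)

length≤length-run : ∀ Q (xs : Vec (Vector k) m) → length Q ≤ length (run Q xs) + m
length≤length-run Q []       = ≤-reflexive (sym (+-identityʳ _))
length≤length-run {m = suc m} Q (x ∷ xs) with ker? (run Q xs) x
... | yes Qx rewrite step-ker x Qx = ≤-trans (length≤length-run Q xs) (+-monoʳ-≤ (length (run Q xs)) (n≤1+n m))
... | no x∉Q = ≤-trans (length≤length-run Q xs)
                 (≤-reflexive (trans (cong (_+ m) (sym (length-step x (run Q xs) x∉Q))) (sym (+-suc _ m))))

-- A dual system: nonzero pairings on the diagonal, zero ones off it. This witness of linear
-- independence survives elimination and projection by explicit formulas.
data DualTo {k} : Rows k → Rows k → Set where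
  []  : DualTo [] []
  _∷_ : ∀ {q u Q U} → q · u ≢ 0ℤ × All (λ q' → q' · u ≡ 0ℤ) Q × All (λ u' → q · u' ≡ 0ℤ) U →
        DualTo Q U → DualTo (q ∷ Q) (u ∷ U)

Independent : Rows k → Set
Independent Q = ∃ (DualTo Q)

-- The pivot `q` kills the remaining dual vectors, so on them elimination only multiplies by
-- `q · x`.
eliminate-dual : ∀ (x q : Vector k) {Q U} → q · x ≢ 0ℤ → All (λ u → q · u ≡ 0ℤ) U →
                 DualTo Q U → DualTo (map (eliminate x q) Q) U
eliminate-dual x q qx≢0 [] [] = []
eliminate-dual x q qx≢0 (qu ∷ qU) (_∷_ {q = q'} {u} (q'u≢0 , Qu , q'U) dual) =
  ((λ e → q'u≢0 (combination-cancels (q · x) (ℤ.- (q' · x)) qx≢0 qu (trans (sym (eliminate-· x q q' u)) e)))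
  , All.map⁺ (All.map (λ {q''} e → trans (eliminate-· x q q'' u) (combination-vanishes (q · x) (ℤ.- (q'' · x)) e qu)) Qu)
  , All.zipWith (λ {u'} (e , e') → trans (eliminate-· x q q' u') (combination-vanishes (q · x) (ℤ.- (q' · x)) e' e)) (qU , q'U))
  ∷ eliminate-dual x q qx≢0 qU dual

dropDual : Vector k → Rows k → Rows k → Rows k
dropDual x (q ∷ Q) (u ∷ U) with q · x ℤ.≟ 0ℤ
... | yes _ = u ∷ dropDual x Q U
... | no _  = U
dropDual x _ _ = []

All-dropDual : ∀ {P : Vector k → Set} x Q {U} → All P U → All P (dropDual x Q U)
All-dropDual x []      pU = []
All-dropDual x (q ∷ Q) []        = []
All-dropDual x (q ∷ Q) (pu ∷ pU) with q · x ℤ.≟ 0ℤ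
... | yes _ = pu ∷ All-dropDual x Q pU
... | no _  = pU

step-dual : ∀ (x : Vector k) {Q U} → DualTo Q U → DualTo (step x Q) (dropDual x Q U)
step-dual x [] = []
step-dual x {q ∷ Q} ((qu≢0 , Qu , qU) ∷ dual) with q · x ℤ.≟ 0ℤ
... | yes _   = (qu≢0 , Ker⊆Ker-step x Qu , All-dropDual x Q qU) ∷ step-dual x dual
... | no qx≢0 = eliminate-dual x q qx≢0 qU dual

step-independent : ∀ (x : Vector k) {Q} → Independent Q → Independent (step x Q)
step-independent x {Q} (U , dual) = dropDual x Q U , step-dual x dual

run-independent : ∀ {Q : Rows k} (xs : Vec (Vector k) m) → Independent Q → Independent (run Q xs)
run-independent []       ind = ind
run-independent (x ∷ xs) ind = step-independent x (run-independent xs ind)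

-- The zero subspace and annihilators

basis : ∀ k → Rows k
basis zero    = []
basis (suc k) = (1ℤ ∷ 𝟎) ∷ map (0ℤ ∷_) (basis k)

length-basis : ∀ k → length (basis k) ≡ k
length-basis zero    = refl
length-basis (suc k) = cong suc (trans (length-map _ (basis k)) (length-basis k))

𝟎-· : ∀ (q : Vector k) → 𝟎 · q ≡ 0ℤ
𝟎-· q = trans (·-comm 𝟎 q) (·-𝟎 q)

basis-independent : ∀ k → Independent (basis k)
basis-independent k = basis k , self k
  where
  shift : ∀ {k} {Q U : Rows k} → DualTo Q U → DualTo (map (0ℤ ∷_) Q) (map (0ℤ ∷_) U)
  shift [] = []
  shift ((qu≢0 , Qu , qU) ∷ dual) =
    ((λ e → qu≢0 (trans (sym (ℤ.+-identityˡ _)) e))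
    , All.map⁺ (All.map (trans (ℤ.+-identityˡ _)) Qu)
    , All.map⁺ (All.map (trans (ℤ.+-identityˡ _)) qU)) ∷ shift dual
  self : ∀ k → DualTo (basis k) (basis k)
  self zero    = []
  self (suc k) =
    ((λ e → 1≢0 (trans (cong (ℤ._+_ 1ℤ) (sym (·-𝟎 (𝟎 {k})))) e))
    , All.map⁺ (All.universal (λ q → trans (ℤ.+-identityˡ _) (·-𝟎 q)) (basis k))
    , All.map⁺ (All.universal (λ q → trans (ℤ.+-identityˡ _) (𝟎-· q)) (basis k))) ∷ shift (self k)
    where
    1≢0 : 1ℤ ≢ 0ℤ
    1≢0 ()

basis-· : ∀ {k} {w : Vector k} → All (λ e → w · e ≡ 0ℤ) (basis k) → w ≡ 𝟎
basis-· {zero}  {[]}    _ = refl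
basis-· {suc k} {a ∷ w} (e ∷ es) = cong₂ _∷_ (trans (sym (lem a)) (trans (cong (ℤ._+_ (a ℤ.* 1ℤ)) (sym (·-𝟎 w))) e))
    (basis-· (All.map (λ {u} e → trans (sym (trans (cong (ℤ._+ (w · u)) (ℤ.*-zeroʳ a)) (ℤ.+-identityˡ _))) e) (All.map⁻ es)))
  where
  lem : ∀ a → a ℤ.* 1ℤ ℤ.+ 0ℤ ≡ a
  lem = ℤSolver.solve-∀

Ker-basis : ∀ {k} {z : Vector k} → Ker (basis k) z → z ≡ 𝟎
Ker-basis {z = z} Qz = basis-· (All.map (λ {q} e → trans (·-comm z q) e) Qz)

-- The kernel is indeed the span of `xs`: it grows from zero by one vector at a time, and by
-- `Ker-step⁻` nothing else enters.
annihilator : ∀ (w : Vector k) (xs : Vec (Vector k) m) → VecAll.All (λ x → w · x ≡ 0ℤ) xs →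
              ∀ {z} → Ker (run (basis k) xs) z → w · z ≡ 0ℤ
annihilator w []       []         Qz = trans (cong (w ·_) (Ker-basis Qz)) (·-𝟎 w)
annihilator w (x ∷ xs) (wx ∷ wxs) {z} Qz with Ker-step⁻ x (run (basis _) xs) Qz
... | a , b , a≢0 , Qzx = combination-cancels a b a≢0 wx
        (trans (sym (·-comb w a z b x)) (annihilator w xs wxs Qzx))

-- With no functional left the span is everything, in particular it contains the unit vectors.
run≡[]⇒annihilator≡𝟎 : ∀ (w : Vector k) (xs : Vec (Vector k) m) → VecAll.All (λ x → w · x ≡ 0ℤ) xs →
                        length (run (basis k) xs) ≡ 0 → w ≡ 𝟎
run≡[]⇒annihilator≡𝟎 {k} w xs wxs len =
  basis-· (All.universal (λ e → annihilator w xs wxs (killed (run (basis k) xs) len)) (basis k))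
  where
  killed : ∀ (Q : Rows k) {z} → length Q ≡ 0 → Ker Q z
  killed [] _ = []

-- Sums of random sign vectors and proper subspaces

e₀ : Vector (suc k)
e₀ = 1ℤ ∷ 𝟎

·-e₀ : ∀ h (t : Vector k) → (h ∷ t) · e₀ ≡ h
·-e₀ h t = trans (cong₂ ℤ._+_ (ℤ.*-identityʳ h) (·-𝟎 t)) (ℤ.+-identityʳ h)

tail-· : ∀ (q u : Vector (suc k)) → q · e₀ ≡ 0ℤ → tail q · tail u ≡ q · u
tail-· (h ∷ q) (a ∷ u) qe rewrite trans (sym (·-e₀ h q)) qe = sym (ℤ.+-identityˡ _)

Ker-tail⁻ : ∀ {Q : Rows (suc k)} {a x} → Ker Q e₀ → Ker Q (a ∷ x) → Ker (map tail Q) x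
Ker-tail⁻ {a = a} {x} Qe Qax = All.map⁺ (All.zipWith (λ {q} (e , e') → trans (tail-· q (a ∷ x) e) e') (Qe , Qax))

tail-dual : ∀ {Q U : Rows (suc k)} → Ker Q e₀ → DualTo Q U → DualTo (map tail Q) (map tail U)
tail-dual [] [] = []
tail-dual (qe ∷ Qe) (_∷_ {q = q} {u} (qu≢0 , Qu , qU) dual) =
  ((λ e → qu≢0 (trans (sym (tail-· q u qe)) e))
  , All.map⁺ (All.zipWith (λ {q'} (e , e') → trans (tail-· q' u e) e') (Qe , Qu))
  , All.map⁺ (All.map (λ {u'} e → trans (tail-· q u' qe) e) qU)) ∷ tail-dual Qe dual

find : ∀ {P : ℤ → Set} (P? : ∀ a → Dec (P a)) D → (∑[ a ∈ D ] ι (P? a) ≡ 0) ⊎ ∃ P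
find P? []      = inj₁ refl
find P? (a ∷ D) with P? a
... | yes p = inj₂ (a , p)
... | no _  = find P? D

module _ (T : ℕ) (D : List ℤ) (T*count≤ : ∀ a → T * count a D ≤ length D) where

  private
    -- Two admissible first coordinates for the same tail would put `e₀` into the kernel. So at most
    -- one is admissible, and only if the tail lies in the projection of the kernel.
    pivotal : ∀ (Q : Rows (suc k)) x → ¬ Ker Q e₀ →
      T * (∑[ a ∈ D ] ι (ker? Q (a ∷ x))) ≤ ι (ker? (map tail (step e₀ Q)) x) * length D
    pivotal Q x ∉Q with find (λ a → ker? Q (a ∷ x)) D
    ... | inj₁ eq rewrite eq = ≤-trans (≤-reflexive (*-zeroʳ T)) z≤n
    ... | inj₂ (b , Qb) = begin
      T * (∑[ a ∈ D ] ι (ker? Q (a ∷ x)))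
        ≤⟨ *-monoʳ-≤ T (∑-mono D (λ a → ι-mono (ker? Q (a ∷ x)) (a ℤ.≟ b) unique)) ⟩
      T * count b D
        ≤⟨ T*count≤ b ⟩
      length D
        ≡⟨ *-identityˡ _ ⟨
      1 * length D
        ≡⟨ cong (_* length D) (ι-yes (ker? (map tail (step e₀ Q)) x) (Ker-tail⁻ (Ker-step-self e₀ Q) (Ker⊆Ker-step e₀ Qb))) ⟨
      ι (ker? (map tail (step e₀ Q)) x) * length D ∎
      where
      open ≤-Reasoning
      lem : ∀ h a b s → h ℤ.* a ℤ.+ s ℤ.- (h ℤ.* b ℤ.+ s) ≡ (a ℤ.- b) ℤ.* h
      lem = ℤSolver.solve-∀
      unique : ∀ {a} → Ker Q (a ∷ x) → a ≡ b
      unique {a} Qa with a ℤ.≟ b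
      ... | yes eq = eq
      ... | no a≢b = ⊥-elim (∉Q (All.zipWith (λ {q} → vanish {q}) (Qa , Qb)))
        where
        vanish : ∀ {q : Vector (suc _)} → q · (a ∷ x) ≡ 0ℤ × q · (b ∷ x) ≡ 0ℤ → q · e₀ ≡ 0ℤ
        vanish {h ∷ t} (e , e') = trans (·-e₀ h t) (*≡0⇒≡0 (λ z → a≢b (ℤ.i-j≡0⇒i≡j a b z))
          (trans (sym (lem h a b (t · x))) (cong₂ ℤ._-_ e e')))

  -- Odlyzko's argument, by projection along `e₀`. If the kernel contains `e₀`, the projection has
  -- the same codimension; otherwise the codimension drops by one and `pivotal` gives a factor `T`.
  independent-rare : ∀ k {Q : Rows k} → Independent Q →
    T ^ length Q * (∑[ x ∈ tuples D k ] ι (ker? Q x)) ≤ length D ^ k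
  independent-rare zero {[]} _ = ≤-refl
  independent-rare zero {[] ∷ Q} (_ , _∷_ {u = []} (0≢0 , _) _) = ⊥-elim (0≢0 refl)
  independent-rare (suc k) {Q} (U , dual) = bound
    where
    open ≤-Reasoning
    Q' = map tail (step e₀ Q)
    N = length D
    IH : T ^ length Q' * (∑[ x ∈ tuples D k ] ι (ker? Q' x)) ≤ N ^ k
    IH = independent-rare k (map tail (dropDual e₀ Q U) , tail-dual (Ker-step-self e₀ Q) (step-dual e₀ dual))
    c' = ∑[ x ∈ tuples D k ] ι (ker? Q' x)
    bound : T ^ length Q * (∑[ x ∈ tuples D (suc k) ] ι (ker? Q x)) ≤ N ^ suc k
    bound with ker? Q e₀
    ... | yes Qe = begin
      T ^ length Q * (∑[ x ∈ tuples D (suc k) ] ι (ker? Q x))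
        ≡⟨ cong (T ^ length Q *_) (∑-tuples D k _) ⟩
      T ^ length Q * (∑[ a ∈ D ] ∑[ x ∈ tuples D k ] ι (ker? Q (a ∷ x)))
        ≤⟨ *-monoʳ-≤ (T ^ length Q) (∑-≤-const D (λ a → ∑-mono (tuples D k) (λ x →
             ι-mono (ker? Q (a ∷ x)) (ker? Q' x) (Ker-tail⁻ (Ker-step-self e₀ Q) ∘ Ker⊆Ker-step e₀)))) ⟩
      T ^ length Q * (N * c')
        ≡⟨ cong (λ l → T ^ l * (N * c')) (trans (sym (cong length (step-ker e₀ Qe))) (sym (length-map tail (step e₀ Q)))) ⟩
      T ^ length Q' * (N * c')
        ≡⟨ e (T ^ length Q') N c' ⟩
      N * (T ^ length Q' * c')
        ≤⟨ *-monoʳ-≤ N IH ⟩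
      N ^ suc k ∎
      where
      e : ∀ x y z → x * (y * z) ≡ y * (x * z)
      e = solve-∀
    ... | no ∉Q = begin
      T ^ length Q * (∑[ x ∈ tuples D (suc k) ] ι (ker? Q x))
        ≡⟨ cong₂ (λ l s → T ^ l * s) (trans (sym (length-step e₀ Q ∉Q)) (cong suc (sym (length-map tail (step e₀ Q)))))
             (trans (∑-tuples D k _) (∑-swap D (tuples D k) _)) ⟩
      T * T ^ length Q' * (∑[ x ∈ tuples D k ] ∑[ a ∈ D ] ι (ker? Q (a ∷ x)))
        ≡⟨ e T (T ^ length Q') _ ⟩
      T ^ length Q' * (T * (∑[ x ∈ tuples D k ] ∑[ a ∈ D ] ι (ker? Q (a ∷ x))))
        ≡⟨ cong (T ^ length Q' *_) (∑-*ˡ (tuples D k) T _) ⟨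
      T ^ length Q' * (∑[ x ∈ tuples D k ] (T * (∑[ a ∈ D ] ι (ker? Q (a ∷ x)))))
        ≤⟨ *-monoʳ-≤ (T ^ length Q') (∑-mono (tuples D k) (λ x → pivotal Q x ∉Q)) ⟩
      T ^ length Q' * (∑[ x ∈ tuples D k ] (ι (ker? Q' x) * N))
        ≡⟨ cong (T ^ length Q' *_) (∑-*ʳ (tuples D k) N _) ⟩
      T ^ length Q' * (c' * N)
        ≡⟨ e' (T ^ length Q') c' N ⟩
      N * (T ^ length Q' * c')
        ≤⟨ *-monoʳ-≤ N IH ⟩
      N ^ suc k ∎
      where
      e : ∀ x y z → x * y * z ≡ y * (x * z)
      e = solve-∀
      e' : ∀ x y z → x * (y * z) ≡ z * (x * y)
      e' = solve-∀

-- Iterated doubling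

module Doubling (V : ℕ → List ℤ) (dbl : ∀ j → V (suc j) DoubleOf V j) (sym₀ : Symmetric (V 0)) where

  N c : ℕ → ℕ
  N j = length (V j)
  c j = count 0ℤ (V j)

  symmetric : ∀ j → Symmetric (V j)
  symmetric zero    = sym₀
  symmetric (suc j) = double-symmetric (V j) (V (suc j)) (symmetric j) (dbl j)

  -- Positivity is created by doubling, whence the indices `suc j` from here on; `E 0`, for
  -- instance, is not positive.
  positive : ∀ j → Positive (V (suc j))
  positive j = double-positive (V j) (V (suc j)) (symmetric j) (dbl j)

  N-suc : ∀ j → N (suc j) ≡ N j * N j
  N-suc j = length-double (V j) (V (suc j)) (dbl j)

  count≤c : ∀ j a → count a (V (suc j)) ≤ c (suc j)
  count≤c j = count≤count-0 (V (suc j)) (symmetric (suc j)) (positive j)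

  module _ (half₁ : 2 * c 1 ≤ N 1) where
    open ≤-Reasoning

    half : ∀ j → 2 * c (suc j) ≤ N (suc j)
    half zero    = half₁
    half (suc j) = begin
      2 * c (suc (suc j))
        ≡⟨ cong (2 *_) (count-double-0 (V (suc j)) (V (suc (suc j))) (symmetric (suc j)) (dbl (suc j))) ⟩
      2 * (∑[ v ∈ V (suc j) ] count v (V (suc j)))       ≤⟨ *-monoʳ-≤ 2 (∑-≤-const (V (suc j)) (count≤c j)) ⟩
      2 * (N (suc j) * c (suc j))                        ≡⟨ e (N (suc j)) (c (suc j)) ⟩
      N (suc j) * (2 * c (suc j))                        ≤⟨ *-monoʳ-≤ (N (suc j)) (half j) ⟩
      N (suc j) * N (suc j)                              ≡⟨ N-suc (suc j) ⟨
      N (suc (suc j))                                    ∎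
      where
      e : ∀ x y → 2 * (x * y) ≡ x * (2 * y)
      e = solve-∀

    gain : ∀ j → 80 * c (suc (suc j)) ≤ 79 * (c (suc j) * N (suc j))
    gain j = begin
      80 * c (suc (suc j))
        ≡⟨ cong (80 *_) (count-double-0 (V (suc j)) (V (suc (suc j))) (symmetric (suc j)) (dbl (suc j))) ⟩
      80 * (∑[ v ∈ V (suc j) ] count v (V (suc j)))
        ≤⟨ ∑-count≤ (V (suc j)) (symmetric (suc j)) (positive j) (half j) ⟩
      79 * (c (suc j) * N (suc j))                        ∎

    gains : ∀ j i → 80 ^ i * c (suc (i + j)) * N (suc j) ≤ 79 ^ i * c (suc j) * N (suc (i + j))
    gains j zero    = ≤-refl
    gains j (suc i) = begin
      80 * 80 ^ i * c (suc (suc (i + j))) * N₀            ≡⟨ e₁ (80 ^ i) (c (suc (suc (i + j)))) N₀ ⟩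
      80 * c (suc (suc (i + j))) * (80 ^ i * N₀)          ≤⟨ *-monoˡ-≤ (80 ^ i * N₀) (gain (i + j)) ⟩
      79 * (c' * N') * (80 ^ i * N₀)                      ≡⟨ e₂ (80 ^ i) c' N' N₀ ⟩
      79 * N' * (80 ^ i * c' * N₀)                        ≤⟨ *-monoʳ-≤ (79 * N') (gains j i) ⟩
      79 * N' * (79 ^ i * c (suc j) * N')                 ≡⟨ e₃ (79 ^ i) (c (suc j)) N' ⟩
      79 * 79 ^ i * c (suc j) * (N' * N')
        ≡⟨ cong (79 * 79 ^ i * c (suc j) *_) (N-suc (suc (i + j))) ⟨
      79 * 79 ^ i * c (suc j) * N (suc (suc (i + j)))     ∎
      where
      N₀ = N (suc j)
      N' = N (suc (i + j))
      c' = c (suc (i + j))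
      e₁ : ∀ x y z → 80 * x * y * z ≡ 80 * y * (x * z)
      e₁ = solve-∀
      e₂ : ∀ x c n m → 79 * (c * n) * (x * m) ≡ 79 * n * (x * c * m)
      e₂ = solve-∀
      e₃ : ∀ x c n → 79 * n * (x * c * n) ≡ 79 * x * c * (n * n)
      e₃ = solve-∀

    -- A statement on the ratio `c / N` with denominators cleared: every `τ` doublings at least
    -- halve it.
    halvings : ∀ τ → 2 * 79 ^ τ ≤ 80 ^ τ → ∀ t j →
      2 ^ t * c (suc (τ * t + j)) * N (suc j) ≤ c (suc j) * N (suc (τ * t + j))
    halvings τ hτ t j = *-cancelˡ-≤ (80 ^ (τ * t)) {{m^n≢0 80 (τ * t)}} (begin
      80 ^ (τ * t) * (2 ^ t * c' * N₀)           ≡⟨ e₁ (80 ^ (τ * t)) (2 ^ t) c' N₀ ⟩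
      2 ^ t * (80 ^ (τ * t) * c' * N₀)           ≤⟨ *-monoʳ-≤ (2 ^ t) (gains j (τ * t)) ⟩
      2 ^ t * (79 ^ (τ * t) * c₀ * N')
        ≡⟨ cong (λ x → 2 ^ t * (x * c₀ * N')) (sym (^-*-assoc 79 τ t)) ⟩
      2 ^ t * ((79 ^ τ) ^ t * c₀ * N')           ≡⟨ e₂ (2 ^ t) ((79 ^ τ) ^ t) c₀ N' ⟩
      2 ^ t * (79 ^ τ) ^ t * (c₀ * N')           ≡⟨ cong (_* (c₀ * N')) (^-distribʳ-* t 2 (79 ^ τ)) ⟨
      (2 * 79 ^ τ) ^ t * (c₀ * N')               ≤⟨ *-monoˡ-≤ (c₀ * N') (^-monoˡ-≤ t hτ) ⟩
      (80 ^ τ) ^ t * (c₀ * N')                   ≡⟨ cong (_* (c₀ * N')) (^-*-assoc 80 τ t) ⟩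
      80 ^ (τ * t) * (c₀ * N')                   ∎)
      where
      N₀ = N (suc j)
      N' = N (suc (τ * t + j))
      c₀ = c (suc j)
      c' = c (suc (τ * t + j))
      e₁ : ∀ x y z w → x * (y * z * w) ≡ y * (x * z * w)
      e₁ = solve-∀
      e₂ : ∀ x y z w → x * (y * z * w) ≡ x * y * (z * w)
      e₂ = solve-∀

-- Sums of signs and their vectors

E : ℕ → List ℤ
E zero    = 1ℤ ∷ -1ℤ ∷ []
E (suc j) = cartesianProductWith ℤ._+_ (E j) (E j)

E-double : ∀ j → E (suc j) DoubleOf E j
E-double j = ∑-cartesianProductWith ℤ._+_ (E j) (E j)

E-symmetric₀ : Symmetric (E 0)
E-symmetric₀ F = e (F 1ℤ) (F -1ℤ)
  where
  e : ∀ x y → x + (y + 0) ≡ y + (x + 0)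
  e = solve-∀

module DE = Doubling E E-double E-symmetric₀

E-bounded : ∀ j → All (λ a → ∣ a ∣ ≤ 2 ^ j) (E j)
E-bounded zero    = ≤-refl ∷ ≤-refl ∷ []
E-bounded (suc j) = All-cartesianProductWith ℤ._+_
  (λ {x} {y} p q → ≤-trans (ℤ.∣i+j∣≤∣i∣+∣j∣ x y) (+-mono-≤ p (≤-trans q (≤-reflexive (sym (+-identityʳ _))))))
  (E-bounded j) (E-bounded j)

Ω : ∀ k → ℕ → List (Vector k)
Ω k j = tuples (E j) k

_⊕_ : Vector k → Vector k → Vector k
_⊕_ = zipWith ℤ._+_

neg : Vector k → Vector k
neg = Vec.map (λ a → ℤ.- a)

·-⊕ : ∀ (w x y : Vector k) → w · (x ⊕ y) ≡ w · x ℤ.+ w · y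
·-⊕ []      []      []      = refl
·-⊕ (a ∷ w) (b ∷ x) (c ∷ y) rewrite ·-⊕ w x y = lem a b c (w · x) (w · y)
  where
  lem : ∀ a b c s t → a ℤ.* (b ℤ.+ c) ℤ.+ (s ℤ.+ t) ≡ a ℤ.* b ℤ.+ s ℤ.+ (a ℤ.* c ℤ.+ t)
  lem = ℤSolver.solve-∀

·-neg : ∀ (w x : Vector k) → w · neg x ≡ ℤ.- (w · x)
·-neg []      []      = refl
·-neg (a ∷ w) (b ∷ x) rewrite ·-neg w x = lem a b (w · x)
  where
  lem : ∀ a b s → a ℤ.* (ℤ.- b) ℤ.+ ℤ.- s ≡ ℤ.- (a ℤ.* b ℤ.+ s)
  lem = ℤSolver.solve-∀

-- Since the coordinates are independent, doubling each of them amounts to adding two independent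
-- vectors.
∑-Ω-suc : ∀ k j (F : Vector k → ℕ) → ∑ (Ω k (suc j)) F ≡ ∑[ x ∈ Ω k j ] ∑[ y ∈ Ω k j ] F (x ⊕ y)
∑-Ω-suc zero    j F = sym (+-identityʳ _)
∑-Ω-suc (suc k) j F = begin
  ∑ (Ω (suc k) (suc j)) F
    ≡⟨ ∑-tuples (E (suc j)) k F ⟩
  (∑[ a ∈ E (suc j) ] ∑[ x ∈ Ω k (suc j) ] F (a ∷ x))
    ≡⟨ E-double j _ ⟩
  (∑[ a ∈ E j ] ∑[ b ∈ E j ] ∑[ x ∈ Ω k (suc j) ] F (a ℤ.+ b ∷ x))
    ≡⟨ ∑-cong (E j) (λ a → ∑-cong (E j) (λ b → ∑-Ω-suc k j _)) ⟩
  (∑[ a ∈ E j ] ∑[ b ∈ E j ] ∑[ x ∈ Ω k j ] ∑[ y ∈ Ω k j ] F (a ℤ.+ b ∷ x ⊕ y))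
    ≡⟨ ∑-cong (E j) (λ a → ∑-swap (E j) (Ω k j) _) ⟩
  (∑[ a ∈ E j ] ∑[ x ∈ Ω k j ] ∑[ b ∈ E j ] ∑[ y ∈ Ω k j ] F (a ℤ.+ b ∷ x ⊕ y))
    ≡⟨ ∑-cong (E j) (λ a → ∑-cong (Ω k j) (λ x → sym (∑-tuples (E j) k _))) ⟩
  (∑[ a ∈ E j ] ∑[ x ∈ Ω k j ] ∑[ y ∈ Ω (suc k) j ] F ((a ∷ x) ⊕ y))
    ≡⟨ ∑-tuples (E j) k _ ⟨
  (∑[ x ∈ Ω (suc k) j ] ∑[ y ∈ Ω (suc k) j ] F (x ⊕ y)) ∎
  where open ≡-Reasoning

∑-Ω-neg : ∀ k (F : Vector k → ℕ) → ∑ (Ω k 0) F ≡ ∑[ x ∈ Ω k 0 ] F (neg x)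
∑-Ω-neg zero    F = refl
∑-Ω-neg (suc k) F = begin
  ∑ (Ω (suc k) 0) F                                  ≡⟨ ∑-tuples (E 0) k F ⟩
  (∑[ a ∈ E 0 ] ∑[ x ∈ Ω k 0 ] F (a ∷ x))            ≡⟨ E-symmetric₀ (λ a → ∑[ x ∈ Ω k 0 ] F (a ∷ x)) ⟩
  (∑[ a ∈ E 0 ] ∑[ x ∈ Ω k 0 ] F (ℤ.- a ∷ x))        ≡⟨ ∑-cong (E 0) (λ a → ∑-Ω-neg k (λ x → F (ℤ.- a ∷ x))) ⟩
  (∑[ a ∈ E 0 ] ∑[ x ∈ Ω k 0 ] F (neg (a ∷ x)))      ≡⟨ ∑-tuples (E 0) k _ ⟨
  (∑[ x ∈ Ω (suc k) 0 ] F (neg x))                   ∎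
  where open ≡-Reasoning

values : Vector k → ℕ → List ℤ
values {k} w j = map (w ·_) (Ω k j)

values-double : ∀ (w : Vector k) j → values w (suc j) DoubleOf values w j
values-double {k} w j F = begin
  ∑ (values w (suc j)) F                                               ≡⟨ ∑-map (w ·_) (Ω k (suc j)) F ⟩
  (∑[ x ∈ Ω k (suc j) ] F (w · x))                                     ≡⟨ ∑-Ω-suc k j _ ⟩
  (∑[ x ∈ Ω k j ] ∑[ y ∈ Ω k j ] F (w · (x ⊕ y)))
    ≡⟨ ∑-cong (Ω k j) (λ x → ∑-cong (Ω k j) (λ y → cong F (·-⊕ w x y))) ⟩
  (∑[ x ∈ Ω k j ] ∑[ y ∈ Ω k j ] F (w · x ℤ.+ w · y))
    ≡⟨ ∑-cong (Ω k j) (λ x → ∑-map (w ·_) (Ω k j) _) ⟨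
  (∑[ x ∈ Ω k j ] ∑[ v ∈ values w j ] F (w · x ℤ.+ v))                 ≡⟨ ∑-map (w ·_) (Ω k j) _ ⟨
  (∑[ u ∈ values w j ] ∑[ v ∈ values w j ] F (u ℤ.+ v))                ∎
  where open ≡-Reasoning

values-symmetric₀ : ∀ (w : Vector k) → Symmetric (values w 0)
values-symmetric₀ {k} w F = begin
  ∑ (values w 0) F                       ≡⟨ ∑-map (w ·_) (Ω k 0) F ⟩
  (∑[ x ∈ Ω k 0 ] F (w · x))             ≡⟨ ∑-Ω-neg k _ ⟩
  (∑[ x ∈ Ω k 0 ] F (w · neg x))         ≡⟨ ∑-cong (Ω k 0) (λ x → cong F (·-neg w x)) ⟩
  (∑[ x ∈ Ω k 0 ] F (ℤ.- (w · x)))       ≡⟨ ∑-map (w ·_) (Ω k 0) _ ⟨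
  (∑[ v ∈ values w 0 ] F (ℤ.- v))        ∎
  where open ≡-Reasoning

-- A nonzero multiple of `suc b` is too large to be cancelled by `s`. The shape of the equation is
-- that produced by `comb-·` in `collapse`.
∣B*c∣≤⇒c≡0 : ∀ b s c → ∣ s ∣ ≤ b → 1ℤ ℤ.* s ℤ.+ ℤ.+ suc b ℤ.* c ≡ 0ℤ → c ≡ 0ℤ
∣B*c∣≤⇒c≡0 b s c s≤b eq with c ℤ.≟ 0ℤ
... | yes c≡0 = c≡0
... | no c≢0  = ⊥-elim (<⇒≱ (s≤s s≤b) (begin
  suc b                  ≡⟨ *-identityʳ (suc b) ⟨
  suc b * 1              ≤⟨ *-monoʳ-≤ (suc b) (n≢0⇒n>0 (λ z → c≢0 (ℤ.∣i∣≡0⇒i≡0 z))) ⟩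
  suc b * ∣ c ∣          ≡⟨ ℤ.abs-* (ℤ.+ suc b) c ⟨
  ∣ ℤ.+ suc b ℤ.* c ∣    ≡⟨ cong ∣_∣ (lem (ℤ.+ suc b) s c) ⟩
  ∣ 1ℤ ℤ.* s ℤ.+ ℤ.+ suc b ℤ.* c ℤ.- s ∣ ≡⟨ cong (λ x → ∣ x ℤ.- s ∣) eq ⟩
  ∣ 0ℤ ℤ.- s ∣           ≡⟨ cong ∣_∣ (ℤ.+-identityˡ (ℤ.- s)) ⟩
  ∣ ℤ.- s ∣              ≡⟨ ℤ.∣-i∣≡∣i∣ s ⟩
  ∣ s ∣                  ∎))
  where
  open ≤-Reasoning
  lem : ∀ b s c → b ℤ.* c ≡ 1ℤ ℤ.* s ℤ.+ b ℤ.* c ℤ.- s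
  lem = ℤSolver.solve-∀

All-≤-∑ : ∀ {X : Set} (f : X → ℕ) xs → All (λ x → f x ≤ ∑ xs f) xs
All-≤-∑ f []       = []
All-≤-∑ f (x ∷ xs) = m≤m+n (f x) _ ∷ All.map (λ le → ≤-trans le (m≤n+m _ (f x))) (All-≤-∑ f xs)

-- A combination of the rows with widely separated coefficients is as good as all of them on Z.
collapse : ∀ (Z Q : Rows k) → ∃ λ w → All (λ z → (w · z ≡ 0ℤ → Ker Q z) × (Ker Q z → w · z ≡ 0ℤ)) Z
collapse Z []      = 𝟎 , All.universal (λ z → (λ _ → []) , λ _ → 𝟎-· z) Z
collapse Z (q ∷ Q) with collapse Z Q
... | w , works = comb 1ℤ q B w , All.zipWith both (All-≤-∑ (λ z → ∣ q · z ∣) Z , works)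
  where
  b = ∑[ z ∈ Z ] ∣ q · z ∣
  B = ℤ.+ suc b
  both : ∀ {z} → ∣ q · z ∣ ≤ b × ((w · z ≡ 0ℤ → Ker Q z) × (Ker Q z → w · z ≡ 0ℤ)) →
         (comb 1ℤ q B w · z ≡ 0ℤ → Ker (q ∷ Q) z) × (Ker (q ∷ Q) z → comb 1ℤ q B w · z ≡ 0ℤ)
  both {z} (qz≤b , f , g) = to′ , from′
    where
    to′ : comb 1ℤ q B w · z ≡ 0ℤ → Ker (q ∷ Q) z
    to′ e = combination-cancels 1ℤ B (λ ()) wz e' ∷ f wz
      where
      e' : 1ℤ ℤ.* (q · z) ℤ.+ B ℤ.* (w · z) ≡ 0ℤ
      e' = trans (sym (comb-· 1ℤ q B w z)) e
      wz : w · z ≡ 0ℤ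
      wz = ∣B*c∣≤⇒c≡0 b (q · z) (w · z) qz≤b e'
    from′ : Ker (q ∷ Q) z → comb 1ℤ q B w · z ≡ 0ℤ
    from′ (qz ∷ Qz) = trans (comb-· 1ℤ q B w z) (combination-vanishes 1ℤ B qz (g Qz))

kernelCount : ∀ j → Rows k → ℕ
kernelCount {k} j Q = ∑[ x ∈ Ω k j ] ι (ker? Q x)

module _ (τ : ℕ) (hτ : 2 * 79 ^ τ ≤ 80 ^ τ) (t : ℕ) where

  E-count≤ : ∀ a → 2 ^ t * count a (E (suc (τ * t + 0))) ≤ length (E (suc (τ * t + 0)))
  E-count≤ a = ≤-trans (*-monoʳ-≤ (2 ^ t) (DE.count≤c (τ * t + 0) a)) (*-cancelʳ-≤ _ _ 4 (begin
    -- `E 1` lists 2, 0, 0, -2, so here `c 1 = 2` and `N 1 = 4`.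
    2 ^ t * c' * 4     ≤⟨ DE.halvings ≤-refl τ hτ t 0 ⟩
    2 * N'             ≤⟨ *-monoˡ-≤ N' {2} {4} (s≤s (s≤s z≤n)) ⟩
    4 * N'             ≡⟨ *-comm 4 N' ⟩
    N' * 4             ∎))
    where
    open ≤-Reasoning
    c' = DE.c (suc (τ * t + 0))
    N' = DE.N (suc (τ * t + 0))

  kernelCount-rare : ∀ {Q : Rows k} → Independent Q →
    (2 ^ t) ^ length Q * kernelCount (suc (τ * t + 0)) Q ≤ length (Ω k (suc (τ * t + 0)))
  kernelCount-rare {k} ind = ≤-trans (independent-rare (2 ^ t) (E (suc (τ * t + 0))) E-count≤ k ind)
    (≤-reflexive (sym (length-tuples (E (suc (τ * t + 0))) k)))

  -- The doubling estimate concerns one integer-valued functional. `collapse` supplies a single `w`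
  -- that agrees with `Q` on the three sample lists involved.
  kernelCount-gain : ∀ {Q : Rows k} → Independent Q → 1 ≤ length Q → ∀ j →
    2 ^ t * kernelCount (suc (τ * t + j)) Q * length (Ω k (suc j)) ≤
    kernelCount (suc j) Q * length (Ω k (suc (τ * t + j)))
  kernelCount-gain {k} {Q} ind 1≤len j with collapse (Ω k 1 ++ (Ω k (suc j) ++ Ω k (suc (τ * t + j)))) Q
  ... | w , works = subst₂ _≤_
          (cong₂ (λ x y → 2 ^ t * x * y) (eq (suc (τ * t + j)) works₂) (N≡ (suc j)))
          (cong₂ _*_ (eq (suc j) works₁) (N≡ (suc (τ * t + j))))
          (Dw.halvings half₁ τ hτ t j)
    where
    module Dw = Doubling (values w) (values-double w) (values-symmetric₀ w)
    open ≤-Reasoning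
    Works : Vector k → Set
    Works z = (w · z ≡ 0ℤ → Ker Q z) × (Ker Q z → w · z ≡ 0ℤ)
    works₀ = All.++⁻ˡ (Ω k 1) works
    works₁ = All.++⁻ˡ (Ω k (suc j)) (All.++⁻ʳ (Ω k 1) works)
    works₂ = All.++⁻ʳ (Ω k (suc j)) (All.++⁻ʳ (Ω k 1) works)
    N≡ : ∀ i → Dw.N i ≡ length (Ω k i)
    N≡ i = length-map (w ·_) (Ω k i)
    eq : ∀ i → All Works (Ω k i) → Dw.c i ≡ kernelCount i Q
    eq i ws = trans (∑-map (w ·_) (Ω k i) _) (∑-cong-All ws λ z (f , g) → ι-cong (w · z ℤ.≟ 0ℤ) (ker? Q z) f g)
    -- No integer fills more than half of `E 1`, so a single independent functional already costs a
    -- factor 2.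
    half₁ : 2 * Dw.c 1 ≤ Dw.N 1
    half₁ = begin
      2 * Dw.c 1                       ≡⟨ cong (2 *_) (eq 1 works₀) ⟩
      2 ^ 1 * kernelCount 1 Q          ≤⟨ *-monoˡ-≤ (kernelCount 1 Q) (^-monoʳ-≤ 2 1≤len) ⟩
      2 ^ length Q * kernelCount 1 Q
        ≤⟨ independent-rare 2 (E 1) (λ a → *-monoʳ-≤ 2 (DE.count≤c 0 a)) k ind ⟩
      length (E 1) ^ k                 ≡⟨ length-tuples (E 1) k ⟨
      length (Ω k 1)                   ≡⟨ N≡ 1 ⟨
      Dw.N 1                           ∎

-- Counting dependent tuples

-- Integers q N = ℓ / N stand in for the weights 1 / N.
quotients : ∀ b → ∃₂ λ ℓ (q : ℕ → ℕ) → 1 ≤ ℓ × (∀ N → 1 ≤ N → N ≤ b → q N * N ≡ ℓ)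
quotients zero    = 1 , const 0 , ≤-refl , λ N 1≤N N≤0 → ⊥-elim (<⇒≱ 1≤N N≤0)
quotients (suc b) with quotients b
... | ℓ , q , 1≤ℓ , div = suc b * ℓ , q' , *-mono-≤ (s≤s (z≤n {b})) 1≤ℓ , div'
  where
  q' : ℕ → ℕ
  q' N with N ≟ suc b
  ... | yes _ = ℓ
  ... | no _  = suc b * q N
  div' : ∀ N → 1 ≤ N → N ≤ suc b → q' N * N ≡ suc b * ℓ
  div' N 1≤N N≤ with N ≟ suc b
  ... | yes refl = *-comm ℓ (suc b)
  ... | no N≢    = trans (*-assoc (suc b) (q N) N) (cong (suc b *_) (div N 1≤N (s≤s⁻¹ (≤∧≢⇒< N≤ N≢))))

span : Vec (Vector k) m → Rows k
span = run (basis _)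

span-independent : ∀ (xs : Vec (Vector k) m) → Independent (span xs)
span-independent xs = run-independent xs (basis-independent _)

-- `length (span xs)` is the codimension of the span, so the equation says that the span has
-- dimension `m`.
LinInd : Vec (Vector k) m → Set
LinInd {k} {m} xs = length (span xs) + m ≡ k

linInd? : ∀ (xs : Vec (Vector k) m) → Dec (LinInd xs)
linInd? {k} {m} xs = length (span xs) + m ≟ k

module Subspaces {k : ℕ} (A : List (Vector k)) where

  a : ℕ
  a = length A

  α : Rows k → ℕ
  α Q = ∑[ x ∈ A ] ι (ker? Q x)

  α-mono : ∀ {Q Q'} → (∀ {z} → Ker Q z → Ker Q' z) → α Q ≤ α Q'
  α-mono {Q} {Q'} f = ∑-mono A (λ x → ι-mono (ker? Q x) (ker? Q' x) f)

  α-cong : ∀ {Q Q'} → Q ≈ Q' → α Q ≡ α Q'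
  α-cong (mk≈ f g _) = ≤-antisym (α-mono f) (α-mono g)

  α≤a : ∀ Q → α Q ≤ a
  α≤a Q = ≤-trans (∑-≤-const A (λ x → ι≤1 (ker? Q x))) (≤-reflexive (*-identityʳ a))

  dependent : ∀ m → ℕ
  dependent m = ∑[ xs ∈ tuples A m ] ι (¬? (linInd? xs))

  -- A vector that enlarges the subspace removes one functional, so exactly `s` of the `m` vectors
  -- do not enlarge it.
  skips? : ∀ Q (xs : Vec (Vector k) m) s → Dec (length (run Q xs) + m ≡ length Q + s)
  skips? {m} Q xs s = length (run Q xs) + m ≟ length Q + s

  -- An x that does not enlarge the current subspace can be chosen in at most α (run Q xs) ways,
  -- xs being the whole tuple; the factor 2 ^ m pays for the positions of these x.
  ∑-skips : ∀ m s {Q} → Independent Q → (h : Rows k → ℕ) → ∀ K →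
    (∀ {Q'} → Independent Q' → h Q' * α Q' ^ s ≤ K) →
    a ^ s * (∑[ xs ∈ tuples A m ] (ι (skips? Q xs s) * h (run Q xs))) ≤ 2 ^ m * a ^ m * K
  ∑-skips zero zero {Q} ind h K le = begin
    1 * (ι (skips? Q [] 0) * h Q + 0)    ≡⟨ trans (*-identityˡ _) (+-identityʳ _) ⟩
    ι (skips? Q [] 0) * h Q              ≤⟨ *-monoˡ-≤ (h Q) (ι≤1 (skips? Q [] 0)) ⟩
    1 * h Q                              ≡⟨ *-comm 1 (h Q) ⟩
    h Q * 1                              ≤⟨ le ind ⟩
    K                                    ≡⟨ *-identityˡ K ⟨
    1 * 1 * K                            ∎
    where open ≤-Reasoning
  ∑-skips zero (suc s) {Q} ind h K le
    rewrite ι-no (skips? Q [] (suc s)) (λ e → 0≢1+n (+-cancelˡ-≡ (length Q) _ _ e))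
    = ≤-trans (≤-reflexive (*-zeroʳ (a ^ suc s))) z≤n
  ∑-skips (suc m) s {Q} ind h K le = begin
    a ^ s * (∑[ xs ∈ tuples A (suc m) ] (ι (skips? Q xs s) * h (run Q xs)))
      ≡⟨ cong (a ^ s *_) (trans (∑-tuples A m _) (∑-swap A (tuples A m) _)) ⟩
    a ^ s * (∑[ xs ∈ tuples A m ] ∑[ x ∈ A ] (ι (skips? Q (x ∷ xs) s) * h (step x (run Q xs))))
      ≤⟨ *-monoʳ-≤ (a ^ s) (∑-mono (tuples A m) (λ xs → ∑-mono A (pointwise xs))) ⟩
    a ^ s * (∑[ xs ∈ tuples A m ] ∑[ x ∈ A ] (ι (ker? (run Q xs) x) * G xs + ι (skips? Q xs s) * h (step x (run Q xs))))
      ≡⟨ cong (a ^ s *_) (∑-cong (tuples A m) (λ xs → trans (∑-+ A _ _)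
           (cong₂ _+_ (∑-*ʳ A (G xs) _) (∑-*ˡ A (ι (skips? Q xs s)) _)))) ⟩
    a ^ s * (∑[ xs ∈ tuples A m ] (α (run Q xs) * G xs + ι (skips? Q xs s) * h' (run Q xs)))
      ≡⟨ trans (cong (a ^ s *_) (∑-+ (tuples A m) _ _)) (*-distribˡ-+ (a ^ s) _ _) ⟩
    a ^ s * (∑[ xs ∈ tuples A m ] (α (run Q xs) * G xs)) +
    a ^ s * (∑[ xs ∈ tuples A m ] (ι (skips? Q xs s) * h' (run Q xs)))
      -- A last vector that skips moves a factor `α` into `h` and lowers `s`. One that enlarges is
      -- summed out into `h'`; the bound survives since `α` only grows with the subspace.
      ≤⟨ +-mono-≤ (skipped s le) (∑-skips m s ind h' (a * K) le') ⟩
    a * (2 ^ m * a ^ m * K) + 2 ^ m * a ^ m * (a * K)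
      ≡⟨ e a (2 ^ m) (a ^ m) K ⟩
    2 ^ suc m * a ^ suc m * K ∎
    where
    open ≤-Reasoning
    e : ∀ a x y K → a * (x * y * K) + x * y * (a * K) ≡ 2 * x * (a * y) * K
    e = solve-∀
    skipped? : ∀ (xs : Vec (Vector k) m) s → Dec (length (run Q xs) + suc m ≡ length Q + s)
    skipped? xs s = length (run Q xs) + suc m ≟ length Q + s
    G : Vec (Vector k) m → ℕ
    G xs = ι (skipped? xs s) * h (run Q xs)
    h' : Rows k → ℕ
    h' Q' = ∑[ x ∈ A ] h (step x Q')
    le' : ∀ {Q'} → Independent Q' → h' Q' * α Q' ^ s ≤ a * K
    le' {Q'} ind' = begin
      h' Q' * α Q' ^ s                                  ≡⟨ ∑-*ʳ A (α Q' ^ s) _ ⟨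
      (∑[ x ∈ A ] (h (step x Q') * α Q' ^ s))
        ≤⟨ ∑-mono A (λ x → *-monoʳ-≤ (h (step x Q')) (^-monoˡ-≤ s (α-mono (Ker⊆Ker-step x)))) ⟩
      (∑[ x ∈ A ] (h (step x Q') * α (step x Q') ^ s))  ≤⟨ ∑-≤-const A (λ x → le (step-independent x ind')) ⟩
      a * K                                             ∎
    pointwise : ∀ xs x → ι (skips? Q (x ∷ xs) s) * h (step x (run Q xs)) ≤
                ι (ker? (run Q xs) x) * G xs + ι (skips? Q xs s) * h (step x (run Q xs))
    pointwise xs x with ker? (run Q xs) x
    ... | yes Qx rewrite step-ker x Qx = ≤-trans (≤-reflexive (sym (*-identityˡ _))) (m≤m+n _ _)
    ... | no x∉Q = *-monoˡ-≤ (h (step x (run Q xs))) (ι-mono (skips? Q (x ∷ xs) s) (skips? Q xs s)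
                     (trans (trans (cong (_+ m) (sym (length-step x (run Q xs) x∉Q))) (sym (+-suc _ m)))))
    skipped : ∀ s → (∀ {Q'} → Independent Q' → h Q' * α Q' ^ s ≤ K) →
      a ^ s * (∑[ xs ∈ tuples A m ] (α (run Q xs) * (ι (skipped? xs s) * h (run Q xs)))) ≤ a * (2 ^ m * a ^ m * K)
    skipped zero    le = begin
      1 * (∑[ xs ∈ tuples A m ] (α (run Q xs) * (ι (skipped? xs 0) * h (run Q xs))))
        ≡⟨ trans (*-identityˡ _) (∑-cong (tuples A m) (λ xs → trans (cong (λ i → α (run Q xs) * (i * h (run Q xs)))
             (ι-no (skipped? xs 0) (impossible xs))) (*-zeroʳ (α (run Q xs))))) ⟩
      (∑[ _ ∈ tuples A m ] 0)
        ≡⟨ ∑-zero (tuples A m) ⟩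
      0
        ≤⟨ z≤n ⟩
      _ ∎
      where
      impossible : ∀ (xs : Vec (Vector k) m) → ¬ length (run Q xs) + suc m ≡ length Q + 0
      impossible xs eq = <-irrefl refl (≤-trans (≤-reflexive (trans (sym (+-suc _ m)) (trans eq (+-identityʳ _)))) (length≤length-run Q xs))
    skipped (suc s) le = begin
      a * a ^ s * (∑[ xs ∈ tuples A m ] (α (run Q xs) * (ι (skipped? xs (suc s)) * h (run Q xs))))
        ≡⟨ trans (*-assoc a (a ^ s) _) (cong (λ S → a * (a ^ s * S)) (∑-cong (tuples A m) (λ xs →
             trans (cong (λ i → α (run Q xs) * (i * h (run Q xs))) (shift xs)) (e′ (α (run Q xs)) (ι (skips? Q xs s)) (h (run Q xs)))))) ⟩
      a * (a ^ s * (∑[ xs ∈ tuples A m ] (ι (skips? Q xs s) * (h (run Q xs) * α (run Q xs)))))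
        ≤⟨ *-monoʳ-≤ a (∑-skips m s ind (λ Q' → h Q' * α Q') K
             (λ {Q'} ind' → ≤-trans (≤-reflexive (*-assoc (h Q') (α Q') (α Q' ^ s))) (le ind'))) ⟩
      a * (2 ^ m * a ^ m * K) ∎
      where
      e′ : ∀ x y z → x * (y * z) ≡ y * (z * x)
      e′ = solve-∀
      shift : ∀ (xs : Vec (Vector k) m) → ι (skipped? xs (suc s)) ≡ ι (skips? Q xs s)
      shift xs = ι-cong (skipped? xs (suc s)) (skips? Q xs s)
        (λ eq → suc-injective (trans (sym (+-suc _ m)) (trans eq (+-suc _ s))))
        (λ eq → trans (+-suc _ m) (trans (cong suc eq) (sym (+-suc _ s))))

-- Exchanging vectors between the two distributions

module Singularity {k : ℕ} (T : ℕ) (A B : List (Vector k)) (L e : ℕ) (L+e : L + e ≡ suc k)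
  (1≤T : 1 ≤ T) (1≤a : 1 ≤ length A) (1≤b : 1 ≤ length B) where
  open Subspaces A
  open Subspaces B using () renaming (a to b; α to β; α-cong to β-cong; α≤a to β≤b)

  module _ (rare : ∀ {Q} → Independent Q → T ^ length Q * β Q ≤ b)
           (gain : ∀ {Q} → Independent Q → 1 ≤ length Q → T * α Q * b ≤ β Q * a) where
    open ≤-Reasoning

    -- The factor 2 leaves room: a subspace of codimension at least `L` has at most half the mass of
    -- a rich one.
    Rich : Rows k → Set
    Rich Q = 2 * b ≤ T ^ L * β Q

    rich? : ∀ Q → Dec (Rich Q)
    rich? Q = 2 * b ≤? T ^ L * β Q

    inside? : ∀ Q (ys : Vec (Vector k) m) → Dec (VecAll.All (Ker Q) ys)
    inside? Q ys = VecAll.all? (ker? Q) ys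

    insiders : ∀ Q m → ℕ
    insiders Q m = ∑[ ys ∈ tuples B m ] (ι (linInd? ys) * ι (inside? Q ys))

    rich-dominates : ∀ {Q Q'} → Rich Q → Independent Q' → L ≤ length Q' → 2 * β Q' ≤ β Q
    rich-dominates {Q} {Q'} rich ind L≤ = *-cancelˡ-≤ (T ^ L) {{m^n≢0 T L {{>-nonZero 1≤T}}}} (begin
      T ^ L * (2 * β Q')              ≡⟨ e₁ (T ^ L) (β Q') ⟩
      2 * (T ^ L * β Q')              ≤⟨ *-monoʳ-≤ 2 (*-monoˡ-≤ (β Q') (^-monoʳ-≤ T {{>-nonZero 1≤T}} L≤)) ⟩
      2 * (T ^ length Q' * β Q')      ≤⟨ *-monoʳ-≤ 2 (rare ind) ⟩
      2 * b                           ≤⟨ rich ⟩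
      T ^ L * β Q                     ∎)
      where
      e₁ : ∀ x y → x * (2 * y) ≡ 2 * (x * y)
      e₁ = solve-∀

    -- Vectors are drawn from the kernel one by one. By `rich-dominates` the span of the earlier
    -- ones absorbs at most half of the `β Q` candidates.
    insiders-many : ∀ {Q} → Rich Q → ∀ m → m ≤ e → β Q ^ m ≤ 2 ^ m * insiders Q m
    insiders-many {Q} rich zero _ = ≤-reflexive (sym (cong (λ i → 1 * (i * 1 + 0))
      (ι-yes (linInd? []) (trans (+-identityʳ _) (length-basis k)))))
    insiders-many {Q} rich (suc m) m<e = begin
      β Q * β Q ^ m
        ≤⟨ *-monoʳ-≤ (β Q) (insiders-many rich m (<⇒≤ m<e)) ⟩
      β Q * (2 ^ m * insiders Q m)
        ≡⟨ e₁ (β Q) (2 ^ m) (insiders Q m) ⟩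
      2 ^ m * (insiders Q m * β Q)
        ≡⟨ cong (2 ^ m *_) (∑-*ʳ (tuples B m) (β Q) _) ⟨
      2 ^ m * (∑[ ys ∈ tuples B m ] (ι (linInd? ys) * ι (inside? Q ys) * β Q))
        ≤⟨ *-monoʳ-≤ (2 ^ m) (∑-mono (tuples B m) (λ ys → ≤-trans (≤-reflexive (*-assoc (ι (linInd? ys)) _ _))
             (ι*-mono (linInd? ys) (λ li → *-monoʳ-≤ (ι (inside? Q ys)) (fresh ys li))))) ⟩
      2 ^ m * (∑[ ys ∈ tuples B m ] (ι (linInd? ys) * (ι (inside? Q ys) * (2 * new ys))))
        ≡⟨ cong (2 ^ m *_) (trans (∑-cong (tuples B m) (λ ys → e₂ (ι (linInd? ys)) (ι (inside? Q ys)) (new ys))) (∑-*ˡ (tuples B m) 2 _)) ⟩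
      2 ^ m * (2 * (∑[ ys ∈ tuples B m ] (ι (linInd? ys) * ι (inside? Q ys) * new ys)))
        ≡⟨ e₃ (2 ^ m) _ ⟩
      2 ^ suc m * (∑[ ys ∈ tuples B m ] (ι (linInd? ys) * ι (inside? Q ys) * new ys))
        ≤⟨ *-monoʳ-≤ (2 ^ suc m) (∑-mono (tuples B m) extend) ⟩
      2 ^ suc m * (∑[ ys ∈ tuples B m ] ∑[ y ∈ B ] (ι (linInd? (y ∷ ys)) * ι (inside? Q (y ∷ ys))))
        ≡⟨ cong (2 ^ suc m *_) (trans (∑-tuples B m _) (∑-swap B (tuples B m) _)) ⟨
      2 ^ suc m * insiders Q (suc m) ∎
      where
      e₁ : ∀ x y z → x * (y * z) ≡ y * (z * x)
      e₁ = solve-∀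
      e₂ : ∀ x y z → x * (y * (2 * z)) ≡ 2 * (x * y * z)
      e₂ = solve-∀
      e₃ : ∀ x y → x * (2 * y) ≡ 2 * x * y
      e₃ = solve-∀
      new? : ∀ (ys : Vec (Vector k) m) y → Dec (Ker Q y × ¬ Ker (span ys) y)
      new? ys y = ker? Q y ×-dec ¬? (ker? (span ys) y)
      new : Vec (Vector k) m → ℕ
      new ys = ∑[ y ∈ B ] ι (new? ys y)
      -- Fewer than `e` independent vectors leave codimension at least `k - e + 1`; hence the
      -- condition `L + e ≡ suc k`.
      L≤ : ∀ (ys : Vec (Vector k) m) → LinInd ys → L ≤ length (span ys)
      L≤ ys li = +-cancelʳ-≤ (suc m) _ _ (≤-trans (+-monoʳ-≤ L m<e)
        (≤-reflexive (trans L+e (trans (cong suc (sym li)) (sym (+-suc _ m))))))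
      fresh : ∀ ys → LinInd ys → β Q ≤ 2 * new ys
      fresh ys li = +-cancelʳ-≤ (β Q) _ _ (begin
        β Q + β Q                          ≡⟨ cong (β Q +_) (+-identityʳ (β Q)) ⟨
        2 * β Q                            ≤⟨ *-monoʳ-≤ 2 (begin
           β Q                                                  ≤⟨ ∑-mono B cover ⟩
           (∑[ y ∈ B ] (ι (new? ys y) + ι (ker? (span ys) y)))  ≡⟨ ∑-+ B _ _ ⟩
           new ys + β (span ys)                                 ∎) ⟩
        2 * (new ys + β (span ys))         ≡⟨ *-distribˡ-+ 2 (new ys) _ ⟩
        2 * new ys + 2 * β (span ys)
          ≤⟨ +-monoʳ-≤ (2 * new ys) (rich-dominates rich (span-independent ys) (L≤ ys li)) ⟩
        2 * new ys + β Q                   ∎)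
        where
        cover : ∀ y → ι (ker? Q y) ≤ ι (new? ys y) + ι (ker? (span ys) y)
        cover y with ker? Q y | ker? (span ys) y
        ... | no _  | _     = z≤n
        ... | yes _ | yes _ = ≤-refl
        ... | yes _ | no _  = ≤-refl
      extend : ∀ ys → ι (linInd? ys) * ι (inside? Q ys) * new ys ≤
               ∑[ y ∈ B ] (ι (linInd? (y ∷ ys)) * ι (inside? Q (y ∷ ys)))
      extend ys = ≤-trans (≤-reflexive (sym (∑-*ˡ B (ι (linInd? ys) * ι (inside? Q ys)) _))) (∑-mono B pointwise)
        where
        pointwise : ∀ y → ι (linInd? ys) * ι (inside? Q ys) * ι (new? ys y) ≤ ι (linInd? (y ∷ ys)) * ι (inside? Q (y ∷ ys))
        pointwise y = ι³-mono (linInd? ys) (inside? Q ys) (new? ys y) (linInd? (y ∷ ys)) (inside? Q (y ∷ ys))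
          (λ li In (Qy , y∉) → trans (trans (+-suc _ m) (cong (_+ m) (length-step y (span ys) y∉))) li , Qy ∷ In)

    private
      ℓ = proj₁ (quotients b)
      q = proj₁ (proj₂ (quotients b))
      1≤ℓ = proj₁ (proj₂ (proj₂ (quotients b)))
      div = proj₂ (proj₂ (proj₂ (quotients b)))

    -- This is `β Q ^ (- e)` scaled by `ℓ ^ e`, so that it cancels the number of `e`-tuples of `B`
    -- in the kernel. The empty list of functionals, to which `gain` does not apply, gets weight 0.
    weight : Rows k → ℕ
    weight Q = ι (1 ≤? length Q) * q (β Q) ^ e

    weight-cong : ∀ {Q Q'} → Q ≈ Q' → weight Q ≡ weight Q'
    weight-cong Q≈Q' = cong₂ (λ l n → ι (1 ≤? l) * q n ^ e) (length≡ Q≈Q') (β-cong Q≈Q')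

    q*β≤ℓ : ∀ Q → q (β Q) * β Q ≤ ℓ
    q*β≤ℓ Q with 1 ≤? β Q
    ... | yes 1≤β = ≤-reflexive (div (β Q) 1≤β (β≤b Q))
    ... | no β<1 rewrite n<1⇒n≡0 (≰⇒> β<1) = ≤-trans (≤-reflexive (*-zeroʳ (q 0))) z≤n

    -- Each of the `e` exchanges replaces `β Q / b` by `α Q / a` and gains `T`. This is the bound
    -- that `∑-skips` asks for.
    weight*α≤ : ∀ {Q} → Independent Q → (T * b) ^ e * weight Q * α Q ^ e ≤ (ℓ * a) ^ e
    weight*α≤ {Q} ind with 1 ≤? length Q
    ... | no _ = ≤-trans (≤-reflexive (cong (_* α Q ^ e) (*-zeroʳ ((T * b) ^ e)))) z≤n
    ... | yes 1≤len = begin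
      (T * b) ^ e * (1 * q (β Q) ^ e) * α Q ^ e
        ≡⟨ cong (λ x → (T * b) ^ e * x * α Q ^ e) (*-identityˡ (q (β Q) ^ e)) ⟩
      (T * b) ^ e * q (β Q) ^ e * α Q ^ e
        ≡⟨ trans (^-distribʳ-* e (T * b * q (β Q)) (α Q)) (cong (_* α Q ^ e) (^-distribʳ-* e (T * b) (q (β Q)))) ⟨
      (T * b * q (β Q) * α Q) ^ e                  ≤⟨ ^-monoˡ-≤ e (begin
        T * b * q (β Q) * α Q                         ≡⟨ e₁ T b (q (β Q)) (α Q) ⟩
        q (β Q) * (T * α Q * b)                       ≤⟨ *-monoʳ-≤ (q (β Q)) (gain ind 1≤len) ⟩
        q (β Q) * (β Q * a)                           ≡⟨ *-assoc (q (β Q)) (β Q) a ⟨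
        q (β Q) * β Q * a                             ≤⟨ *-monoˡ-≤ a (q*β≤ℓ Q) ⟩
        ℓ * a                                         ∎) ⟩
      (ℓ * a) ^ e                                  ∎
      where
      e₁ : ∀ T b q α → T * b * q * α ≡ q * (T * α * b)
      e₁ = solve-∀

    richCount : ∀ d → ℕ
    richCount d = ∑[ xs ∈ tuples A d ] (ι (linInd? xs) * ι (rich? (span xs)))

    -- Every rich `xs` is charged to the independent `ys` inside its span, which `insiders-many`
    -- supplies. After the sums are exchanged `ys` comes first, and `e` of the vectors in `xs` are
    -- redundant.
    richCount-weighted : ∀ d → d < k → richCount d * ℓ ^ e ≤
      2 ^ e * (∑[ ys ∈ tuples B e ] ι (linInd? ys) * (∑[ xs ∈ tuples A d ] (ι (skips? (span ys) xs e) * weight (run (span ys) xs))))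
    richCount-weighted d d<k = begin
      richCount d * ℓ ^ e
        ≡⟨ ∑-*ʳ (tuples A d) (ℓ ^ e) _ ⟨
      (∑[ xs ∈ tuples A d ] (ι (linInd? xs) * ι (rich? (span xs)) * ℓ ^ e))
        ≤⟨ ∑-mono (tuples A d) unweight ⟩
      (∑[ xs ∈ tuples A d ] (ι (linInd? xs) * (weight (span xs) * (2 ^ e * insiders (span xs) e))))
        ≡⟨ trans (∑-cong (tuples A d) (λ xs → e₁ (ι (linInd? xs)) (weight (span xs)) (2 ^ e) (insiders (span xs) e))) (∑-*ˡ (tuples A d) (2 ^ e) _) ⟩
      2 ^ e * (∑[ xs ∈ tuples A d ] (ι (linInd? xs) * weight (span xs) * insiders (span xs) e))
        ≡⟨ cong (2 ^ e *_) (trans (∑-cong (tuples A d) (λ xs → sym (∑-*ˡ (tuples B e) (ι (linInd? xs) * weight (span xs)) _))) (∑-swap (tuples A d) (tuples B e) _)) ⟩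
      2 ^ e * (∑[ ys ∈ tuples B e ] ∑[ xs ∈ tuples A d ] (ι (linInd? xs) * weight (span xs) * (ι (linInd? ys) * ι (inside? (span xs) ys))))
        ≤⟨ *-monoʳ-≤ (2 ^ e) (∑-mono (tuples B e) (λ ys → ∑-mono (tuples A d) (λ xs → reorder xs ys))) ⟩
      2 ^ e * (∑[ ys ∈ tuples B e ] ∑[ xs ∈ tuples A d ] (ι (linInd? ys) * (ι (skips? (span ys) xs e) * weight (run (span ys) xs))))
        ≡⟨ cong (2 ^ e *_) (∑-cong (tuples B e) (λ ys → ∑-*ˡ (tuples A d) (ι (linInd? ys)) _)) ⟩
      _ ∎
      where
      e₁ : ∀ x w y z → x * (w * (y * z)) ≡ y * (x * w * z)
      e₁ = solve-∀
      nonempty : ∀ (xs : Vec (Vector k) d) → LinInd xs → 1 ≤ length (span xs)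
      nonempty xs li with length (span xs)
      ... | zero  = ⊥-elim (<-irrefl li d<k)
      ... | suc _ = s≤s z≤n
      unweight : ∀ xs → ι (linInd? xs) * ι (rich? (span xs)) * ℓ ^ e ≤
                 ι (linInd? xs) * (weight (span xs) * (2 ^ e * insiders (span xs) e))
      unweight xs with linInd? xs
      ... | no _ = z≤n
      ... | yes li with rich? Q
        where Q = span xs
      ...   | no _ = z≤n
      ...   | yes rich = begin
        1 * 1 * ℓ ^ e                          ≡⟨ *-identityˡ _ ⟩
        ℓ ^ e                                  ≡⟨ cong (_^ e) (div (β Q) 1≤β (β≤b Q)) ⟨
        (q (β Q) * β Q) ^ e                    ≡⟨ ^-distribʳ-* e (q (β Q)) (β Q) ⟩
        q (β Q) ^ e * β Q ^ e                  ≤⟨ *-monoʳ-≤ (q (β Q) ^ e) (insiders-many rich e ≤-refl) ⟩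
        q (β Q) ^ e * (2 ^ e * insiders Q e)
          ≡⟨ cong (_* (2 ^ e * insiders Q e)) (trans (cong (_* q (β Q) ^ e) (ι-yes (1 ≤? length Q) (nonempty xs li))) (*-identityˡ _)) ⟨
        weight Q * (2 ^ e * insiders Q e)      ≡⟨ *-identityˡ _ ⟨
        1 * (weight Q * (2 ^ e * insiders Q e)) ∎
        where
        Q = span xs
        1≤β : 1 ≤ β Q
        1≤β = n≢0⇒n>0 (λ z → <⇒≱ (≤-trans 1≤b (m≤m+n b _)) (≤-trans rich (≤-reflexive (trans (cong (T ^ L *_) z) (*-zeroʳ (T ^ L))))))
      reorder : ∀ xs ys → ι (linInd? xs) * weight (span xs) * (ι (linInd? ys) * ι (inside? (span xs) ys)) ≤
                ι (linInd? ys) * (ι (skips? (span ys) xs e) * weight (run (span ys) xs))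
      reorder xs ys with linInd? xs
      ... | no _ = z≤n
      ... | yes li with linInd? ys
      ...   | no _ = ≤-reflexive (*-zeroʳ (1 * weight (span xs)))
      ...   | yes li' with inside? (span xs) ys
      ...     | no _ = ≤-trans (≤-reflexive (*-zeroʳ (1 * weight (span xs)))) z≤n
      ...     | yes In = ≤-reflexive (trans (trans (*-identityʳ _) (trans (*-identityˡ _) (weight-cong (≈-sym same))))
                  (sym (trans (*-identityˡ _) (trans (cong (_* weight (run (span ys) xs)) (ι-yes (skips? (span ys) xs e) skipped)) (*-identityˡ _)))))
        where
        absorb : ∀ {Q m} (ys : Vec (Vector k) m) → VecAll.All (Ker Q) ys → run Q ys ≡ Q
        absorb []       []        = refl
        absorb (y ∷ ys) (Qy ∷ Qys) = trans (cong (step y) (absorb ys Qys)) (step-ker y Qy)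
        -- Adding `ys` to the span of `xs` changes nothing, and the order of adding is immaterial.
        -- The codimensions `k - e` and `k - d` then force exactly `e` skips.
        same : run (span ys) xs ≈ span xs
        same = ≈-trans (run-swap (basis k) xs ys) (≈-reflexive (absorb ys In))
        skipped : length (run (span ys) xs) + d ≡ length (span ys) + e
        skipped = trans (cong (_+ d) (length≡ same)) (trans li (sym li'))

    -- The sum over `ys` is bounded by its length. The factor `2 ^ d` counts the positions of the
    -- skips, and `2 ^ e` comes from `insiders-many`.
    richCount-rare : ∀ d → d < k → T ^ e * richCount d ≤ 2 ^ e * 2 ^ d * a ^ d
    richCount-rare d d<k = *-cancelˡ-≤ (a ^ e * b ^ e * ℓ ^ e) {{nz}} (begin
      a ^ e * b ^ e * ℓ ^ e * (T ^ e * R)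
        ≡⟨ e₁ (a ^ e) (b ^ e) (ℓ ^ e) (T ^ e) R ⟩
      a ^ e * (T ^ e * b ^ e) * (R * ℓ ^ e)
        ≡⟨ cong (λ x → a ^ e * x * (R * ℓ ^ e)) (^-distribʳ-* e T b) ⟨
      a ^ e * (T * b) ^ e * (R * ℓ ^ e)
        ≤⟨ *-monoʳ-≤ (a ^ e * (T * b) ^ e) (richCount-weighted d d<k) ⟩
      a ^ e * (T * b) ^ e * (2 ^ e * (∑[ ys ∈ tuples B e ] ι (linInd? ys) * S ys))
        ≡⟨ trans (e₂ (a ^ e * (T * b) ^ e) (2 ^ e) _) (cong (2 ^ e *_) (sym (∑-*ˡ (tuples B e) (a ^ e * (T * b) ^ e) _))) ⟩
      2 ^ e * (∑[ ys ∈ tuples B e ] a ^ e * (T * b) ^ e * (ι (linInd? ys) * S ys))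
        ≤⟨ *-monoʳ-≤ (2 ^ e) (∑-≤-const (tuples B e) bound) ⟩
      2 ^ e * (length (tuples B e) * (2 ^ d * a ^ d * (ℓ * a) ^ e))
        ≡⟨ cong₂ (λ x y → 2 ^ e * (x * (2 ^ d * a ^ d * y))) (length-tuples B e) (^-distribʳ-* e ℓ a) ⟩
      2 ^ e * (b ^ e * (2 ^ d * a ^ d * (ℓ ^ e * a ^ e)))
        ≡⟨ e₃ (2 ^ e) (b ^ e) (2 ^ d) (a ^ d) (ℓ ^ e) (a ^ e) ⟩
      a ^ e * b ^ e * ℓ ^ e * (2 ^ e * 2 ^ d * a ^ d) ∎)
      where
      R = richCount d
      S : Vec (Vector k) e → ℕ
      S ys = ∑[ xs ∈ tuples A d ] (ι (skips? (span ys) xs e) * weight (run (span ys) xs))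
      nz : NonZero (a ^ e * b ^ e * ℓ ^ e)
      nz = m*n≢0 (a ^ e * b ^ e) (ℓ ^ e) {{m*n≢0 (a ^ e) (b ^ e) {{m^n≢0 a e {{>-nonZero 1≤a}}}} {{m^n≢0 b e {{>-nonZero 1≤b}}}}}} {{m^n≢0 ℓ e {{>-nonZero 1≤ℓ}}}}
      e₁ : ∀ a b l t r → a * b * l * (t * r) ≡ a * (t * b) * (r * l)
      e₁ = solve-∀
      e₂ : ∀ x y z → x * (y * z) ≡ y * (x * z)
      e₂ = solve-∀
      e₃ : ∀ t b u v l a → t * (b * (u * v * (l * a))) ≡ a * b * l * (t * u * v)
      e₃ = solve-∀
      bound : ∀ ys → a ^ e * (T * b) ^ e * (ι (linInd? ys) * S ys) ≤ 2 ^ d * a ^ d * (ℓ * a) ^ e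
      bound ys = begin
        a ^ e * (T * b) ^ e * (ι (linInd? ys) * S ys)
          ≤⟨ *-monoʳ-≤ (a ^ e * (T * b) ^ e) (≤-trans (*-monoˡ-≤ (S ys) (ι≤1 (linInd? ys))) (≤-reflexive (*-identityˡ (S ys)))) ⟩
        a ^ e * (T * b) ^ e * S ys
          ≡⟨ trans (*-assoc (a ^ e) ((T * b) ^ e) (S ys)) (cong (a ^ e *_) (sym (∑-*ˡ (tuples A d) ((T * b) ^ e) _))) ⟩
        a ^ e * (∑[ xs ∈ tuples A d ] (T * b) ^ e * (ι (skips? (span ys) xs e) * weight (run (span ys) xs)))
          ≡⟨ cong (a ^ e *_) (∑-cong (tuples A d) (λ xs → e₂ ((T * b) ^ e) (ι (skips? (span ys) xs e)) _)) ⟩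
        a ^ e * (∑[ xs ∈ tuples A d ] ι (skips? (span ys) xs e) * ((T * b) ^ e * weight (run (span ys) xs)))
          ≤⟨ ∑-skips d e (span-independent ys) (λ Q → (T * b) ^ e * weight Q) ((ℓ * a) ^ e) weight*α≤ ⟩
        2 ^ d * a ^ d * (ℓ * a) ^ e ∎

    module _ (Θ C : ℕ) (Θ≤T^e : Θ ≤ T ^ e) (Θ≤T^L : Θ ≤ T ^ L) (C≥ : ∀ d → d < k → 2 + 2 ^ e * 2 ^ d ≤ C) where

      degenerate : ∀ d → ℕ
      degenerate d = ∑[ xs ∈ tuples A d ] (ι (linInd? xs) * α (span xs))

      -- In `C` the summand 2 pays for the spans that are not rich, and `2 ^ e * 2 ^ d` for the rich
      -- ones, where every next vector is allowed.
      degenerate-rare : ∀ d → d < k → Θ * degenerate d ≤ C * a ^ suc d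
      degenerate-rare d d<k = begin
        Θ * degenerate d
          ≡⟨ ∑-*ˡ (tuples A d) Θ _ ⟨
        (∑[ xs ∈ tuples A d ] Θ * (ι (linInd? xs) * α (span xs)))
          ≤⟨ ∑-mono (tuples A d) pointwise ⟩
        (∑[ xs ∈ tuples A d ] (2 * a + ι (linInd? xs) * ι (rich? (span xs)) * (Θ * a)))
          ≡⟨ trans (∑-+ (tuples A d) _ _) (cong₂ _+_ (trans (∑-const (tuples A d) (2 * a)) (cong (_* (2 * a)) (length-tuples A d))) (∑-*ʳ (tuples A d) (Θ * a) _)) ⟩
        a ^ d * (2 * a) + richCount d * (Θ * a)
          ≤⟨ +-monoʳ-≤ (a ^ d * (2 * a)) (begin
            richCount d * (Θ * a)            ≡⟨ e₁ (richCount d) Θ a ⟩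
            a * (Θ * richCount d)            ≤⟨ *-monoʳ-≤ a (*-monoˡ-≤ (richCount d) Θ≤T^e) ⟩
            a * (T ^ e * richCount d)        ≤⟨ *-monoʳ-≤ a (richCount-rare d d<k) ⟩
            a * (2 ^ e * 2 ^ d * a ^ d)      ∎) ⟩
        a ^ d * (2 * a) + a * (2 ^ e * 2 ^ d * a ^ d)
          ≡⟨ e₂ (a ^ d) a (2 ^ e * 2 ^ d) ⟩
        (2 + 2 ^ e * 2 ^ d) * (a * a ^ d)
          ≤⟨ *-monoˡ-≤ (a * a ^ d) (C≥ d d<k) ⟩
        C * a ^ suc d ∎
        where
        e₁ : ∀ x y z → x * (y * z) ≡ z * (y * x)
        e₁ = solve-∀
        e₂ : ∀ x a y → x * (2 * a) + a * (y * x) ≡ (2 + y) * (a * x)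
        e₂ = solve-∀
        poor : ∀ xs → LinInd xs → ¬ Rich (span xs) → Θ * α (span xs) ≤ 2 * a
        poor xs li ¬rich = *-cancelʳ-≤ _ _ b {{>-nonZero 1≤b}} (begin
          Θ * α Q * b                ≤⟨ *-monoˡ-≤ b (*-monoˡ-≤ (α Q) Θ≤T^L) ⟩
          T ^ L * α Q * b
            ≡⟨ trans (*-assoc (T ^ L) (α Q) b) (cong (T ^ L *_) (sym (*-identityˡ _))) ⟩
          T ^ L * (1 * (α Q * b))    ≤⟨ *-monoʳ-≤ (T ^ L) (*-monoˡ-≤ (α Q * b) 1≤T) ⟩
          T ^ L * (T * (α Q * b))    ≡⟨ cong (T ^ L *_) (*-assoc T (α Q) b) ⟨
          T ^ L * (T * α Q * b)      ≤⟨ *-monoʳ-≤ (T ^ L) (gain (span-independent xs) nonempty) ⟩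
          T ^ L * (β Q * a)          ≡⟨ *-assoc (T ^ L) (β Q) a ⟨
          T ^ L * β Q * a            ≤⟨ *-monoˡ-≤ a (<⇒≤ (≰⇒> ¬rich)) ⟩
          2 * b * a                  ≡⟨ e₃ b a ⟩
          2 * a * b                  ∎)
          where
          Q = span xs
          e₃ : ∀ x y → 2 * x * y ≡ 2 * y * x
          e₃ = solve-∀
          nonempty : 1 ≤ length Q
          nonempty = +-cancelʳ-≤ d 1 (length Q) (≤-trans d<k (≤-reflexive (sym li)))
        pointwise : ∀ xs → Θ * (ι (linInd? xs) * α (span xs)) ≤ 2 * a + ι (linInd? xs) * ι (rich? (span xs)) * (Θ * a)
        pointwise xs with linInd? xs
        ... | no _ = ≤-trans (≤-reflexive (*-zeroʳ Θ)) z≤n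
        ... | yes li with rich? (span xs)
        ...   | yes _ = ≤-trans (*-monoʳ-≤ Θ (≤-trans (≤-reflexive (*-identityˡ _)) (α≤a (span xs)))) (≤-trans (≤-reflexive (sym (*-identityˡ _))) (m≤n+m _ (2 * a)))
        ...   | no ¬rich = ≤-trans (≤-reflexive (cong (Θ *_) (*-identityˡ _))) (≤-trans (poor xs li ¬rich) (m≤m+n _ _))

      -- A dependent tuple has a first vector, in the order of drawing, inside the span of the
      -- earlier ones; each of the `m` positions costs at most `C / Θ`.
      dependent-rare : ∀ m → m ≤ k → Θ * dependent m ≤ m * C * a ^ m
      dependent-rare zero _ rewrite ι-no (¬? (linInd? [])) (λ ¬li → ¬li (trans (+-identityʳ _) (length-basis k))) = ≤-reflexive (*-zeroʳ Θ)
      dependent-rare (suc m) m<k = begin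
        Θ * dependent (suc m)
          ≡⟨ cong (Θ *_) (trans (∑-tuples A m _) (∑-swap A (tuples A m) _)) ⟩
        Θ * (∑[ xs ∈ tuples A m ] ∑[ x ∈ A ] ι (¬? (linInd? (x ∷ xs))))
          ≤⟨ *-monoʳ-≤ Θ (∑-mono (tuples A m) (λ xs → ∑-mono A (pointwise xs))) ⟩
        Θ * (∑[ xs ∈ tuples A m ] ∑[ x ∈ A ] (ι (¬? (linInd? xs)) + ι (linInd? xs) * ι (ker? (span xs) x)))
          ≡⟨ cong (Θ *_) (∑-cong (tuples A m) (λ xs → trans (∑-+ A _ _) (cong₂ _+_ (∑-const A _) (∑-*ˡ A (ι (linInd? xs)) _)))) ⟩
        Θ * (∑[ xs ∈ tuples A m ] (a * ι (¬? (linInd? xs)) + ι (linInd? xs) * α (span xs)))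
          ≡⟨ cong (Θ *_) (trans (∑-+ (tuples A m) _ _) (cong (_+ degenerate m) (∑-*ˡ (tuples A m) a _))) ⟩
        Θ * (a * dependent m + degenerate m)
          ≡⟨ e₁ Θ a (dependent m) (degenerate m) ⟩
        a * (Θ * dependent m) + Θ * degenerate m
          ≤⟨ +-mono-≤ (*-monoʳ-≤ a (dependent-rare m (<⇒≤ m<k))) (degenerate-rare m m<k) ⟩
        a * (m * C * a ^ m) + C * (a * a ^ m)
          ≡⟨ e₂ a m C (a ^ m) ⟩
        suc m * C * a ^ suc m ∎
        where
        e₁ : ∀ t a x y → t * (a * x + y) ≡ a * (t * x) + t * y
        e₁ = solve-∀
        e₂ : ∀ a m C x → a * (m * C * x) + C * (a * x) ≡ (1 + m) * C * (a * x)
        e₂ = solve-∀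
        pointwise : ∀ xs x → ι (¬? (linInd? (x ∷ xs))) ≤ ι (¬? (linInd? xs)) + ι (linInd? xs) * ι (ker? (span xs) x)
        pointwise xs x with linInd? xs
        ... | no _ = ≤-trans (ι≤1 (¬? (linInd? (x ∷ xs)))) (s≤s z≤n)
        ... | yes li with ker? (span xs) x
        ...   | yes _ = ι≤1 (¬? (linInd? (x ∷ xs)))
        ...   | no x∉ = ≤-reflexive (ι-no (¬? (linInd? (x ∷ xs)))
                  (λ ¬li → ¬li (trans (trans (+-suc _ m) (cong (_+ m) (length-step x (span xs) x∉))) li)))

-- Singular matrices have a left kernel

sumℤ-cong : {f g : Fin n → ℤ} → (∀ i → f i ≡ g i) → sumℤ f ≡ sumℤ g
sumℤ-cong {zero}  eq = refl
sumℤ-cong {suc n} eq = cong₂ ℤ._+_ (eq zero) (sumℤ-cong (eq ∘ suc))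

sumℤ-comb : ∀ s t (f g : Fin n → ℤ) →
  sumℤ (λ i → s ℤ.* f i ℤ.+ t ℤ.* g i) ≡ s ℤ.* sumℤ f ℤ.+ t ℤ.* sumℤ g
sumℤ-comb {zero}  s t f g = sym (cong₂ ℤ._+_ (ℤ.*-zeroʳ s) (ℤ.*-zeroʳ t))
sumℤ-comb {suc n} s t f g rewrite sumℤ-comb s t (f ∘ suc) (g ∘ suc) =
  lem s t (f zero) (g zero) (sumℤ (f ∘ suc)) (sumℤ (g ∘ suc))
  where
  lem : ∀ s t a b c d → s ℤ.* a ℤ.+ t ℤ.* b ℤ.+ (s ℤ.* c ℤ.+ t ℤ.* d) ≡ s ℤ.* (a ℤ.+ c) ℤ.+ t ℤ.* (b ℤ.+ d)
  lem = ℤSolver.solve-∀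

sumℤ-*ˡ : ∀ s (f : Fin n → ℤ) → sumℤ (λ i → s ℤ.* f i) ≡ s ℤ.* sumℤ f
sumℤ-*ˡ {zero}  s f = sym (ℤ.*-zeroʳ s)
sumℤ-*ˡ {suc n} s f rewrite sumℤ-*ˡ s (f ∘ suc) = sym (ℤ.*-distribˡ-+ s (f zero) _)

sumℤ-zero : {f : Fin n → ℤ} → (∀ i → f i ≡ 0ℤ) → sumℤ f ≡ 0ℤ
sumℤ-zero {zero}  eq = refl
sumℤ-zero {suc n} eq = cong₂ ℤ._+_ (eq zero) (sumℤ-zero (eq ∘ suc))

minor : Matrix (suc n) (suc n) → Fin (suc n) → Matrix n n
minor M j r c = M (suc r) (punchIn j c)

term : Matrix (suc n) (suc n) → Fin (suc n) → ℤ
term M j = sign (toℕ j) ℤ.* M zero j ℤ.* det (minor M j)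

det-cong : {M M' : Matrix n n} → (∀ r c → M r c ≡ M' r c) → det M ≡ det M'
det-cong {zero}  eq = refl
det-cong {suc n} eq = sumℤ-cong (λ j → cong₂ (λ a d → sign (toℕ j) ℤ.* a ℤ.* d) (eq zero j)
  (det-cong (λ r c → eq (suc r) (punchIn j c))))

-- In the expansion along the first row, the term of column `l` is linear through its entry; every
-- other term is linear through its minor, where column `l` has become `punchOut j≢l`.
det-linear : ∀ (l : Fin n) (M M' M'' : Matrix n n) s t →
  (∀ r → M r l ≡ s ℤ.* M' r l ℤ.+ t ℤ.* M'' r l) →
  (∀ r c → c ≢ l → M r c ≡ M' r c × M r c ≡ M'' r c) →
  det M ≡ s ℤ.* det M' ℤ.+ t ℤ.* det M''
det-linear {suc n} l M M' M'' s t at off =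
  trans (sumℤ-cong linear) (sumℤ-comb s t (term M') (term M''))
  where
  lem₁ : ∀ g s t a b d → g ℤ.* (s ℤ.* a ℤ.+ t ℤ.* b) ℤ.* d ≡ s ℤ.* (g ℤ.* a ℤ.* d) ℤ.+ t ℤ.* (g ℤ.* b ℤ.* d)
  lem₁ = ℤSolver.solve-∀
  lem₂ : ∀ g s t a d e → g ℤ.* a ℤ.* (s ℤ.* d ℤ.+ t ℤ.* e) ≡ s ℤ.* (g ℤ.* a ℤ.* d) ℤ.+ t ℤ.* (g ℤ.* a ℤ.* e)
  lem₂ = ℤSolver.solve-∀
  linear : ∀ j → term M j ≡ s ℤ.* term M' j ℤ.+ t ℤ.* term M'' j
  linear j with j Fin.≟ l
  ... | yes refl = trans (cong (λ a → sign (toℕ j) ℤ.* a ℤ.* det (minor M j)) (at zero))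
        (trans (lem₁ (sign (toℕ j)) s t (M' zero j) (M'' zero j) (det (minor M j)))
          (cong₂ (λ d e → s ℤ.* (sign (toℕ j) ℤ.* M' zero j ℤ.* d) ℤ.+ t ℤ.* (sign (toℕ j) ℤ.* M'' zero j ℤ.* e))
            (det-cong (λ r c → proj₁ (off (suc r) (punchIn j c) (Fin.punchInᵢ≢i j c))))
            (det-cong (λ r c → proj₂ (off (suc r) (punchIn j c) (Fin.punchInᵢ≢i j c))))))
  ... | no j≢l = trans (cong (λ d → sign (toℕ j) ℤ.* M zero j ℤ.* d)
          (det-linear (punchOut j≢l) (minor M j) (minor M' j) (minor M'' j) s t at' off'))
        (trans (lem₂ (sign (toℕ j)) s t (M zero j) (det (minor M' j)) (det (minor M'' j)))
          (cong₂ (λ a b → s ℤ.* (sign (toℕ j) ℤ.* a ℤ.* det (minor M' j)) ℤ.+ t ℤ.* (sign (toℕ j) ℤ.* b ℤ.* det (minor M'' j)))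
            (proj₁ (off zero j j≢l)) (proj₂ (off zero j j≢l))))
    where
    at' : ∀ r → minor M j r (punchOut j≢l) ≡ s ℤ.* minor M' j r (punchOut j≢l) ℤ.+ t ℤ.* minor M'' j r (punchOut j≢l)
    at' r rewrite Fin.punchIn-punchOut j≢l = at (suc r)
    off' : ∀ r c → c ≢ punchOut j≢l → minor M j r c ≡ minor M' j r c × minor M j r c ≡ minor M'' j r c
    off' r c c≢ = off (suc r) (punchIn j c)
      (λ e → c≢ (Fin.punchIn-injective j c (punchOut j≢l) (trans e (sym (Fin.punchIn-punchOut j≢l)))))

sumℤ-adjacent : (f : Fin (suc n) → ℤ) (i : Fin n) → f (inject₁ i) ℤ.+ f (suc i) ≡ 0ℤ →
  (∀ j → j ≢ inject₁ i → j ≢ suc i → f j ≡ 0ℤ) → sumℤ f ≡ 0ℤ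
sumℤ-adjacent f zero eq rest = trans (sym (ℤ.+-assoc (f zero) (f (suc zero)) _))
  (cong₂ ℤ._+_ eq (sumℤ-zero (λ j → rest (suc (suc j)) (λ ()) (λ ()))))
sumℤ-adjacent f (suc i) eq rest = cong₂ ℤ._+_ (rest zero (λ ()) (λ ()))
  (sumℤ-adjacent (f ∘ suc) i eq (λ j j≢ j≢' → rest (suc j) (j≢ ∘ Fin.suc-injective) (j≢' ∘ Fin.suc-injective)))

punchIn-adjacent : ∀ (i c : Fin n) → punchIn (inject₁ i) c ≡ punchIn (suc i) c ⊎
  (punchIn (inject₁ i) c ≡ suc i × punchIn (suc i) c ≡ inject₁ i)
punchIn-adjacent zero    zero    = inj₂ (refl , refl)
punchIn-adjacent zero    (suc c) = inj₁ refl
punchIn-adjacent (suc i) zero    = inj₁ refl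
punchIn-adjacent (suc i) (suc c) with punchIn-adjacent i c
... | inj₁ e        = inj₁ (cong suc e)
... | inj₂ (e , e') = inj₂ (cong suc e , cong suc e')

adjacent-preimage : ∀ (j : Fin (suc (suc n))) (i : Fin (suc n)) → j ≢ inject₁ i → j ≢ suc i →
  ∃ λ i' → punchIn j (inject₁ i') ≡ inject₁ i × punchIn j (suc i') ≡ suc i
adjacent-preimage zero          zero    j≢ j≢' = ⊥-elim (j≢ refl)
adjacent-preimage zero          (suc i) j≢ j≢' = i , refl , refl
adjacent-preimage (suc zero)    zero    j≢ j≢' = ⊥-elim (j≢' refl)
adjacent-preimage {suc n} (suc (suc j)) zero j≢ j≢' = zero , refl , refl
adjacent-preimage {suc n} (suc j) (suc i) j≢ j≢' with adjacent-preimage j i (j≢ ∘ cong suc) (j≢' ∘ cong suc)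
... | i' , e , e' = suc i' , cong suc e , cong suc e'

-- The terms of the two columns have equal minors and opposite signs; every other minor again has
-- two equal adjacent columns. Elimination between neighbours needs no more.
det-adjacent-equal : ∀ (i : Fin n) (M : Matrix (suc n) (suc n)) →
  (∀ r → M r (inject₁ i) ≡ M r (suc i)) → det M ≡ 0ℤ
det-adjacent-equal {suc n} i M eq = sumℤ-adjacent (term M) i pair rest
  where
  lem : ∀ g a d → g ℤ.* a ℤ.* d ℤ.+ ℤ.- g ℤ.* a ℤ.* d ≡ 0ℤ
  lem = ℤSolver.solve-∀
  same : ∀ r c → minor M (inject₁ i) r c ≡ minor M (suc i) r c
  same r c with punchIn-adjacent i c
  ... | inj₁ e        = cong (M (suc r)) e
  ... | inj₂ (e , e') = trans (cong (M (suc r)) e) (trans (sym (eq (suc r))) (cong (M (suc r)) (sym e')))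
  pair : term M (inject₁ i) ℤ.+ term M (suc i) ≡ 0ℤ
  pair rewrite Fin.toℕ-inject₁ i | eq zero | det-cong {M = minor M (inject₁ i)} {minor M (suc i)} same =
    lem (sign (toℕ i)) (M zero (suc i)) (det (minor M (suc i)))
  rest : ∀ j → j ≢ inject₁ i → j ≢ suc i → term M j ≡ 0ℤ
  rest j j≢ j≢' with adjacent-preimage j i j≢ j≢'
  ... | i' , e , e' = trans (cong (λ d → sign (toℕ j) ℤ.* M zero j ℤ.* d) (det-adjacent-equal i' (minor M j)
          (λ r → trans (cong (M (suc r)) e) (trans (eq (suc r)) (cong (M (suc r)) (sym e'))))))
        (ℤ.*-zeroʳ (sign (toℕ j) ℤ.* M zero j))

setColumn : Matrix k n → Fin n → (Fin k → ℤ) → Matrix k n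
setColumn M p v r c with c Fin.≟ p
... | yes _ = v r
... | no _  = M r c

setColumn-at : ∀ (M : Matrix k n) p v r → setColumn M p v r p ≡ v r
setColumn-at M p v r with p Fin.≟ p
... | yes _  = refl
... | no p≢p = ⊥-elim (p≢p refl)

setColumn-off : ∀ (M : Matrix k n) p v r {c} → c ≢ p → setColumn M p v r c ≡ M r c
setColumn-off M p v r {c} c≢p with c Fin.≟ p
... | yes c≡p = ⊥-elim (c≢p c≡p)
... | no _    = refl

Kills : (Fin k → ℤ) → Matrix k n → Set
Kills w M = ∀ c → sumℤ (λ r → w r ℤ.* M r c) ≡ 0ℤ

-- Singularity is carried forward to the simpler matrix, and its left kernel is carried back.
record _Reduces_ (M' M : Matrix n n) : Set where
  field
    det≡0  : det M ≡ 0ℤ → det M' ≡ 0ℤ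
    kills : ∀ w → Kills w M' → Kills w M
open _Reduces_

reduces-refl : {M : Matrix n n} → M Reduces M
reduces-refl = record { det≡0 = id ; kills = λ _ → id }

reduces-trans : {M M' M'' : Matrix n n} → M' Reduces M → M'' Reduces M' → M'' Reduces M
reduces-trans R R' = record { det≡0 = det≡0 R' ∘ det≡0 R ; kills = λ w → kills R w ∘ kills R' w }

columnOp : ∀ (M : Matrix n n) p p' s t → s ≢ 0ℤ → p' ≢ p → det (setColumn M p (λ r → M r p')) ≡ 0ℤ →
  setColumn M p (λ r → s ℤ.* M r p ℤ.+ t ℤ.* M r p') Reduces M
columnOp {n} M p p' s t s≢0 p'≢p repeated = record
  { det≡0 = λ e → trans (det-linear p M' M (setColumn M p (λ r → M r p')) s t
      (λ r → trans (setColumn-at M p v r) (cong (λ x → s ℤ.* M r p ℤ.+ t ℤ.* x) (sym (setColumn-at M p _ r))))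
      (λ r c c≢p → setColumn-off M p v r c≢p , trans (setColumn-off M p v r c≢p) (sym (setColumn-off M p _ r c≢p))))
      (combination-vanishes s t e repeated)
  ; kills = killed
  }
  where
  v : Fin n → ℤ
  v r = s ℤ.* M r p ℤ.+ t ℤ.* M r p'
  M' = setColumn M p v
  lem : ∀ w s t a b → w ℤ.* (s ℤ.* a ℤ.+ t ℤ.* b) ≡ s ℤ.* (w ℤ.* a) ℤ.+ t ℤ.* (w ℤ.* b)
  lem = ℤSolver.solve-∀
  killed : ∀ w → Kills w M' → Kills w M
  killed w kl = goal
    where
    off : ∀ c → c ≢ p → sumℤ (λ r → w r ℤ.* M r c) ≡ 0ℤ
    off c c≢p = trans (sumℤ-cong (λ r → cong (w r ℤ.*_) (sym (setColumn-off M p v r c≢p)))) (kl c)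
    goal : Kills w M
    goal c with c Fin.≟ p
    ... | no c≢p = off c c≢p
    ... | yes refl = combination-cancels s t s≢0 (off p' p'≢p) (trans (sym (sumℤ-comb s t (λ r → w r ℤ.* M r p) (λ r → w r ℤ.* M r p')))
            (trans (sumℤ-cong (λ r → trans (sym (lem (w r) s t (M r p) (M r p'))) (cong (w r ℤ.*_) (sym (setColumn-at M p v r))))) (kl p)))

inject₁≢suc : ∀ (i : Fin n) → inject₁ i ≢ suc i
inject₁≢suc i e = 1+n≢n (trans (sym (cong toℕ e)) (Fin.toℕ-inject₁ i))

ClearedAt : Fin n → Matrix (suc n) (suc n) → Matrix (suc n) (suc n) → Set
ClearedAt i M M' = M' Reduces M × M' zero (suc i) ≡ 0ℤ ×
  (∀ c → c ≢ inject₁ i → c ≢ suc i → M' zero c ≡ M zero c)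

eliminateNext : ∀ (i : Fin n) M → M zero (inject₁ i) ≢ 0ℤ → ∃ (ClearedAt i M)
eliminateNext i M h≢0 =
  _ , columnOp M (suc i) (inject₁ i) h (ℤ.- h') h≢0 (inject₁≢suc i)
        (det-adjacent-equal i (setColumn M (suc i) (λ r → M r (inject₁ i))) (λ r → trans (setColumn-off M (suc i) _ r (inject₁≢suc i)) (sym (setColumn-at M (suc i) _ r))))
  , trans (setColumn-at M (suc i) _ zero) (lem h h')
  , λ c _ c≢ → setColumn-off M (suc i) _ zero c≢
  where
  h = M zero (inject₁ i)
  h' = M zero (suc i)
  lem : ∀ a b → a ℤ.* b ℤ.+ ℤ.- b ℤ.* a ≡ 0ℤ
  lem = ℤSolver.solve-∀

clearNext : ∀ (i : Fin n) M → ∃ (ClearedAt i M)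
clearNext i M with M zero (suc i) ℤ.≟ 0ℤ
... | yes e = M , reduces-refl , e , λ _ _ _ → refl
... | no h'≢0 with M zero (inject₁ i) ℤ.≟ 0ℤ
...   | no h≢0 = eliminateNext i M h≢0
-- With a zero pivot, the right-hand column is first added to its left neighbour, which makes the
-- pivot nonzero.
...   | yes h≡0 with eliminateNext i M₁ head≢0
  where
  v : Fin _ → ℤ
  v r = 1ℤ ℤ.* M r (inject₁ i) ℤ.+ 1ℤ ℤ.* M r (suc i)
  M₁ = setColumn M (inject₁ i) v
  lem : ∀ a b → 1ℤ ℤ.* a ℤ.+ 1ℤ ℤ.* b ≡ a ℤ.+ b
  lem = ℤSolver.solve-∀
  head≢0 : M₁ zero (inject₁ i) ≢ 0ℤ
  head≢0 e = h'≢0 (trans (sym (ℤ.+-identityˡ _)) (trans (cong (ℤ._+ M zero (suc i)) (sym h≡0))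
    (trans (sym (lem (M zero (inject₁ i)) (M zero (suc i)))) (trans (sym (setColumn-at M (inject₁ i) v zero)) e))))
...     | M₂ , R , cleared , off = M₂ ,
          reduces-trans (columnOp M (inject₁ i) (suc i) 1ℤ 1ℤ (λ ()) (inject₁≢suc i ∘ sym)
            (det-adjacent-equal i (setColumn M (inject₁ i) (λ r → M r (suc i))) (λ r → trans (setColumn-at M (inject₁ i) _ r) (sym (setColumn-off M (inject₁ i) _ r (inject₁≢suc i ∘ sym)))))) R ,
          cleared , λ c c≢ c≢' → trans (off c c≢ c≢') (setColumn-off M (inject₁ i) _ zero c≢)

-- Goes from right to left. Each `clearNext` alters the first row in two neighbouring places only,
-- so the zeros further right remain.
sweep : ∀ (M : Matrix (suc n) (suc n)) m → m ≤ n →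
  ∃ λ M' → M' Reduces M × (∀ c → n ∸ m < toℕ c → M' zero c ≡ 0ℤ)
sweep M zero    _   = M , reduces-refl , λ c n<c → ⊥-elim (<⇒≱ n<c (s≤s⁻¹ (Fin.toℕ<n c)))
sweep {n} M (suc m) m<n with sweep M m (<⇒≤ m<n)
... | M₁ , R₁ , cleared with clearNext (fromℕ< (∸-monoʳ-< {n} {suc m} {0} (s≤s z≤n) m<n)) M₁
...   | M₂ , R₂ , at , off = M₂ , reduces-trans R₁ R₂ , heads
  where
  l = n ∸ suc m
  l<n : l < n
  l<n = ∸-monoʳ-< {n} {suc m} {0} (s≤s z≤n) m<n
  i = fromℕ< l<n
  suc-l : suc l ≡ n ∸ m
  suc-l = sym (+-∸-assoc 1 m<n)
  heads : ∀ c → l < toℕ c → M₂ zero c ≡ 0ℤ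
  heads c l<c with c Fin.≟ suc i
  ... | yes refl = at
  ... | no c≢ = trans (off c c≢' c≢) (cleared c (subst (_< toℕ c) suc-l (≤∧≢⇒< l<c
        (λ e → c≢ (Fin.toℕ-injective (trans (sym e) (cong suc (sym (Fin.toℕ-fromℕ< l<n)))))))))
    where
    c≢' : c ≢ inject₁ i
    c≢' refl = <-irrefl (sym (trans (Fin.toℕ-inject₁ i) (Fin.toℕ-fromℕ< l<n))) l<c

-- After `sweep` the first row is `a, 0, ..., 0`. If `a` is zero, the first unit vector works.
-- Otherwise `D` is singular, and a vector `w'` killing it extends to `- S`, `a * w'`, which also
-- cancels column zero.
det≡0⇒killed : ∀ {n} (M : Matrix n n) → det M ≡ 0ℤ → ∃ λ w → (∃ λ r → w r ≢ 0ℤ) × Kills w M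
det≡0⇒killed {suc n} M det≡0ᴹ with sweep M n ≤-refl
... | M' , R , cleared = result
  where
  heads : ∀ c → M' zero (suc c) ≡ 0ℤ
  heads c = cleared (suc c) (subst (_< suc (toℕ c)) (sym (n∸n≡0 n)) (s≤s z≤n))
  a = M' zero zero
  D = minor M' zero
  lem₁ : ∀ a d → 1ℤ ℤ.* a ℤ.* d ≡ a ℤ.* d
  lem₁ = ℤSolver.solve-∀
  lem₂ : ∀ a w x → a ℤ.* w ℤ.* x ≡ a ℤ.* (w ℤ.* x)
  lem₂ = ℤSolver.solve-∀
  lem₃ : ∀ a s → ℤ.- s ℤ.* a ℤ.+ a ℤ.* s ≡ 0ℤ
  lem₃ = ℤSolver.solve-∀
  a*det : a ℤ.* det D ≡ 0ℤ
  a*det = begin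
    a ℤ.* det D                                   ≡⟨ lem₁ a (det D) ⟨
    1ℤ ℤ.* a ℤ.* det D                            ≡⟨ ℤ.+-identityʳ _ ⟨
    1ℤ ℤ.* a ℤ.* det D ℤ.+ 0ℤ                     ≡⟨ cong (ℤ._+_ (1ℤ ℤ.* a ℤ.* det D)) (sumℤ-zero {f = term M' ∘ suc} (λ c →
      trans (cong (λ h → sign (suc (toℕ c)) ℤ.* h ℤ.* det (minor M' (suc c))) (heads c))
            (cong (ℤ._* det (minor M' (suc c))) (ℤ.*-zeroʳ (sign (suc (toℕ c))))))) ⟨
    det M'                                        ≡⟨ det≡0 R det≡0ᴹ ⟩
    0ℤ                                            ∎
    where open ≡-Reasoning
  result : ∃ λ w → (∃ λ r → w r ≢ 0ℤ) × Kills w M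
  result with a ℤ.≟ 0ℤ
  ... | yes a≡0 = e , (zero , λ ()) , kills R e killed
    where
    e : Fin (suc n) → ℤ
    e zero    = 1ℤ
    e (suc _) = 0ℤ
    row : ∀ c → M' zero c ≡ 0ℤ
    row zero    = a≡0
    row (suc c) = heads c
    killed : Kills e M'
    killed c = sumℤ-zero {f = λ r → e r ℤ.* M' r c} (λ { zero → trans (ℤ.*-identityˡ _) (row c) ; (suc r) → refl })
  ... | no a≢0 with det≡0⇒killed D (*≡0⇒≡0 a≢0 a*det)
  ...   | w' , (r , w'r≢0) , killed' = w , (suc r , λ e → w'r≢0 (*≡0⇒≡0 a≢0 e)) , kills R w killed
    where
    S = sumℤ (λ r → w' r ℤ.* M' (suc r) zero)
    w : Fin (suc n) → ℤ
    w zero    = ℤ.- S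
    w (suc r) = a ℤ.* w' r
    scaled : ∀ c → sumℤ (λ r → a ℤ.* w' r ℤ.* M' (suc r) c) ≡ a ℤ.* sumℤ (λ r → w' r ℤ.* M' (suc r) c)
    scaled c = trans (sumℤ-cong (λ r → lem₂ a (w' r) (M' (suc r) c))) (sumℤ-*ˡ a (λ r → w' r ℤ.* M' (suc r) c))
    killed : Kills w M'
    killed zero    = trans (cong (ℤ._+_ (ℤ.- S ℤ.* a)) (scaled zero)) (lem₃ a S)
    killed (suc c) = cong₂ ℤ._+_ (trans (cong (ℤ.- S ℤ.*_) (heads c)) (ℤ.*-zeroʳ (ℤ.- S)))
      (trans (scaled (suc c)) (trans (cong (a ℤ.*_) (killed' c)) (ℤ.*-zeroʳ a)))

-- Choosing the columns

data Mask : ℕ → ℕ → Set where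
  []   : Mask 0 0
  skip : Mask n k → Mask (suc n) k
  take : Mask n k → Mask (suc n) (suc k)

select : Mask n k → Vec X n → Vec X k
select []       []       = []
select (skip M) (x ∷ xs) = select M xs
select (take M) (x ∷ xs) = x ∷ select M xs

masks : ∀ n k → List (Mask n k)
masks zero    zero    = [] ∷ []
masks zero    (suc k) = []
masks (suc n) zero    = map skip (masks n zero)
masks (suc n) (suc k) = map skip (masks n (suc k)) ++ map take (masks n k)

All-masks⁻ : ∀ {P : Mask n k → Set} → All P (masks n k) → ∀ M → P M
All-masks⁻ (p ∷ []) [] = p
All-masks⁻ {suc n} {zero}  ps (skip M) = All-masks⁻ (All.map⁻ ps) M
All-masks⁻ {suc n} {suc k} ps (skip M) = All-masks⁻ (All.map⁻ (All.++⁻ˡ (map skip (masks n (suc k))) ps)) M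
All-masks⁻ {suc n} {suc k} ps (take M) = All-masks⁻ (All.map⁻ (All.++⁻ʳ (map skip (masks n (suc k))) ps)) M

-- The selected columns are themselves `k` independent draws; both sides are scaled to avoid a
-- division.
∑-select : ∀ (xs : List X) (M : Mask n k) (f : Vec X k → ℕ) →
  length xs ^ k * (∑[ v ∈ tuples xs n ] f (select M v)) ≡ length xs ^ n * ∑ (tuples xs k) f
∑-select xs [] f = refl
∑-select {n = suc n} {k} xs (skip M) f = begin
  a ^ k * (∑[ v ∈ tuples xs (suc n) ] f (select (skip M) v))
    ≡⟨ cong (a ^ k *_) (trans (∑-tuples xs n _) (∑-const xs _)) ⟩
  a ^ k * (a * (∑[ v ∈ tuples xs n ] f (select M v)))             ≡⟨ e (a ^ k) a _ ⟩
  a * (a ^ k * (∑[ v ∈ tuples xs n ] f (select M v)))             ≡⟨ cong (a *_) (∑-select xs M f) ⟩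
  a * (a ^ n * ∑ (tuples xs k) f)                                 ≡⟨ *-assoc a (a ^ n) _ ⟨
  a ^ suc n * ∑ (tuples xs k) f                                   ∎
  where
  open ≡-Reasoning
  a = length xs
  e : ∀ x y z → x * (y * z) ≡ y * (x * z)
  e = solve-∀
∑-select {n = suc n} {suc k} xs (take M) f = begin
  a ^ suc k * (∑[ v ∈ tuples xs (suc n) ] f (select (take M) v))
    ≡⟨ cong (a ^ suc k *_) (∑-tuples xs n _) ⟩
  a ^ suc k * (∑[ x ∈ xs ] ∑[ v ∈ tuples xs n ] f (x ∷ select M v))                 ≡⟨ *-assoc a (a ^ k) _ ⟩
  a * (a ^ k * (∑[ x ∈ xs ] ∑[ v ∈ tuples xs n ] f (x ∷ select M v)))
    ≡⟨ cong (a *_) (∑-*ˡ xs (a ^ k) _) ⟨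
  a * (∑[ x ∈ xs ] a ^ k * (∑[ v ∈ tuples xs n ] f (x ∷ select M v)))
    ≡⟨ cong (a *_) (∑-cong xs (λ x → ∑-select xs M (λ v → f (x ∷ v)))) ⟩
  a * (∑[ x ∈ xs ] a ^ n * (∑[ v ∈ tuples xs k ] f (x ∷ v)))
    ≡⟨ cong (a *_) (∑-*ˡ xs (a ^ n) _) ⟩
  a * (a ^ n * (∑[ x ∈ xs ] ∑[ v ∈ tuples xs k ] f (x ∷ v)))                        ≡⟨ *-assoc a (a ^ n) _ ⟨
  a ^ suc n * (∑[ x ∈ xs ] ∑[ v ∈ tuples xs k ] f (x ∷ v))
    ≡⟨ cong (a ^ suc n *_) (∑-tuples xs k f) ⟨
  a ^ suc n * ∑ (tuples xs (suc k)) f                                               ∎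
  where
  open ≡-Reasoning
  a = length xs

-- Being killed by a functional does not depend on the order of the columns. So increasing
-- selections suffice, and determinants of permuted columns are never compared.
image : ∀ {n k} (cols : Fin k → Fin n) → Injective _≡_ _≡_ cols →
  ∃ λ (M : Mask n k) → ∀ {X : Set} {P : X → Set} (v : Vec X n) →
    (∀ j → P (lookup v (cols j))) → VecAll.All P (select M v)
image {zero}  {zero}  cols inj = [] , λ { [] _ → [] }
image {zero}  {suc k} cols inj with cols zero
... | ()
image {suc n} {k} cols inj with Fin.any? (λ j → cols j Fin.≟ zero)
... | no ∄ = skip (proj₁ IH) , λ { {P = P} (x ∷ v) ps → proj₂ IH v
               (λ j → subst (λ c → P (lookup (x ∷ v) c)) (sym (Fin.punchIn-punchOut (0≢ j))) (ps j)) }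
  where
  0≢ : ∀ j → zero ≢ cols j
  0≢ j e = ∄ (j , sym e)
  IH = image (λ j → punchOut (0≢ j)) (λ {i} {j} e → inj (Fin.punchOut-injective (0≢ i) (0≢ j) e))
image {suc n} {suc k} cols inj | yes (j₀ , e₀) =
  take (proj₁ IH) , λ { {P = P} (x ∷ v) ps → subst (λ c → P (lookup (x ∷ v) c)) e₀ (ps j₀) ∷ proj₂ IH v
    (λ j → subst (λ c → P (lookup (x ∷ v) c)) (sym (Fin.punchIn-punchOut (0≢ j))) (ps (punchIn j₀ j))) }
  where
  0≢ : ∀ j → zero ≢ cols (punchIn j₀ j)
  0≢ j e = Fin.punchInᵢ≢i j₀ j (inj (trans (sym e) (sym e₀)))
  IH = image (λ j → punchOut (0≢ j))
         (λ {i} {j} e → Fin.punchIn-injective j₀ i j (inj (Fin.punchOut-injective (0≢ i) (0≢ j) e)))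

-- The number of masks times `u ^ (n - k)` is one term in the binomial expansion of `(1 + u) ^ n`.
length-masks-≤ : ∀ u n k → length (masks n k) * u ^ n ≤ suc u ^ n * u ^ k
length-masks-≤ u zero    zero    = ≤-refl
length-masks-≤ u zero    (suc k) = z≤n
length-masks-≤ u (suc n) zero    = begin
  length (map skip (masks n 0)) * (u * u ^ n)    ≡⟨ cong (_* (u * u ^ n)) (length-map skip (masks n 0)) ⟩
  length (masks n 0) * (u * u ^ n)               ≡⟨ e₁ (length (masks n 0)) u (u ^ n) ⟩
  u * (length (masks n 0) * u ^ n)               ≤⟨ *-mono-≤ (n≤1+n u) (length-masks-≤ u n 0) ⟩
  suc u * (suc u ^ n * 1)                        ≡⟨ *-assoc (suc u) (suc u ^ n) 1 ⟨
  suc u ^ suc n * 1                              ∎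
  where
  open ≤-Reasoning
  e₁ : ∀ x y z → x * (y * z) ≡ y * (x * z)
  e₁ = solve-∀
length-masks-≤ u (suc n) (suc k) = begin
  length (masks (suc n) (suc k)) * (u * u ^ n)
    ≡⟨ cong (_* (u * u ^ n)) (trans (length-++ (map skip (masks n (suc k)))) (cong₂ _+_ (length-map skip (masks n (suc k))) (length-map take (masks n k)))) ⟩
  (N' + N) * (u * u ^ n)
    ≡⟨ e₁ N' N u (u ^ n) ⟩
  u * (N' * u ^ n) + u * (N * u ^ n)
    ≤⟨ +-mono-≤ (*-monoʳ-≤ u (length-masks-≤ u n (suc k))) (*-monoʳ-≤ u (length-masks-≤ u n k)) ⟩
  u * (suc u ^ n * (u * u ^ k)) + u * (suc u ^ n * u ^ k)
    ≡⟨ e₂ u (suc u ^ n) (u ^ k) ⟩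
  (1 + u) * suc u ^ n * (u * u ^ k) ∎
  where
  open ≤-Reasoning
  N = length (masks n k)
  N' = length (masks n (suc k))
  e₁ : ∀ a b u x → (a + b) * (u * x) ≡ u * (a * x) + u * (b * x)
  e₁ = solve-∀
  e₂ : ∀ u x y → u * (x * (u * y)) + u * (x * y) ≡ (1 + u) * x * (u * y)
  e₂ = solve-∀

-- (1 - 1/s)^s ≥ 1/4 for s = 2^(j+1), since (1 - 1/2s)² ≥ 1 - 1/s.
s^s≤4u^s : ∀ j u → suc u ≡ 2 ^ suc j → suc u ^ suc u ≤ 4 * u ^ suc u
s^s≤4u^s zero    .1 refl = ≤-refl
s^s≤4u^s (suc j) u  eq   = begin
  suc u ^ suc u                          ≡⟨ cong₂ _^_ u≡ u≡ ⟩
  (2 * s) ^ (2 * s)                      ≡⟨ ^-*-assoc (2 * s) 2 s ⟨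
  ((2 * s) ^ 2) ^ s                      ≡⟨ cong (_^ s) (e₁ s) ⟩
  (4 * s * s) ^ s                        ≡⟨ ^-distribʳ-* s (4 * s) s ⟩
  (4 * s) ^ s * s ^ s                    ≤⟨ *-monoʳ-≤ ((4 * s) ^ s) (s^s≤4u^s j v v≡) ⟩
  (4 * s) ^ s * (4 * v ^ s)              ≡⟨ e₂ ((4 * s) ^ s) (v ^ s) ⟩
  4 * ((4 * s) ^ s * v ^ s)              ≡⟨ cong (4 *_) (^-distribʳ-* s (4 * s) v) ⟨
  4 * (4 * s * v) ^ s
    ≤⟨ *-monoʳ-≤ 4 (^-monoˡ-≤ s (≤-trans (m≤m+n _ 1) (≤-reflexive (e₃ v)))) ⟩
  4 * ((1 + 2 * v) ^ 2) ^ s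
    ≡⟨ cong (λ x → 4 * (x ^ 2) ^ s) (suc-injective (trans (e₄ v) (sym u≡))) ⟩
  4 * (u ^ 2) ^ s                        ≡⟨ cong (4 *_) (^-*-assoc u 2 s) ⟩
  4 * u ^ (2 * s)                        ≡⟨ cong (λ x → 4 * u ^ x) u≡ ⟨
  4 * u ^ suc u                          ∎
  where
  open ≤-Reasoning
  v = pred (2 ^ suc j)
  s = suc v
  v≡ : suc v ≡ 2 ^ suc j
  v≡ = suc-pred (2 ^ suc j) {{m^n≢0 2 (suc j)}}
  u≡ : suc u ≡ 2 * s
  u≡ = trans eq (cong (2 *_) (sym v≡))
  e₁ : ∀ s → (2 * s) ^ 2 ≡ 4 * s * s
  e₁ s = trans (cong (2 * s *_) (*-identityʳ (2 * s))) (lem s)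
    where
    lem : ∀ s → 2 * s * (2 * s) ≡ 4 * s * s
    lem = solve-∀
  e₂ : ∀ x y → x * (4 * y) ≡ 4 * (x * y)
  e₂ = solve-∀
  e₃ : ∀ v → 4 * (1 + v) * v + 1 ≡ (1 + 2 * v) ^ 2
  e₃ v = trans (lem v) (cong ((1 + 2 * v) *_) (sym (*-identityʳ (1 + 2 * v))))
    where
    lem : ∀ v → 4 * (1 + v) * v + 1 ≡ (1 + 2 * v) * (1 + 2 * v)
    lem = solve-∀
  e₄ : ∀ v → 2 + 2 * v ≡ 2 * (1 + v)
  e₄ = solve-∀

-- With `s = 2 ^ suc j` and `u = s - 1`, `length-masks-≤` gives `(s/u)^n * u^k`. Raising `n` to
-- `s * k` turns the first factor into at most `4 ^ k`.
masks-few : ∀ j {n k} → n ≤ 2 ^ suc j * k → length (masks n k) ≤ (4 * 2 ^ suc j) ^ k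
masks-few j {n} {k} n≤ = *-cancelʳ-≤ _ _ (u ^ (s * k)) {{m^n≢0 u (s * k) {{u≢0}}}} (begin
  N * u ^ (s * k)                        ≡⟨ cong (λ x → N * u ^ x) (m+[n∸m]≡n n≤s) ⟨
  N * u ^ (n + r)                        ≡⟨ cong (N *_) (^-distribˡ-+-* u n r) ⟩
  N * (u ^ n * u ^ r)                    ≡⟨ *-assoc N (u ^ n) (u ^ r) ⟨
  N * u ^ n * u ^ r                      ≤⟨ *-mono-≤ (length-masks-≤ u n k) (^-monoˡ-≤ r (n≤1+n u)) ⟩
  s ^ n * u ^ k * s ^ r                  ≡⟨ e₁ (s ^ n) (u ^ k) (s ^ r) ⟩
  s ^ n * s ^ r * u ^ k
    ≡⟨ cong (_* u ^ k) (trans (sym (^-distribˡ-+-* s n r)) (cong (s ^_) (m+[n∸m]≡n n≤s))) ⟩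
  s ^ (s * k) * u ^ k                    ≡⟨ cong (_* u ^ k) (^-*-assoc s s k) ⟨
  (s ^ s) ^ k * u ^ k                    ≤⟨ *-mono-≤ (^-monoˡ-≤ k (s^s≤4u^s j u s≡)) (^-monoˡ-≤ k (n≤1+n u)) ⟩
  (4 * u ^ s) ^ k * s ^ k
    ≡⟨ cong (_* s ^ k) (trans (^-distribʳ-* k 4 (u ^ s)) (cong (4 ^ k *_) (^-*-assoc u s k))) ⟩
  4 ^ k * u ^ (s * k) * s ^ k            ≡⟨ e₂ (4 ^ k) (u ^ (s * k)) (s ^ k) ⟩
  4 ^ k * s ^ k * u ^ (s * k)
    ≡⟨ cong (_* u ^ (s * k)) (trans (sym (^-distribʳ-* k 4 s)) (cong (λ x → (4 * x) ^ k) s≡)) ⟩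
  (4 * 2 ^ suc j) ^ k * u ^ (s * k)      ∎)
  where
  open ≤-Reasoning
  u = pred (2 ^ suc j)
  s = suc u
  N = length (masks n k)
  s≡ : s ≡ 2 ^ suc j
  s≡ = suc-pred (2 ^ suc j) {{m^n≢0 2 (suc j)}}
  n≤s : n ≤ s * k
  n≤s = subst (λ x → n ≤ x * k) (sym s≡) n≤
  r = s * k ∸ n
  u≢0 : NonZero u
  u≢0 = >-nonZero (s≤s⁻¹ (subst (2 ≤_) (sym s≡) (*-monoʳ-≤ 2 (m^n>0 2 j))))
  e₁ : ∀ x y z → x * y * z ≡ x * z * y
  e₁ = solve-∀
  e₂ : ∀ x y z → x * y * z ≡ x * z * y
  e₂ = solve-∀

n<2^n : ∀ n → n < 2 ^ n
n<2^n zero    = ≤-refl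
n<2^n (suc n) = begin-strict
  1 + n              ≤⟨ n<2^n n ⟩
  2 ^ n              <⟨ m<m+n (2 ^ n) (m^n>0 2 n) ⟩
  2 ^ n + 2 ^ n      ≡⟨ cong (2 ^ n +_) (+-identityʳ _) ⟨
  2 ^ suc n          ∎
  where open ≤-Reasoning

-- The search descends from `f` and stops where one more halving would fall below `n`.
dyadic : ∀ n k → k ≤ n → ∀ f → n ≤ 2 ^ f * k → ∃ λ j → n ≤ 2 ^ j * k × 2 ^ j * k ≤ 2 * n
dyadic n k k≤n zero    n≤ = 0 , n≤ , ≤-trans (≤-reflexive (*-identityˡ k)) (≤-trans k≤n (m≤m+n n _))
dyadic n k k≤n (suc f) n≤ with n ≤? 2 ^ f * k
... | yes n≤' = dyadic n k k≤n f n≤'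
... | no n≰   = suc f , n≤ , ≤-trans (≤-reflexive (*-assoc 2 (2 ^ f) k)) (*-monoʳ-≤ 2 (<⇒≤ (≰⇒> n≰)))

-- The union bound and the parameters

tabulate-· : ∀ (w : Fin k → ℤ) x → tabulate w · x ≡ sumℤ (λ r → w r ℤ.* lookup x r)
tabulate-· w []      = refl
tabulate-· w (a ∷ x) = cong (ℤ._+_ (w zero ℤ.* a)) (tabulate-· (w ∘ suc) x)

E-nonempty : ∀ j → 1 ≤ length (E j)
E-nonempty zero    = s≤s z≤n
E-nonempty (suc j) = subst (1 ≤_) (sym (DE.N-suc j)) (*-mono-≤ (E-nonempty j) (E-nonempty j))

Ω-nonempty : ∀ k j → 1 ≤ length (Ω k j)
Ω-nonempty k j = subst (1 ≤_) (sym (length-tuples (E j) k)) (m^n>0 (length (E j)) {{>-nonZero (E-nonempty j)}} k)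

-- On average a tuple `v` has fewer than one dependent selection, so some `v` has none.
exists-general-position : ∀ {P : Vector k → Set} {A} n → All P A → 1 ≤ length A → ∀ Θ c →
  Θ * Subspaces.dependent A k ≤ c * length A ^ k → length (masks n k) * c < Θ →
  ∃ λ (v : Vec (Vector k) n) → VecAll.All P v × (∀ M → LinInd (select M v))
exists-general-position {k} {P} {A} n all 1≤a Θ c rare small = conclude (∑<length⇒∃-zero bad (All-tuples all n) few)
  where
  open ≤-Reasoning
  a = length A
  N = length (masks n k)
  D = Subspaces.dependent A k
  bad : Vec (Vector k) n → ℕ
  bad v = ∑[ M ∈ masks n k ] ι (¬? (linInd? (select M v)))
  Total = ∑ (tuples A n) bad
  total : a ^ k * Total ≡ N * (a ^ n * D)
  total = begin-equality
    a ^ k * Total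
      ≡⟨ cong (a ^ k *_) (∑-swap (tuples A n) (masks n k) _) ⟩
    a ^ k * (∑[ M ∈ masks n k ] ∑[ v ∈ tuples A n ] ι (¬? (linInd? (select M v))))
      ≡⟨ ∑-*ˡ (masks n k) (a ^ k) _ ⟨
    (∑[ M ∈ masks n k ] a ^ k * (∑[ v ∈ tuples A n ] ι (¬? (linInd? (select M v)))))
      ≡⟨ ∑-cong (masks n k) (λ M → ∑-select A M (λ w → ι (¬? (linInd? w)))) ⟩
    (∑[ _ ∈ masks n k ] a ^ n * D)
      ≡⟨ ∑-const (masks n k) (a ^ n * D) ⟩
    N * (a ^ n * D) ∎
  e₁ : ∀ x y z → x * (y * z) ≡ y * (x * z)
  e₁ = solve-∀
  e₂ : ∀ θ N x D → θ * (N * (x * D)) ≡ N * x * (θ * D)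
  e₂ = solve-∀
  e₃ : ∀ N x s y → N * x * (s * y) ≡ y * (N * s * x)
  e₃ = solve-∀
  few : Total < length (tuples A n)
  few = subst (Total <_) (sym (length-tuples A n)) (*-cancelˡ-< Θ _ _ (*-cancelˡ-< (a ^ k) _ _ (begin-strict
    a ^ k * (Θ * Total)             ≡⟨ e₁ (a ^ k) Θ Total ⟩
    Θ * (a ^ k * Total)             ≡⟨ cong (Θ *_) total ⟩
    Θ * (N * (a ^ n * D))           ≡⟨ e₂ Θ N (a ^ n) D ⟩
    N * a ^ n * (Θ * D)             ≤⟨ *-monoʳ-≤ (N * a ^ n) rare ⟩
    N * a ^ n * (c * a ^ k)         ≡⟨ e₃ N (a ^ n) c (a ^ k) ⟩
    a ^ k * (N * c * a ^ n)         <⟨ *-monoʳ-< (a ^ k) {{m^n≢0 a k {{>-nonZero 1≤a}}}}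
                                         (*-monoˡ-< (a ^ n) {{m^n≢0 a n {{>-nonZero 1≤a}}}} small) ⟩
    a ^ k * (Θ * a ^ n)             ∎)))
  conclude : (∃ λ v → VecAll.All P v × bad v ≡ 0) → ∃ λ v → VecAll.All P v × (∀ M → LinInd (select M v))
  conclude (v , all , none) = v , all , λ M → decidable-stable (linInd? (select M v)) (λ dep →
    0≢1+n (trans (sym (All-masks⁻ (∑≡0⇒All-zero (masks n k) _ none) M)) (ι-yes (¬? (linInd? (select M v))) dep)))

module _ (τ : ℕ) (hτ : 2 * 79 ^ τ ≤ 80 ^ τ) (j : ℕ) where
  -- `2 ^ gainExponent` is `θ` squared. After the first doubling, `B` uses `τ * gainExponent`
  -- further ones and `A` twice as many.
  gainExponent doublings : ℕ
  gainExponent = (j + 8) * 2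
  doublings = suc (τ * gainExponent + (τ * gainExponent + 0))

  private
    θ = 2 ^ (j + 8)

  dependent-count : ∀ k → 1 ≤ k →
    θ ^ k * Subspaces.dependent (Ω k doublings) k ≤ 16 ^ k * length (Ω k doublings) ^ k
  dependent-count k 1≤k = begin
    θ ^ k * Subspaces.dependent (Ω k doublings) k
      ≤⟨ S.dependent-rare (kernelCount-rare τ hτ gainExponent) (λ ind 1≤ → kernelCount-gain τ hτ gainExponent ind 1≤ (τ * gainExponent + 0))
           (θ ^ k) (2 * 4 ^ k) (Θ≤ e k≤2e) (Θ≤ L k≤2L) C≥ k ≤-refl ⟩
    k * (2 * 4 ^ k) * a ^ k
      ≤⟨ *-monoˡ-≤ (a ^ k) (begin
           k * (2 * 4 ^ k)           ≤⟨ *-mono-≤ (<⇒≤ (n<2^n k)) (*-monoˡ-≤ (4 ^ k) (^-monoʳ-≤ 2 1≤k)) ⟩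
           2 ^ k * (2 ^ k * 4 ^ k)   ≡⟨ cong (2 ^ k *_) (^-distribʳ-* k 2 4) ⟨
           2 ^ k * 8 ^ k             ≡⟨ ^-distribʳ-* k 2 8 ⟨
           16 ^ k                    ∎) ⟩
    16 ^ k * a ^ k ∎
    where
    open ≤-Reasoning
    a = length (Ω k doublings)
    -- A balanced choice: `2 * L` and `2 * e` are both at least `k`, so `T ^ L` and `T ^ e` both
    -- reach `θ ^ k`.
    L = suc ⌊ k /2⌋
    e = ⌈ k /2⌉
    module S = Singularity (2 ^ gainExponent) (Ω k doublings) (Ω k (suc (τ * gainExponent + 0))) L e (cong suc (⌊n/2⌋+⌈n/2⌉≡n k))
                 (m^n>0 2 gainExponent) (Ω-nonempty k doublings) (Ω-nonempty k (suc (τ * gainExponent + 0)))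
    k≤2e : k ≤ 2 * e
    k≤2e = begin
      k                ≡⟨ ⌊n/2⌋+⌈n/2⌉≡n k ⟨
      ⌊ k /2⌋ + e      ≤⟨ +-monoˡ-≤ e (⌊n/2⌋≤⌈n/2⌉ k) ⟩
      e + e            ≡⟨ cong (e +_) (+-identityʳ e) ⟨
      2 * e            ∎
    k≤2L : k ≤ 2 * L
    k≤2L = begin
      k                ≡⟨ ⌊n/2⌋+⌈n/2⌉≡n k ⟨
      ⌊ k /2⌋ + e      ≤⟨ +-mono-≤ (n≤1+n ⌊ k /2⌋) (⌊n/2⌋-mono (n≤1+n (suc k))) ⟩
      L + L            ≡⟨ cong (L +_) (+-identityʳ L) ⟨
      2 * L            ∎
    Θ≤ : ∀ x → k ≤ 2 * x → θ ^ k ≤ (2 ^ gainExponent) ^ x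
    Θ≤ x k≤ = begin
      θ ^ k            ≤⟨ ^-monoʳ-≤ θ {{m^n≢0 2 (j + 8)}} k≤ ⟩
      θ ^ (2 * x)      ≡⟨ ^-*-assoc θ 2 x ⟨
      (θ ^ 2) ^ x      ≡⟨ cong (_^ x) (^-*-assoc 2 (j + 8) 2) ⟩
      (2 ^ gainExponent) ^ x      ∎
    C≥ : ∀ d → d < k → 2 + 2 ^ e * 2 ^ d ≤ 2 * 4 ^ k
    C≥ d d<k = begin
      2 + 2 ^ e * 2 ^ d
        ≤⟨ +-mono-≤ (≤-trans (s≤s (s≤s z≤n)) (^-monoʳ-≤ 4 1≤k)) (*-mono-≤ (^-monoʳ-≤ 2 (⌈n/2⌉≤n k)) (^-monoʳ-≤ 2 (<⇒≤ d<k))) ⟩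
      4 ^ k + 2 ^ k * 2 ^ k  ≡⟨ cong (4 ^ k +_) (^-distribʳ-* k 2 2) ⟨
      4 ^ k + 4 ^ k          ≡⟨ cong (4 ^ k +_) (+-identityʳ _) ⟨
      2 * 4 ^ k              ∎

  few-masks : ∀ n k → 1 ≤ k → n ≤ 2 ^ suc j * k → length (masks n k) * 16 ^ k < θ ^ k
  few-masks n k 1≤k n≤ = begin-strict
    length (masks n k) * 16 ^ k         ≤⟨ *-monoˡ-≤ (16 ^ k) (masks-few j n≤) ⟩
    (4 * 2 ^ suc j) ^ k * 16 ^ k        ≡⟨ ^-distribʳ-* k (4 * 2 ^ suc j) 16 ⟨
    (4 * 2 ^ suc j * 16) ^ k            <⟨ ^-monoˡ-< k {{>-nonZero 1≤k}} (begin-strict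
       4 * 2 ^ suc j * 16                  ≡⟨ e₄ (2 ^ j) ⟩
       -- The origin of the 8 in `j + 8`: the constants 4, 2 and 16 multiply to less than `2 ^ 8`.
       2 ^ j * 128                         <⟨ *-monoʳ-< (2 ^ j) {{m^n≢0 2 j}} {128} {256} (≤ᵇ⇒≤ 129 256 tt) ⟩
       2 ^ j * 2 ^ 8                       ≡⟨ ^-distribˡ-+-* 2 j 8 ⟨
       2 ^ (j + 8)                         ∎) ⟩
    θ ^ k                               ∎
    where
    open ≤-Reasoning
    e₄ : ∀ x → 4 * (2 * x) * 16 ≡ x * 128
    e₄ = solve-∀

  bounded-general-position : ∀ n k → 1 ≤ k → n ≤ 2 ^ suc j * k →
    ∃ λ (v : Vec (Vector k) n) → VecAll.All (VecAll.All (λ x → ∣ x ∣ ≤ 2 ^ doublings)) v × (∀ M → LinInd (select M v))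
  bounded-general-position n k 1≤k n≤ = exists-general-position n (All-tuples (E-bounded doublings) k) (Ω-nonempty k doublings)
    (θ ^ k) (16 ^ k) (dependent-count k 1≤k) (few-masks n k 1≤k n≤)

-- A vanishing minor would yield a nonzero functional that kills `k` columns spanning the whole
-- space.
generalPosition⇒MDS : ∀ (v : Vec (Vector k) n) → (∀ M → LinInd (select M v)) → IsMDS (λ r c → lookup (lookup v c) r)
generalPosition⇒MDS {k} v indep cols inj det≡0 with det≡0⇒killed _ det≡0 | image cols inj
... | w , (r , wr≢0) , killed | M , selected = wr≢0 (begin
  w r                       ≡⟨ Vec.lookup∘tabulate w r ⟨
  lookup (tabulate w) r     ≡⟨ cong (λ u → lookup u r) (run≡[]⇒annihilator≡𝟎 (tabulate w) (select M v)
                                 (selected v (λ j → trans (tabulate-· w _) (killed j)))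
                                 (+-cancelʳ-≡ k _ _ (indep M))) ⟩
  lookup 𝟎 r                ≡⟨ Vec.lookup-replicate r 0ℤ ⟩
  0ℤ                        ∎)
  where open ≡-Reasoning

abstract
  -- 56 is the least such exponent, as log 2 / log (80/79) is about 55.1.
  halvingTime : ∃ λ τ → 1 ≤ τ × 2 * 79 ^ τ ≤ 80 ^ τ
  halvingTime = 56 , s≤s z≤n , ≤ᵇ⇒≤ (2 * 79 ^ 56) (80 ^ 56) tt

-- The exponent of 2 is `1 + 32 τ + 4 τ j`. The part with `j` is at most `(2n/k)^(4τ)`, and the rest
-- is at most `2^(37τ)`, hence at most `(2n/k)^(37τ)`; this gives 41 = 4 + 37.
entries-small : ∀ τ j n k → 1 ≤ τ → k ≤ n → 2 ^ j * k ≤ 2 * n →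
  2 ^ suc (τ * ((j + 8) * 2) + (τ * ((j + 8) * 2) + 0)) * k ^ (41 * τ) ≤ (41 * τ * n) ^ (41 * τ)
entries-small τ j n k 1≤τ k≤n 2^jk≤ = begin
  2 ^ suc (τ * ((j + 8) * 2) + (τ * ((j + 8) * 2) + 0)) * k ^ (41 * τ)
    ≡⟨ cong₂ (λ x y → 2 ^ x * k ^ y) (e₁ τ j) (e₂ τ) ⟩
  2 ^ (1 + 32 * τ + j * (4 * τ)) * k ^ (4 * τ + 37 * τ)
    ≡⟨ cong₂ _*_ (trans (^-distribˡ-+-* 2 (1 + 32 * τ) (j * (4 * τ))) (cong (2 ^ (1 + 32 * τ) *_) (sym (^-*-assoc 2 j (4 * τ)))))
                 (^-distribˡ-+-* k (4 * τ) (37 * τ)) ⟩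
  2 ^ (1 + 32 * τ) * (2 ^ j) ^ (4 * τ) * (k ^ (4 * τ) * k ^ (37 * τ))
    ≡⟨ e₃ (2 ^ (1 + 32 * τ)) ((2 ^ j) ^ (4 * τ)) (k ^ (4 * τ)) (k ^ (37 * τ)) ⟩
  2 ^ (1 + 32 * τ) * ((2 ^ j) ^ (4 * τ) * k ^ (4 * τ)) * k ^ (37 * τ)
    ≡⟨ cong (λ x → 2 ^ (1 + 32 * τ) * x * k ^ (37 * τ)) (^-distribʳ-* (4 * τ) (2 ^ j) k) ⟨
  2 ^ (1 + 32 * τ) * (2 ^ j * k) ^ (4 * τ) * k ^ (37 * τ)
    ≤⟨ *-mono-≤ (*-mono-≤ (^-monoʳ-≤ 2 (begin
          1 + 32 * τ      ≤⟨ +-monoˡ-≤ (32 * τ) 1≤τ ⟩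
          τ + 32 * τ      ≤⟨ m≤m+n _ (4 * τ) ⟩
          τ + 32 * τ + 4 * τ ≡⟨ e₄ τ ⟩
          37 * τ          ∎)) (^-monoˡ-≤ (4 * τ) 2^jk≤)) (^-monoˡ-≤ (37 * τ) k≤n) ⟩
  2 ^ (37 * τ) * (2 * n) ^ (4 * τ) * n ^ (37 * τ)
    ≡⟨ e₅ (2 ^ (37 * τ)) ((2 * n) ^ (4 * τ)) (n ^ (37 * τ)) ⟩
  (2 * n) ^ (4 * τ) * (2 ^ (37 * τ) * n ^ (37 * τ))
    ≡⟨ cong ((2 * n) ^ (4 * τ) *_) (^-distribʳ-* (37 * τ) 2 n) ⟨
  (2 * n) ^ (4 * τ) * (2 * n) ^ (37 * τ)
    ≡⟨ trans (sym (^-distribˡ-+-* (2 * n) (4 * τ) (37 * τ))) (cong ((2 * n) ^_) (sym (e₂ τ))) ⟩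
  (2 * n) ^ (41 * τ)
    ≤⟨ ^-monoˡ-≤ (41 * τ) (*-monoˡ-≤ n (*-mono-≤ {2} {41} (s≤s (s≤s z≤n)) 1≤τ)) ⟩
  (41 * τ * n) ^ (41 * τ) ∎
  where
  open ≤-Reasoning
  e₁ : ∀ τ j → 1 + (τ * ((j + 8) * 2) + (τ * ((j + 8) * 2) + 0)) ≡ 1 + 32 * τ + j * (4 * τ)
  e₁ = solve-∀
  e₂ : ∀ τ → 41 * τ ≡ 4 * τ + 37 * τ
  e₂ = solve-∀
  e₃ : ∀ x y z w → x * y * (z * w) ≡ x * (y * z) * w
  e₃ = solve-∀
  e₄ : ∀ τ → τ + 32 * τ + 4 * τ ≡ 37 * τ
  e₄ = solve-∀
  e₅ : ∀ x y z → x * y * z ≡ y * (x * z)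
  e₅ = solve-∀

smallMDS : ∀ τ → 1 ≤ τ → 2 * 79 ^ τ ≤ 80 ^ τ → ∀ c → c ≡ 41 * τ → ∀ n k → 1 ≤ k → k ≤ n →
  ∃ λ m → 1 ≤ m × m * k ^ c ≤ (c * n) ^ c ×
  ∃ λ (A : Matrix k n) → (∀ i j → ∣ A i j ∣ ≤ m) × IsMDS A
smallMDS τ 1≤τ hτ c c≡ n k 1≤k k≤n =
  fromExponent (dyadic n k k≤n n (≤-trans (<⇒≤ (n<2^n n)) (m≤m*n (2 ^ n) k {{>-nonZero 1≤k}})))
  where
  Goal : Set
  Goal = ∃ λ m → 1 ≤ m × m * k ^ c ≤ (c * n) ^ c ×
    ∃ λ (A : Matrix k n) → (∀ i j → ∣ A i j ∣ ≤ m) × IsMDS A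
  fromVectors : ∀ j → 2 ^ j * k ≤ 2 * n →
    (∃ λ (v : Vec (Vector k) n) → VecAll.All (VecAll.All (λ x → ∣ x ∣ ≤ 2 ^ doublings τ hτ j)) v × (∀ M → LinInd (select M v))) → Goal
  fromVectors j ≤2n (v , bounded , indep) =
    2 ^ doublings τ hτ j , m^n>0 2 (doublings τ hτ j) ,
    subst (λ c → 2 ^ doublings τ hτ j * k ^ c ≤ (c * n) ^ c) (sym c≡) (entries-small τ j n k 1≤τ k≤n ≤2n) ,
    (λ r c → lookup (lookup v c) r) , (λ r c → VecAll.lookup⁺ (VecAll.lookup⁺ bounded c) r) , generalPosition⇒MDS v indep
  fromExponent : (∃ λ j → n ≤ 2 ^ j * k × 2 ^ j * k ≤ 2 * n) → Goal
  -- The factor 2 given away here keeps the base `2 ^ suc j` of `masks-few` at least 2, even for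
  -- `j = 0`.
  fromExponent (j , n≤ , ≤2n) = fromVectors j ≤2n
    (bounded-general-position τ hτ j n k 1≤k (≤-trans n≤ (*-monoˡ-≤ k (m≤m+n (2 ^ j) _))))

theorem1p3 : ∃ λ (c : ℕ) → 1 ≤ c ×
    ((n k : ℕ) → 1 ≤ k → k ≤ n →
    ∃ λ (m : ℕ) → 1 ≤ m × m * k ^ c ≤ (c * n) ^ c ×
    ∃ λ (A : Matrix k n) → (∀ i j → ∣ A i j ∣ ≤ m) × IsMDS A)
theorem1p3 = 41 * proj₁ halvingTime , *-mono-≤ {1} {41} (s≤s z≤n) (proj₁ (proj₂ halvingTime)) ,
  smallMDS (proj₁ halvingTime) (proj₁ (proj₂ halvingTime)) (proj₂ (proj₂ halvingTime)) (41 * proj₁ halvingTime) refl
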